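{- Let $\diamondsuit\in\{\square,\mathrm{v},\mathrm{h}\}$, $n\ge1$, $Z=z_1+\cdots+z_n$ and $Z^*=z_1^{ -1}+\cdots+z_n^{ -1}$. Then, as formal Laurent series in $z_1,\dots,z_n$ with operator coefficients, $$B^\diamondsuit(Z)=R(Z)\,\Omega[-f_\diamondsuit[Z]]\,\Omega[ZX]\,\Omega[-(Z+Z^*)X]^\perp .$$
   Context: $\Lambda$ is the ring of symmetric functions in $X=x_1+x_2+\cdots$ (rational coefficients, extended by auxiliary indeterminates as needed), with the scalar product for which Schur functions are orthonormal. Plethystic notation: $P[A]$ is obtained from $P\in\Lambda$ by expressing $P$ in power sums and replacing $p_k$ by $p_k[A]$, where $p_k[A]$ raises every indeterminate in $A$ to the $k$-th power and $p_k[A-B]=p_k[A]-p_k[B]$; $\Omega[A]=\exp(\sum_{k\ge1}p_k[A]/k)$, so that $\Omega[A-B]=\prod_{b\in B}(1-b)/\prod_{a\in A}(1-a)$ when $A,B$ are sums of monomials. $P^\perp$ is the operator on $\Lambda$ adjoint to multiplication by $P$ (skewing is always in the $X$ variables); in particular $\Omega[XA]^\perp P[X]=P[X+A]$. A product such as $\Omega[ZX]\,\Omega[\cdots]^\perp$ means: skew first, then multiply. The symbols: $\square$ (single cell), $\mathrm{h}$ (horizontal domino), $\mathrm{v}$ (vertical domino). Put $f_\square=s_1+s_{(1^2)}$, $f_{\mathrm{h}}=s_2$, $f_{\mathrm{v}}=s_{(1^2)}$, so $\Omega[-f_{\mathrm v}[Z]]=\prod_{i<j}(1-z_iz_j)$,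 $\Omega[-f_{\mathrm h}[Z]]=\prod_{i\le j}(1-z_iz_j)$, $\Omega[-f_\square[Z]]=\prod_i(1-z_i)\prod_{i<j}(1-z_iz_j)$. Also $R(Z)=\prod_{1\le i<j\le n}(1-z_jz_i^{ -1})$. Bernstein's operators $B_r\in\mathrm{End}(\Lambda)$ ($r\in\mathbb{Z}$) are defined by $\sum_{r\in\mathbb{Z}}B_rz^r=\Omega[zX]\,\Omega[-z^{ -1}X]^\perp$. For $\nu\in\mathbb{Z}^n$ put $B_\nu=B_{\nu_1}\circ\cdots\circ B_{\nu_n}$, $B^\diamondsuit_\nu=\Omega[-f_\diamondsuit]^\perp\circ B_\nu\circ\Omega[f_\diamondsuit]^\perp$, and $B^\diamondsuit(Z)=\sum_{\nu\in\mathbb{Z}^n}z^\nu B^\diamondsuit_\nu$. -}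

module Defs where

open import Algebra.Bundles using (CommutativeRing; RawRing)
open import Data.Bool.Base using (if_then_else_)
import Data.Fin.Base as Fin
import Data.Fin.Properties as Fin
open import Data.Integer.Base as ℤ using (ℤ; +_; -[1+_]; _⊖_)
import Data.Integer.Properties as ℤ
open import Data.List.Base as List using (List; []; _∷_; _++_)
open import Data.List.Relation.Unary.All using (All)
open import Data.List.Relation.Unary.Linked using (Linked)
open import Data.Nat.Base as ℕ using (ℕ; zero; suc; pred; NonZero; _!)
open import Data.Nat.Properties using (_!≢0)
open import Data.Product.Base using (_×_; _,_; map₁)
open import Data.Rational.Base as ℚ using (ℚ; 0ℚ; 1ℚ)
open import Data.Vec.Base as Vec using (Vec; []; _∷_)
open import Data.Vec.Properties using (≡-dec)
open import Function.Base using (_∘_; id)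
open import Level using (0ℓ)
open import Relation.Binary.PropositionalEquality using (_≡_; _≢_)
open import Relation.Nullary.Decidable using (does)

import Algebra.Definitions.RawSemiring as RawSemiringDefs

-- Rings with the operations used by plethystic notation: con is the scalar
-- embedding, and ψ[1+ k ] raises every indeterminate to the power 1 + k,
-- so that p_{1+k}[A] = ψ[1+ k ] A.

record PlethysticRing : Set₁ where
  field
    rawRing : RawRing 0ℓ 0ℓ
  open RawRing rawRing public
  field
    con     : ℚ → Carrier
    ψ[1+_]  : ℕ → Carrier → Carrier

module RingOps (R : RawRing 0ℓ 0ℓ) where
  open RawRing R
  open RawSemiringDefs rawSemiring public using (sum; _^_)

  sum≤ : ℕ → (ℕ → Carrier) → Carrier
  sum≤ n a = sum {suc n} (a ∘ Fin.toℕ)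

  productList : List Carrier → Carrier
  productList = List.foldr _*_ 1#

  -- Laplace expansion along the first row.
  det : ∀ {n} → (Fin.Fin n → Fin.Fin n → Carrier) → Carrier
  det {zero}  M = 1#
  det {suc n} M = sum λ j →
    (- 1#) ^ Fin.toℕ j * (M Fin.zero j * det (λ i k → M (Fin.suc i) (Fin.punchIn j k)))

  -- Sequences are power series in a variable t.
  _⊛_ : (ℕ → Carrier) → (ℕ → Carrier) → (ℕ → Carrier)
  (a ⊛ b) d = sum≤ d λ i → a i * b (d ℕ.∸ i)

  _^⊛_ : (ℕ → Carrier) → ℕ → (ℕ → Carrier)
  a ^⊛ zero  = λ { zero → 1# ; (suc _) → 0# }
  a ^⊛ suc m = a ⊛ (a ^⊛ m)

module ΩOf (A : PlethysticRing) where
  open PlethysticRing A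
  open RingOps rawRing

  -- The power series exp(a) = Σ_m a^m / m!, for a with zero constant term;
  -- then a^m has no term in t^d when m > d.
  exp : (ℕ → Carrier) → (ℕ → Carrier)
  exp a d = sum≤ d λ m → con ((+ 1 ℚ./ (m !)) {{m !≢0}}) * (a ^⊛ m) d

  -- Ω a d is the part of Ω[a] = exp(Σ_{k≥1} p_k[a]/k) of degree d in a, that
  -- is, the coefficient of t^d in exp(Σ_{k≥1} p_k[a] t^k/k).
  Ω : Carrier → (ℕ → Carrier)
  Ω a = exp λ { zero → 0# ; (suc k) → con (+ 1 ℚ./ suc k) * ψ[1+ k ] a }

-- Λ is ℚ[p_1, p_2, ...], the free commutative ℚ-algebra on the power sums,
-- as terms modulo the congruence _≈_; p[1+ k ] is p_{1+k}.

infix  8 -_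
infixl 7 _*_
infixl 6 _+_
infix  4 _≈_

data Λ : Set where
  con    : ℚ → Λ
  p[1+_] : ℕ → Λ
  _+_    : Λ → Λ → Λ
  _*_    : Λ → Λ → Λ
  -_     : Λ → Λ

data _≈_ : Λ → Λ → Set where
  ≈-refl      : ∀ {P} → P ≈ P
  ≈-sym       : ∀ {P Q} → P ≈ Q → Q ≈ P
  ≈-trans     : ∀ {P Q S} → P ≈ Q → Q ≈ S → P ≈ S
  +-cong      : ∀ {P P′ Q Q′} → P ≈ P′ → Q ≈ Q′ → P + Q ≈ P′ + Q′
  *-cong      : ∀ {P P′ Q Q′} → P ≈ P′ → Q ≈ Q′ → P * Q ≈ P′ * Q′
  -‿cong      : ∀ {P P′} → P ≈ P′ → - P ≈ - P′
  +-assoc     : ∀ P Q S → (P + Q) + S ≈ P + (Q + S)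
  +-comm      : ∀ P Q → P + Q ≈ Q + P
  +-identityˡ : ∀ P → con 0ℚ + P ≈ P
  -‿inverseˡ  : ∀ P → - P + P ≈ con 0ℚ
  *-assoc     : ∀ P Q S → (P * Q) * S ≈ P * (Q * S)
  *-comm      : ∀ P Q → P * Q ≈ Q * P
  *-identityˡ : ∀ P → con 1ℚ * P ≈ P
  distribˡ    : ∀ P Q S → P * (Q + S) ≈ P * Q + P * S
  con-+       : ∀ a b → con (a ℚ.+ b) ≈ con a + con b
  con-*       : ∀ a b → con (a ℚ.* b) ≈ con a * con b

Λ-commutativeRing : CommutativeRing 0ℓ 0ℓ
Λ-commutativeRing = record
  { Carrier = Λ ; _≈_ = _≈_ ; _+_ = _+_ ; _*_ = _*_ ; -_ = -_
  ; 0# = con 0ℚ ; 1# = con 1ℚ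
  ; isCommutativeRing = record
    { isRing = record
      { +-isAbelianGroup = record
        { isGroup = record
          { isMonoid = record
            { isSemigroup = record
              { isMagma = record
                { isEquivalence = record
                  { refl = ≈-refl ; sym = ≈-sym ; trans = ≈-trans }
                ; ∙-cong = +-cong }
              ; assoc = +-assoc }
            ; identity = +-identityˡ , λ P → ≈-trans (+-comm _ _) (+-identityˡ P) }
          ; inverse = -‿inverseˡ , λ P → ≈-trans (+-comm _ _) (-‿inverseˡ P)
          ; ⁻¹-cong = -‿cong }
        ; comm = +-comm }
      ; *-cong = *-cong
      ; *-assoc = *-assoc
      ; *-identity = *-identityˡ , λ P → ≈-trans (*-comm _ _) (*-identityˡ P)
      ; distrib = distribˡ , λ P Q S → ≈-trans (*-comm _ _)
          (≈-trans (distribˡ P Q S) (+-cong (*-comm _ _) (*-comm _ _))) }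
    ; *-comm = *-comm } }

Λ-rawRing : RawRing 0ℓ 0ℓ
Λ-rawRing = CommutativeRing.rawRing Λ-commutativeRing

-- An upper bound for the degree in X (with p_k of degree k), read off the term.
degree : Λ → ℕ
degree (con _)  = 0
degree p[1+ k ] = suc k
degree (P + Q)  = degree P ℕ.⊔ degree Q
degree (P * Q)  = degree P ℕ.+ degree Q
degree (- P)    = degree P

plethysm : (A : PlethysticRing) → Λ → PlethysticRing.Carrier A → PlethysticRing.Carrier A
plethysm A P a = go P
  where
  module A = PlethysticRing A
  go : Λ → A.Carrier
  go (con q)  = A.con q
  go p[1+ k ] = A.ψ[1+ k ] a
  go (P + Q)  = go P A.+ go Q
  go (P * Q)  = go P A.* go Q
  go (- P)    = A.- go P

Λ-ψ[1+_] : ℕ → Λ → Λ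
Λ-ψ[1+ k ] (con q)  = con q
Λ-ψ[1+ k ] p[1+ j ] = p[1+ pred (suc k ℕ.* suc j) ]
Λ-ψ[1+ k ] (P + Q)  = Λ-ψ[1+ k ] P + Λ-ψ[1+ k ] Q
Λ-ψ[1+ k ] (P * Q)  = Λ-ψ[1+ k ] P * Λ-ψ[1+ k ] Q
Λ-ψ[1+ k ] (- P)    = - Λ-ψ[1+ k ] P

Λ-plethysticRing : PlethysticRing
Λ-plethysticRing = record { rawRing = Λ-rawRing ; con = con ; ψ[1+_] = Λ-ψ[1+_] }

open RingOps Λ-rawRing using (det; sum≤)
open ΩOf Λ-plethysticRing public using () renaming (Ω to ΩΛ)

-- h_m is the part of degree m of Ω[X], where X = p_1.
h : ℤ → Λ
h (+ m)    = ΩΛ p[1+ 0 ] m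
h -[1+ _ ] = con 0ℚ

-- Jacobi–Trudi: s_μ = det (h_{μ_i - i + j}).
s : List ℕ → Λ
s μ = det λ i j → h ((List.lookup μ i ℕ.+ Fin.toℕ j) ⊖ Fin.toℕ i)

IsPartition : List ℕ → Set
IsPartition μ = Linked ℕ._≥_ μ × All NonZero μ

-- These laws determine the product, the Schur functions being a basis of Λ;
-- hence adjoints are determined up to _≈_.
record IsHallScalarProduct (⟨_,_⟩ : Λ → Λ → ℚ) : Set where
  field
    cong         : ∀ {P P′ Q Q′} → P ≈ P′ → Q ≈ Q′ → ⟨ P , Q ⟩ ≡ ⟨ P′ , Q′ ⟩
    symmetric    : ∀ P Q → ⟨ P , Q ⟩ ≡ ⟨ Q , P ⟩
    additive     : ∀ P Q S → ⟨ P + Q , S ⟩ ≡ ⟨ P , S ⟩ ℚ.+ ⟨ Q , S ⟩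
    homogeneous  : ∀ a P Q → ⟨ con a * P , Q ⟩ ≡ a ℚ.* ⟨ P , Q ⟩
    s-normal     : ∀ μ → IsPartition μ → ⟨ s μ , s μ ⟩ ≡ 1ℚ
    s-orthogonal : ∀ μ ν → IsPartition μ → IsPartition ν → μ ≢ ν → ⟨ s μ , s ν ⟩ ≡ 0ℚ

-- (P ⊥) is the operator adjoint to multiplication by P.
IsSkewing : (Λ → Λ → ℚ) → (Λ → Λ → Λ) → Set
IsSkewing ⟨_,_⟩ _⊥ = ∀ P Q S → ⟨ (P ⊥) Q , S ⟩ ≡ ⟨ Q , P * S ⟩

data Symbol : Set where
  □ 𝗁 𝗏 : Symbol

f : Symbol → Λ
f □ = s (1 ∷ []) + s (1 ∷ 1 ∷ [])
f 𝗁 = s (2 ∷ [])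
f 𝗏 = s (1 ∷ 1 ∷ [])

-- Laurent polynomials and formal series in z_1, ..., z_n with coefficients
-- in Λ.

module Laurent (n : ℕ) where

  -- A Laurent polynomial is a list of terms c z^μ, possibly with repeated
  -- exponents; two are equal if all their coefficients are.
  LaurentPolynomial : Set
  LaurentPolynomial = List (Λ × Vec ℤ n)

  PowerSeries : Set
  PowerSeries = Vec ℕ n → Λ

  LaurentSeries : Set
  LaurentSeries = Vec ℤ n → Λ

  infixl 7 _·_ _∙_ _⊙_

  sumTerms : LaurentPolynomial → (Λ → Vec ℤ n → Λ) → Λ
  sumTerms L g = List.foldr (λ (c , μ) a → g c μ + a) (con 0ℚ) L

  coeff : LaurentPolynomial → LaurentSeries
  coeff L ν = sumTerms L λ c μ → if does (≡-dec ℤ._≟_ μ ν) then c else con 0ℚ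

  rawRing : RawRing 0ℓ 0ℓ
  rawRing = record
    { Carrier = LaurentPolynomial
    ; _≈_ = λ L M → ∀ ν → coeff L ν ≈ coeff M ν
    ; _+_ = _++_
    ; _*_ = List.cartesianProductWith λ (c , μ) (d , ν) → c * d , Vec.zipWith ℤ._+_ μ ν
    ; -_  = List.map (map₁ -_)
    ; 0#  = []
    ; 1#  = (con 1ℚ , Vec.replicate n ℤ.0ℤ) ∷ []
    }

  open RawRing rawRing public using () renaming (_+_ to _+ᴸ_; _*_ to _*ᴸ_; -_ to -ᴸ_; 1# to 1ᴸ)

  const : Λ → LaurentPolynomial
  const P = (P , Vec.replicate n ℤ.0ℤ) ∷ []

  plethysticRing : PlethysticRing
  plethysticRing = record
    { rawRing = rawRing
    ; con     = const ∘ con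
    ; ψ[1+_]  = λ k → List.map λ (c , μ) → Λ-ψ[1+ k ] c , Vec.map (+ suc k ℤ.*_) μ
    }

  open RingOps rawRing using (sum; productList)
  open ΩOf plethysticRing public using (Ω)

  _⟦_⟧ : Λ → LaurentPolynomial → LaurentPolynomial
  P ⟦ A ⟧ = plethysm plethysticRing P A

  X : LaurentPolynomial
  X = const p[1+ 0 ]

  e : Fin.Fin n → Vec ℤ n
  e i = Vec.replicate n ℤ.0ℤ Vec.[ i ]≔ ℤ.1ℤ

  z z⁻¹ : Fin.Fin n → LaurentPolynomial
  z   i = (con 1ℚ , e i) ∷ []
  z⁻¹ i = (con 1ℚ , Vec.map (ℤ.-_) (e i)) ∷ []

  Z Z* : LaurentPolynomial
  Z  = sum z
  Z* = sum z⁻¹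

  -- R(Z) = ∏_{i<j} (1 - z_j z_i⁻¹)
  R : LaurentPolynomial
  R = productList
    (List.map (λ (i , j) → 1ᴸ +ᴸ -ᴸ (z j *ᴸ z⁻¹ i))
      (List.filter (λ (i , j) → i Fin.<? j)
        (List.cartesianProduct (List.allFin n) (List.allFin n))))

  _∙_ : PowerSeries → PowerSeries → PowerSeries
  (F ∙ G) α = List.foldr (λ β a → F β * G (Vec.zipWith ℕ._∸_ α β) + a) (con 0ℚ) (below α)
    where
    below : ∀ {m} → Vec ℕ m → List (Vec ℕ m)
    below []      = [] ∷ []
    below (a ∷ α) = List.cartesianProductWith _∷_ (List.upTo (suc a)) (below α)

  toLaurentSeries : PowerSeries → LaurentSeries
  toLaurentSeries F = go F
    where
    go : ∀ {m} → (Vec ℕ m → Λ) → Vec ℤ m → Λ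
    go F []             = F []
    go F (+ a ∷ ν)      = go (F ∘ (a ∷_)) ν
    go F (-[1+ _ ] ∷ ν) = con 0ℚ

  _⊙_ : LaurentPolynomial → LaurentSeries → LaurentSeries
  (L ⊙ F) ν = sumTerms L λ c μ → c * F (Vec.zipWith ℤ._-_ ν μ)

  _·_ : PowerSeries → LaurentPolynomial → LaurentSeries
  F · L = L ⊙ toLaurentSeries F

  -- Ω[A] as a power series in z_1, ..., z_n, for A all of whose terms have
  -- exponent in ℕⁿ and positive total degree in z_1, ..., z_n: the part of
  -- Ω[A] of degree d in A then does not contribute to z^α when d > |α|.
  Ω⟨_⟩ : LaurentPolynomial → PowerSeries
  Ω⟨ A ⟩ α = sum≤ (Vec.sum α) λ d → coeff (Ω A d) (Vec.map +_ α)

module Bernstein (_⊥ : Λ → Λ → Λ) where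

  -- Ω[A]^⊥ P, for A all of whose terms have positive degree in X: the part of
  -- Ω[A] of degree d in A then has degree at least d in X, so that its adjoint
  -- annihilates P when d > degree P.
  Ω⟨_⟩⊥ : Λ → Λ → Λ
  Ω⟨ A ⟩⊥ P = sum≤ (degree P) λ d → (ΩΛ A d ⊥) P

  -- The same with A depending on z_1, ..., z_n. Skewing is linear over
  -- polynomials in the z_i^±1.
  module _ {n : ℕ} where
    open Laurent n using (LaurentPolynomial; Ω; rawRing)

    skew : LaurentPolynomial → Λ → LaurentPolynomial
    skew L P = List.map (map₁ λ c → (c ⊥) P) L

    Ω⟨_⟩⊥ᴸ : LaurentPolynomial → Λ → LaurentPolynomial
    Ω⟨ A ⟩⊥ᴸ P = RingOps.sum≤ rawRing (degree P) λ d → skew (Ω A d) P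

  -- Σ_r B_r z^r = Ω[zX] Ω[-z⁻¹X]^⊥, evaluated at P.
  B-generating : Λ → Laurent.LaurentSeries 1
  B-generating P = Ω⟨ z Fin.zero *ᴸ X ⟩ · Ω⟨ -ᴸ (z⁻¹ Fin.zero *ᴸ X) ⟩⊥ᴸ P
    where open Laurent 1

  B : ℤ → Λ → Λ
  B r P = B-generating P (r ∷ [])

  B[_] : ∀ {n} → Vec ℤ n → Λ → Λ
  B[ ν ] = Vec.foldr′ (λ r T → B r ∘ T) id ν

  B^_[_] : Symbol → ∀ {n} → Vec ℤ n → Λ → Λ
  B^ ◇ [ ν ] = Ω⟨ - f ◇ ⟩⊥ ∘ B[ ν ] ∘ Ω⟨ f ◇ ⟩⊥

  -- B^◇(Z) = Σ_ν z^ν B^◇_ν, evaluated at P.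
  B^_⟨Z⟩ : Symbol → ∀ {n} → Λ → Laurent.LaurentSeries n
  B^ ◇ ⟨Z⟩ P ν = B^ ◇ [ ν ] P

-- The Schur functions are orthonormal for the form for which the adjoint of multiplication by p_k is
-- k ∂/∂p_k: by Jacobi–Trudi they are iterated Bernstein operators applied to 1, and Bernstein operators
-- satisfy fermionic relations with their adjoints. They also span Λ, since the span is closed under
-- Bernstein operators, hence under multiplication by the h_r. So every Hall scalar product is that form,
-- and P^⊥ is P with each p_k replaced by k ∂/∂p_k.
--
-- Both sides of the identity are then operators W with W(p_k P) = (p_k - p_k[Z] - p_k[Z*]) W(P); for the
-- left side this uses that log Ω[f] has k ∂/∂p_k log Ω[f] = p_k + constant. It remains to take P = 1, and
-- there Ω[-f]^⊥ B(Z) 1 = R(Z) Ω[-f[Z]] Ω[ZX], because B(Z) 1 = R(Z) Ω[ZX] and G^⊥ Ω[ZX] = G[Z] Ω[ZX].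

module Submission where

open import Defs using (PlethysticRing; module RingOps; module ΩOf)
open import Algebra.Bundles using (CommutativeRing)
import Algebra.Solver.Ring
open import Algebra.Solver.Ring.AlmostCommutativeRing using (AlmostCommutativeRing; fromCommutativeRing; _-Raw-AlmostCommutative⟶_)
open import Algebra.Structures using (IsCommutativeRing)
open import Data.Bool.Base using (if_then_else_; true; false)
import Data.Fin.Base as Fin
import Data.Fin.Properties as Fin
open import Data.Integer.Base as ℤ using (ℤ; +_; -[1+_]; _⊖_)
import Data.Integer.Properties as ℤ
open import Data.Integer.Tactic.RingSolver using (solve-∀)
open import Data.List.Base as List using (List; []; _∷_; _++_; _∷ʳ_)
import Data.List.Properties as List
open import Data.List.Relation.Unary.All as All using (All; []; _∷_)
import Data.List.Relation.Unary.All.Properties as All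
open import Data.List.Relation.Unary.Linked using (Linked; []; [-]; _∷_)
open import Data.Maybe.Base as Maybe using (Maybe)
open import Data.Nat.Base as ℕ using (ℕ; zero; suc; NonZero; _!; _≤_; z≤n; s≤s)
open import Data.Nat.Induction using (<-rec)
import Data.Nat.Properties as ℕ
open import Data.Product.Base using (∃; _×_; _,_; proj₁; proj₂; map₁)
open import Data.Rational.Base as ℚ using (ℚ; 0ℚ; 1ℚ)
import Data.Rational.Properties as ℚ
import Data.Rational.Unnormalised.Base as ℚᵘ
import Data.Rational.Unnormalised.Properties as ℚᵘ
open import Data.Sign.Base as Sign using (Sign; opposite)
open import Data.Sum.Base using (_⊎_; inj₁; inj₂)
open import Data.Vec.Base as Vec using (Vec; []; _∷_)
import Data.Vec.Properties as Vec
open import Data.Vec.Properties using (≡-dec)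
open import Function.Base using (_∘_; id; const)
open import Function.Bundles using (mk⇔)
open import Level using (0ℓ)
open import Relation.Binary.Core using (Rel)
open import Relation.Binary.Definitions using (tri<; tri≈; tri>)
open import Relation.Binary.PropositionalEquality as ≡ using (_≡_; _≢_; module ≡-Reasoning)
import Relation.Binary.Reasoning.Setoid as SetoidReasoning
open import Relation.Nullary.Decidable using (Dec; yes; no; does; does-⇔; dec⇒maybe)
open import Relation.Nullary.Negation using (contradiction)

-- Conjugation by `Ω[f]^⊥` is what adds Z to Z*. It sends p_k to p_k + p_k^⊥ + constant; B(Z)
-- commutes with p_k up to p_k[Z*] and with p_k^⊥ up to p_k[Z]; the outer factor then removes p_k^⊥
-- and the constant again. The three choices of f share the term p_1² / 2 and differ only in the
-- coefficients of p_1 and p_2, hence only in that constant, so one argument serves all of them. The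
-- obstacle is that every Ω is an infinite sum, cut off by the definitions at a degree that is read
-- off a term and is not invariant under `_≈_`. Each operator therefore comes with a lemma that any
-- larger bound gives the same value, which rests on the filtrations `Low` and `Order≥`. After that,
-- operators are compared without expanding them: a commutation rule with the p_k and the value at 1
-- determine a linear operator on Λ.

abstract
  -- Abstract, because the reduced fractions behind it should never be unfolded; the rules of this
  -- block are all that later proofs see.
  ℕ→ℚ : ℕ → ℚ
  ℕ→ℚ n = + n ℚ./ 1

  ℕ→ℚ-0 : ℕ→ℚ 0 ≡ 0ℚ
  ℕ→ℚ-0 = ≡.refl

  ℕ→ℚ-1 : ℕ→ℚ 1 ≡ 1ℚ
  ℕ→ℚ-1 = ≡.refl

  ℕ→ℚ-suc : ∀ n → ℕ→ℚ (suc n) ≡ 1ℚ ℚ.+ ℕ→ℚ n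
  ℕ→ℚ-suc n = ℚ.toℚᵘ-injective (begin
    ℚ.toℚᵘ (ℕ→ℚ (suc n))                  ≈⟨ ℚ.toℚᵘ-fromℚᵘ (ℚᵘ.mkℚᵘ (+ suc n) 0) ⟩
    ℚᵘ.mkℚᵘ (+ suc n) 0                    ≈⟨ ℚᵘ.*≡* (≡.cong (λ x → (+ 1 ℤ.+ x) ℤ.* + 1) (≡.sym (ℤ.*-identityʳ (+ n)))) ⟩
    ℚᵘ.1ℚᵘ ℚᵘ.+ ℚᵘ.mkℚᵘ (+ n) 0          ≈⟨ ℚᵘ.+-congʳ ℚᵘ.1ℚᵘ (ℚ.toℚᵘ-fromℚᵘ (ℚᵘ.mkℚᵘ (+ n) 0)) ⟨
    ℚᵘ.1ℚᵘ ℚᵘ.+ ℚ.toℚᵘ (ℕ→ℚ n)          ≈⟨ ℚ.toℚᵘ-homo-+ 1ℚ (ℕ→ℚ n) ⟨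
    ℚ.toℚᵘ (1ℚ ℚ.+ ℕ→ℚ n)                 ∎)
    where open SetoidReasoning ℚᵘ.≃-setoid

  ℕ→ℚ-+ : ∀ m n → ℕ→ℚ (m ℕ.+ n) ≡ ℕ→ℚ m ℚ.+ ℕ→ℚ n
  ℕ→ℚ-+ zero    n = ≡.sym (ℚ.+-identityˡ (ℕ→ℚ n))
  ℕ→ℚ-+ (suc m) n = begin
    ℕ→ℚ (suc (m ℕ.+ n))              ≡⟨ ℕ→ℚ-suc (m ℕ.+ n) ⟩
    1ℚ ℚ.+ ℕ→ℚ (m ℕ.+ n)             ≡⟨ ≡.cong (1ℚ ℚ.+_) (ℕ→ℚ-+ m n) ⟩
    1ℚ ℚ.+ (ℕ→ℚ m ℚ.+ ℕ→ℚ n)        ≡⟨ ℚ.+-assoc 1ℚ (ℕ→ℚ m) (ℕ→ℚ n) ⟨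
    (1ℚ ℚ.+ ℕ→ℚ m) ℚ.+ ℕ→ℚ n        ≡⟨ ≡.cong (ℚ._+ ℕ→ℚ n) (ℕ→ℚ-suc m) ⟨
    ℕ→ℚ (suc m) ℚ.+ ℕ→ℚ n            ∎
    where open ≡-Reasoning

  1/-*-cancel : ∀ m n → .{{_ : NonZero m}} .{{_ : NonZero n}} .{{_ : NonZero (m ℕ.* n)}} →
    (+ 1 ℚ./ (m ℕ.* n)) ℚ.* ℕ→ℚ m ≡ + 1 ℚ./ n
  1/-*-cancel (suc m) (suc n) = ℚ.toℚᵘ-injective (begin
    ℚ.toℚᵘ ((+ 1 ℚ./ (suc m ℕ.* suc n)) ℚ.* ℕ→ℚ (suc m))
      ≈⟨ ℚ.toℚᵘ-homo-* (+ 1 ℚ./ (suc m ℕ.* suc n)) (ℕ→ℚ (suc m)) ⟩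
    ℚ.toℚᵘ (+ 1 ℚ./ (suc m ℕ.* suc n)) ℚᵘ.* ℚ.toℚᵘ (ℕ→ℚ (suc m))
      ≈⟨ ℚᵘ.*-cong (ℚ.toℚᵘ-fromℚᵘ (ℚᵘ.mkℚᵘ (+ 1) (n ℕ.+ m ℕ.* suc n))) (ℚ.toℚᵘ-fromℚᵘ (ℚᵘ.mkℚᵘ (+ suc m) 0)) ⟩
    ℚᵘ.mkℚᵘ (+ 1) (n ℕ.+ m ℕ.* suc n) ℚᵘ.* ℚᵘ.mkℚᵘ (+ suc m) 0
      ≈⟨ ℚᵘ.*≡* (≡.cong (+_) (≡.trans (≡.cong (ℕ._* suc n) (ℕ.+-identityʳ (suc m)))
           (≡.trans (≡.sym (ℕ.*-identityʳ _)) (≡.sym (ℕ.+-identityʳ _))))) ⟩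
    ℚᵘ.mkℚᵘ (+ 1) n
      ≈⟨ ℚ.toℚᵘ-fromℚᵘ (ℚᵘ.mkℚᵘ (+ 1) n) ⟨
    ℚ.toℚᵘ (+ 1 ℚ./ suc n) ∎)
    where
    open SetoidReasoning ℚᵘ.≃-setoid

  1/suc*suc : ∀ n → (+ 1 ℚ./ suc n) ℚ.* ℕ→ℚ (suc n) ≡ 1ℚ
  1/suc*suc n = ≡.trans (≡.cong (ℚ._* ℕ→ℚ (suc n)) (ℚ./-cong {+ 1} {suc n} {+ 1} {suc n ℕ.* 1} ≡.refl (≡.sym (ℕ.*-identityʳ (suc n))))) (1/-*-cancel (suc n) 1)

-- Multiplication by t^k. The coefficients may have any type C, with c₀ as its zero, since sums in Λ
-- are also taken over delayed sequences of Laurent polynomials.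
delay : ∀ {C : Set} → C → ℕ → (ℕ → C) → ℕ → C
delay c₀ zero    b d       = b d
delay c₀ (suc k) b zero    = c₀
delay c₀ (suc k) b (suc d) = delay c₀ k b d

-- Power series over a ring with plethysm

-- The equality is a field of its own: Laurent polynomials get the relation `_≃_` in place of the
-- coefficientwise equality of their raw ring.
record Laws (A : PlethysticRing) : Set₁ where
  open PlethysticRing A hiding (_≈_)
  field
    _∼_               : Rel Carrier 0ℓ
    isCommutativeRing : IsCommutativeRing _∼_ _+_ _*_ -_ 0# 1#
    con-1             : con 1ℚ ∼ 1#
    con-+             : ∀ a b → con (a ℚ.+ b) ∼ (con a + con b)
    con-*             : ∀ a b → con (a ℚ.* b) ∼ (con a * con b)

module Series (A : PlethysticRing) (laws : Laws A) where
  open PlethysticRing A public using (con; ψ[1+_])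
  private module L = Laws laws
  commutativeRing : CommutativeRing 0ℓ 0ℓ
  commutativeRing = record { isCommutativeRing = L.isCommutativeRing }
  open CommutativeRing commutativeRing public hiding (rawRing; zero)
  open L public using (con-1; con-+; con-*)
  open RingOps (PlethysticRing.rawRing A) public using (sum; sum≤)
  private module F = RingOps (PlethysticRing.rawRing A)
  open ΩOf A public using (Ω)
  private module G = ΩOf A
  open SetoidReasoning setoid
  open import Algebra.Properties.Ring ring public using (-‿distribˡ-*; -‿distribʳ-*; -0#≈0#)
  open import Algebra.Properties.AbelianGroup +-abelianGroup using (inverseʳ-unique)

  con-0 : con 0ℚ ≈ 0#
  con-0 = begin
    con 0ℚ                        ≈⟨ +-identityʳ _ ⟨
    con 0ℚ + 0#                   ≈⟨ +-congˡ (-‿inverseʳ _) ⟨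
    con 0ℚ + (con 0ℚ - con 0ℚ)    ≈⟨ +-assoc _ _ _ ⟨
    con 0ℚ + con 0ℚ - con 0ℚ      ≈⟨ +-congʳ (con-+ 0ℚ 0ℚ) ⟨
    con 0ℚ - con 0ℚ               ≈⟨ -‿inverseʳ _ ⟩
    0#                            ∎

  con-neg : ∀ a → con (ℚ.- a) ≈ - con a
  con-neg a = inverseʳ-unique (con a) (con (ℚ.- a)) (begin
    con a + con (ℚ.- a)   ≈⟨ con-+ a (ℚ.- a) ⟨
    con (a ℚ.- a)         ≡⟨ ≡.cong con (ℚ.+-inverseʳ a) ⟩
    con 0ℚ                ≈⟨ con-0 ⟩
    0#                    ∎)

  almostCommutativeRing : AlmostCommutativeRing 0ℓ 0ℓ
  almostCommutativeRing = fromCommutativeRing commutativeRing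

  con-morphism : CommutativeRing.rawRing ℚ.+-*-commutativeRing -Raw-AlmostCommutative⟶ almostCommutativeRing
  con-morphism = record
    { ⟦_⟧ = con ; +-homo = con-+ ; *-homo = con-* ; -‿homo = con-neg ; 0-homo = con-0 ; 1-homo = con-1 }

  con-≟ : ∀ a b → Maybe (con a ≈ con b)
  con-≟ a b = Maybe.map (λ a≡b → reflexive (≡.cong con a≡b)) (dec⇒maybe (a ℚ.≟ b))

  module Solver = Algebra.Solver.Ring (CommutativeRing.rawRing ℚ.+-*-commutativeRing) almostCommutativeRing con-morphism con-≟

  open Solver using (_:+_; _:*_; _:-_; :-_; _:=_) renaming (solve to solveS; con to K)

  ∑ : ℕ → (ℕ → Carrier) → Carrier
  ∑ zero    a = a 0
  ∑ (suc n) a = a 0 + ∑ n (a ∘ suc)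

  sum≤-∑ : ∀ n (a : ℕ → Carrier) → sum≤ n a ≈ ∑ n a
  sum≤-∑ zero    a = +-identityʳ _
  sum≤-∑ (suc n) a = +-congˡ (sum≤-∑ n (a ∘ suc))

  ∑-cong : ∀ n {a b : ℕ → Carrier} → (∀ i → i ℕ.≤ n → a i ≈ b i) → ∑ n a ≈ ∑ n b
  ∑-cong zero    eq = eq 0 z≤n
  ∑-cong (suc n) eq = +-cong (eq 0 z≤n) (∑-cong n λ i i≤n → eq (suc i) (s≤s i≤n))

  ∑-0 : ∀ n {a : ℕ → Carrier} → (∀ i → i ℕ.≤ n → a i ≈ 0#) → ∑ n a ≈ 0#
  ∑-0 zero    eq = eq 0 z≤n
  ∑-0 (suc n) eq = trans (+-cong (eq 0 z≤n) (∑-0 n λ i i≤n → eq (suc i) (s≤s i≤n))) (+-identityʳ _)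

  interchange : ∀ a b c d → (a + b) + (c + d) ≈ (a + c) + (b + d)
  interchange = solveS 4 (λ a b c d → a :+ b :+ (c :+ d) := a :+ c :+ (b :+ d)) refl

  x∙yz≈y∙xz : ∀ x y z → x * (y * z) ≈ y * (x * z)
  x∙yz≈y∙xz = solveS 3 (λ a b c → a :* (b :* c) := b :* (a :* c)) refl

  x+yz≈y+xz : ∀ x y z → x + (y + z) ≈ y + (x + z)
  x+yz≈y+xz = solveS 3 (λ a b c → a :+ (b :+ c) := b :+ (a :+ c)) refl

  ∑-+ : ∀ n (a b : ℕ → Carrier) → ∑ n (λ i → a i + b i) ≈ ∑ n a + ∑ n b
  ∑-+ zero    a b = refl
  ∑-+ (suc n) a b = trans (+-congˡ (∑-+ n (a ∘ suc) (b ∘ suc))) (interchange _ _ _ _)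

  ∑-hom : ∀ n (φ : Carrier → Carrier) (a : ℕ → Carrier) →
    (∀ x y → φ (x + y) ≈ φ x + φ y) → φ (∑ n a) ≈ ∑ n (φ ∘ a)
  ∑-hom zero    φ a hom = refl
  ∑-hom (suc n) φ a hom = trans (hom _ _) (+-congˡ (∑-hom n φ (a ∘ suc) hom))

  ∑-*ˡ : ∀ n c (a : ℕ → Carrier) → ∑ n (λ i → c * a i) ≈ c * ∑ n a
  ∑-*ˡ n c a = sym (∑-hom n (c *_) a (distribˡ c))

  ∑-*ʳ : ∀ n c (a : ℕ → Carrier) → ∑ n (λ i → a i * c) ≈ ∑ n a * c
  ∑-*ʳ n c a = sym (∑-hom n (_* c) a (distribʳ c))

  ∑-last : ∀ n (a : ℕ → Carrier) → ∑ (suc n) a ≈ ∑ n a + a (suc n)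
  ∑-last zero    a = refl
  ∑-last (suc n) a = trans (+-congˡ (∑-last n (a ∘ suc))) (sym (+-assoc _ _ _))

  ∑-swap : ∀ m n (a : ℕ → ℕ → Carrier) → ∑ m (λ i → ∑ n (a i)) ≈ ∑ n (λ j → ∑ m λ i → a i j)
  ∑-swap zero    n a = refl
  ∑-swap (suc m) n a = trans (+-congˡ (∑-swap m n (a ∘ suc))) (sym (∑-+ n (a 0) (λ j → ∑ m λ i → a (suc i) j)))

  ∑-extend : ∀ {m n} (a : ℕ → Carrier) → m ℕ.≤ n → (∀ i → m ℕ.< i → a i ≈ 0#) → ∑ n a ≈ ∑ m a
  ∑-extend {zero}  {zero}  a _ z = refl
  ∑-extend {zero}  {suc n} a _ z = trans (+-congˡ (∑-0 n λ i _ → z (suc i) (s≤s z≤n))) (+-identityʳ _)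
  ∑-extend {suc m} {suc n} a (s≤s m≤n) z = +-congˡ (∑-extend (a ∘ suc) m≤n λ i m<i → z (suc i) (s≤s m<i))

  Seq : Set
  Seq = ℕ → Carrier

  infix 4 _≋_
  _≋_ : Rel Seq 0ℓ
  a ≋ b = ∀ d → a d ≈ b d

  infixl 7 _⊛_
  -- Splitting off one coefficient of a at a time avoids the index subtraction of the defining sum,
  -- so that the ring laws follow by induction on the degree.
  _⊛_ : Seq → Seq → Seq
  (a ⊛ b) zero    = a 0 * b 0
  (a ⊛ b) (suc d) = a 0 * b (suc d) + ((a ∘ suc) ⊛ b) d

  1⊛ : Seq
  1⊛ zero    = 1#
  1⊛ (suc _) = 0#

  _^⊛_ : Seq → ℕ → Seq
  a ^⊛ zero  = 1⊛
  a ^⊛ suc m = a ⊛ (a ^⊛ m)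

  ⊛-∑ : ∀ a b d → (a ⊛ b) d ≈ ∑ d λ i → a i * b (d ℕ.∸ i)
  ⊛-∑ a b zero    = refl
  ⊛-∑ a b (suc d) = +-congˡ (⊛-∑ (a ∘ suc) b d)

  ⊛-cong≤ : ∀ {a a′ b b′} d → (∀ i → i ℕ.≤ d → a i ≈ a′ i) → (∀ i → i ℕ.≤ d → b i ≈ b′ i) → (a ⊛ b) d ≈ (a′ ⊛ b′) d
  ⊛-cong≤ zero    eq eq′ = *-cong (eq 0 z≤n) (eq′ 0 z≤n)
  ⊛-cong≤ (suc d) eq eq′ = +-cong (*-cong (eq 0 z≤n) (eq′ (suc d) ℕ.≤-refl))
    (⊛-cong≤ d (λ i i≤d → eq (suc i) (s≤s i≤d)) (λ i i≤d → eq′ i (ℕ.m≤n⇒m≤1+n i≤d)))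

  ⊛-cong : ∀ {a a′ b b′} → a ≋ a′ → b ≋ b′ → (a ⊛ b) ≋ (a′ ⊛ b′)
  ⊛-cong eq eq′ d = ⊛-cong≤ d (λ i _ → eq i) (λ i _ → eq′ i)

  ⊛-congˡ : ∀ {a b b′} → b ≋ b′ → (a ⊛ b) ≋ (a ⊛ b′)
  ⊛-congˡ eq = ⊛-cong (λ _ → refl) eq

  ⊛-congʳ : ∀ {a a′ b} → a ≋ a′ → (a ⊛ b) ≋ (a′ ⊛ b)
  ⊛-congʳ eq = ⊛-cong eq (λ _ → refl)

  ⊛-0ʳ : ∀ {a b} d → (∀ i → i ℕ.≤ d → b i ≈ 0#) → (a ⊛ b) d ≈ 0#
  ⊛-0ʳ {a} {b} zero    eq = trans (*-congˡ (eq 0 z≤n)) (zeroʳ _)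
  ⊛-0ʳ {a} {b} (suc d) eq = trans (+-cong (trans (*-congˡ (eq (suc d) ℕ.≤-refl)) (zeroʳ _)) (⊛-0ʳ d λ i i≤d → eq i (ℕ.m≤n⇒m≤1+n i≤d))) (+-identityʳ _)

  ⊛-distribʳ : ∀ a b c → ((λ d → b d + c d) ⊛ a) ≋ λ d → (b ⊛ a) d + (c ⊛ a) d
  ⊛-distribʳ a b c zero    = distribʳ _ _ _
  ⊛-distribʳ a b c (suc d) = trans (+-cong (distribʳ _ _ _) (⊛-distribʳ a (b ∘ suc) (c ∘ suc) d)) (interchange _ _ _ _)

  ⊛-scaleˡ : ∀ c a b → ((λ d → c * a d) ⊛ b) ≋ λ d → c * (a ⊛ b) d
  ⊛-scaleˡ c a b zero    = *-assoc _ _ _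
  ⊛-scaleˡ c a b (suc d) = trans (+-cong (*-assoc _ _ _) (⊛-scaleˡ c (a ∘ suc) b d)) (sym (distribˡ _ _ _))

  ⊛-sucʳ : ∀ a b d → (a ⊛ b) (suc d) ≈ a (suc d) * b 0 + (a ⊛ (b ∘ suc)) d
  ⊛-sucʳ a b zero    = +-comm _ _
  ⊛-sucʳ a b (suc d) = trans (+-congˡ (⊛-sucʳ (a ∘ suc) b d)) (x+yz≈y+xz _ _ _)

  ⊛-comm : ∀ a b → (a ⊛ b) ≋ (b ⊛ a)
  ⊛-comm a b zero    = *-comm _ _
  ⊛-comm a b (suc d) = trans (+-cong (*-comm _ _) (⊛-comm (a ∘ suc) b d)) (sym (⊛-sucʳ b a d))

  ⊛-distribˡ : ∀ a b c → (a ⊛ λ d → b d + c d) ≋ λ d → (a ⊛ b) d + (a ⊛ c) d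
  ⊛-distribˡ a b c d = trans (⊛-comm a _ d) (trans (⊛-distribʳ a b c d) (+-cong (⊛-comm b a d) (⊛-comm c a d)))

  ⊛-scaleʳ : ∀ c a b → (a ⊛ λ d → c * b d) ≋ λ d → c * (a ⊛ b) d
  ⊛-scaleʳ c a b d = trans (⊛-comm a _ d) (trans (⊛-scaleˡ c b a d) (*-congˡ (⊛-comm b a d)))

  ⊛-assoc : ∀ a b c → ((a ⊛ b) ⊛ c) ≋ (a ⊛ (b ⊛ c))
  ⊛-assoc a b c zero    = *-assoc _ _ _
  ⊛-assoc a b c (suc d) = begin
    a 0 * b 0 * c (suc d) + (((a ⊛ b) ∘ suc) ⊛ c) d
      ≈⟨ +-congˡ (⊛-distribʳ c (λ i → a 0 * b (suc i)) ((a ∘ suc) ⊛ b) d) ⟩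
    a 0 * b 0 * c (suc d) + (((λ i → a 0 * b (suc i)) ⊛ c) d + (((a ∘ suc) ⊛ b) ⊛ c) d)
      ≈⟨ +-cong (*-assoc _ _ _) (+-cong (⊛-scaleˡ (a 0) (b ∘ suc) c d) (⊛-assoc (a ∘ suc) b c d)) ⟩
    a 0 * (b 0 * c (suc d)) + (a 0 * ((b ∘ suc) ⊛ c) d + ((a ∘ suc) ⊛ (b ⊛ c)) d)
      ≈⟨ +-assoc _ _ _ ⟨
    a 0 * (b 0 * c (suc d)) + a 0 * ((b ∘ suc) ⊛ c) d + ((a ∘ suc) ⊛ (b ⊛ c)) d
      ≈⟨ +-congʳ (distribˡ _ _ _) ⟨
    (a ⊛ (b ⊛ c)) (suc d) ∎

  ⊛-exchange : ∀ a b c → (a ⊛ (b ⊛ c)) ≋ (b ⊛ (a ⊛ c))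
  ⊛-exchange a b c d = begin
    (a ⊛ (b ⊛ c)) d   ≈⟨ ⊛-assoc a b c d ⟨
    ((a ⊛ b) ⊛ c) d   ≈⟨ ⊛-congʳ (⊛-comm a b) d ⟩
    ((b ⊛ a) ⊛ c) d   ≈⟨ ⊛-assoc b a c d ⟩
    (b ⊛ (a ⊛ c)) d   ∎

  ⊛-∑-distribˡ : ∀ N a (b : ℕ → Seq) d → (a ⊛ λ i → ∑ N λ m → b m i) d ≈ ∑ N λ m → (a ⊛ b m) d
  ⊛-∑-distribˡ zero    a b d = refl
  ⊛-∑-distribˡ (suc N) a b d = trans (⊛-distribˡ a (b 0) (λ i → ∑ N λ m → b (suc m) i) d) (+-congˡ (⊛-∑-distribˡ N a (b ∘ suc) d))

  -- Three families are needed because the induction drops a coefficient of a: this shifts the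
  -- degree seen by the operators on a and on the product, but not the one seen on b.
  ⊛-leibniz : (δ₁ δ₂ δ : ℕ → Carrier → Carrier) →
    (∀ d x y → δ d (x + y) ≈ δ d x + δ d y) →
    (∀ i j x y → δ (i ℕ.+ j) (x * y) ≈ δ₁ i x * y + x * δ₂ j y) →
    ∀ a b d → δ d ((a ⊛ b) d) ≈ ((λ i → δ₁ i (a i)) ⊛ b) d + (a ⊛ λ i → δ₂ i (b i)) d
  ⊛-leibniz δ₁ δ₂ δ add leibniz a b zero    = leibniz 0 0 (a 0) (b 0)
  ⊛-leibniz δ₁ δ₂ δ add leibniz a b (suc d) = begin
    δ (suc d) (a 0 * b (suc d) + ((a ∘ suc) ⊛ b) d)
      ≈⟨ add (suc d) _ _ ⟩
    δ (suc d) (a 0 * b (suc d)) + δ (suc d) (((a ∘ suc) ⊛ b) d)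
      ≈⟨ +-cong (leibniz 0 (suc d) _ _) (⊛-leibniz (δ₁ ∘ suc) δ₂ (δ ∘ suc) (add ∘ suc) (leibniz ∘ suc) (a ∘ suc) b d) ⟩
    _ ≈⟨ interchange _ _ _ _ ⟩
    _ ∎

  -- Coefficientwise derivations and t d/dt are treated at once: δ d acts on the coefficient of t^d.
  record IsDerivation (δ : ℕ → Carrier → Carrier) : Set where
    field
      δ-cong : ∀ d {x y} → x ≈ y → δ d x ≈ δ d y
      δ-+  : ∀ d x y → δ d (x + y) ≈ δ d x + δ d y
      δ-* : ∀ i j x y → δ (i ℕ.+ j) (x * y) ≈ δ i x * y + x * δ j y
      δ-con* : ∀ d q x → δ d (con q * x) ≈ con q * δ d x
      δ-1  : δ 0 1# ≈ 0#
      δ-0 : ∀ d → δ d 0# ≈ 0#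

  ^⊛-vanish : ∀ {a} → a 0 ≈ 0# → ∀ m d → d ℕ.< m → (a ^⊛ m) d ≈ 0#
  ^⊛-vanish {a} a₀ (suc m) zero    _         = trans (*-congʳ a₀) (zeroˡ _)
  ^⊛-vanish {a} a₀ (suc m) (suc d) (s≤s d<m) = trans (+-cong (trans (*-congʳ a₀) (zeroˡ _))
    (⊛-0ʳ {a ∘ suc} d λ i i≤d → ^⊛-vanish a₀ m i (ℕ.≤-<-trans i≤d d<m))) (+-identityʳ _)

  1/_! : ℕ → ℚ
  1/ m ! = (+ 1 ℚ./ (m !)) {{m ℕ.!≢0}}

  -- With a bound N independent of d this is a finite sum of whole series, which can be convolved
  -- and differentiated term by term.
  exp≤ : ℕ → Seq → Seq
  exp≤ N a d = ∑ N λ m → con (1/ m !) * (a ^⊛ m) d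

  exp : Seq → Seq
  exp a d = exp≤ d a d

  exp≤-exp : ∀ a → a 0 ≈ 0# → ∀ {N} d → d ℕ.≤ N → exp≤ N a d ≈ exp a d
  exp≤-exp a a₀ {N} d d≤N = ∑-extend _ d≤N λ i d<i → trans (*-congˡ (^⊛-vanish a₀ i d d<i)) (zeroʳ (con (1/ i !)))

  ⊛-frozen : ∀ a b d → (a F.⊛ b) d ≈ (a ⊛ b) d
  ⊛-frozen a b zero    = +-identityʳ _
  ⊛-frozen a b (suc d) = +-congˡ (⊛-frozen (a ∘ suc) b d)

  ^⊛-frozen : ∀ a m d → (a F.^⊛ m) d ≈ (a ^⊛ m) d
  ^⊛-frozen a zero    zero    = refl
  ^⊛-frozen a zero    (suc d) = refl
  ^⊛-frozen a (suc m) d       = trans (⊛-frozen a (a F.^⊛ m) d) (⊛-congˡ {a} (^⊛-frozen a m) d)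

  exp-frozen : ∀ a d → G.exp a d ≈ exp a d
  exp-frozen a d = trans (sum≤-∑ d (λ m → con (1/ m !) * (a F.^⊛ m) d)) (∑-cong d λ m _ → *-congˡ {con (1/ m !)} (^⊛-frozen a m d))

  module Derivation {δ} (isDerivation : IsDerivation δ) where
    open IsDerivation isDerivation

    ∂ : Seq → Seq
    ∂ a d = δ d (a d)

    ∂-pow-0 : ∂ 1⊛ ≋ λ _ → 0#
    ∂-pow-0 0       = δ-1
    ∂-pow-0 (suc d) = δ-0 (suc d)

    ∂-pow : ∀ a m → ∂ (a ^⊛ suc m) ≋ λ d → con (ℕ→ℚ (suc m)) * (∂ a ⊛ (a ^⊛ m)) d
    ∂-pow a 0 d = begin
      ∂ (a ⊛ (a ^⊛ 0)) d                             ≈⟨ ⊛-leibniz δ δ δ δ-+ δ-* a _ d ⟩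
      (∂ a ⊛ (a ^⊛ 0)) d + (a ⊛ ∂ (a ^⊛ 0)) d       ≈⟨ +-congˡ (⊛-0ʳ {a} d λ i _ → ∂-pow-0 i) ⟩
      (∂ a ⊛ (a ^⊛ 0)) d + 0#                         ≈⟨ +-identityʳ _ ⟩
      (∂ a ⊛ (a ^⊛ 0)) d                              ≈⟨ *-identityˡ _ ⟨
      1# * (∂ a ⊛ (a ^⊛ 0)) d                         ≈⟨ *-congʳ con-1 ⟨
      con 1ℚ * (∂ a ⊛ (a ^⊛ 0)) d                     ≡⟨ ≡.cong (λ q → con q * (∂ a ⊛ (a ^⊛ 0)) d) ℕ→ℚ-1 ⟨
      con (ℕ→ℚ 1) * (∂ a ⊛ (a ^⊛ 0)) d               ∎
    ∂-pow a (suc m) d = begin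
      ∂ (a ⊛ (a ^⊛ suc m)) d
        ≈⟨ ⊛-leibniz δ δ δ δ-+ δ-* a _ d ⟩
      (∂ a ⊛ (a ^⊛ suc m)) d + (a ⊛ ∂ (a ^⊛ suc m)) d
        ≈⟨ +-congˡ (trans (⊛-congˡ {a} (∂-pow a m) d) (trans (⊛-scaleʳ (con (ℕ→ℚ (suc m))) a (∂ a ⊛ (a ^⊛ m)) d) (*-congˡ (⊛-exchange a (∂ a) (a ^⊛ m) d)))) ⟩
      (∂ a ⊛ (a ^⊛ suc m)) d + con (ℕ→ℚ (suc m)) * (∂ a ⊛ (a ^⊛ suc m)) d
        ≈⟨ solveS 2 (λ x y → x :+ y :* x := (K 1ℚ :+ y) :* x) refl _ _ ⟩
      (con 1ℚ + con (ℕ→ℚ (suc m))) * (∂ a ⊛ (a ^⊛ suc m)) d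
        ≈⟨ *-congʳ (con-+ 1ℚ _) ⟨
      con (1ℚ ℚ.+ ℕ→ℚ (suc m)) * (∂ a ⊛ (a ^⊛ suc m)) d
        ≡⟨ ≡.cong (λ q → con q * (∂ a ⊛ (a ^⊛ suc m)) d) (ℕ→ℚ-suc (suc m)) ⟨
      con (ℕ→ℚ (suc (suc m))) * (∂ a ⊛ (a ^⊛ suc m)) d ∎

    ∂-exp : ∀ a → a 0 ≈ 0# → ∂ (exp a) ≋ (∂ a ⊛ exp a)
    ∂-exp a a₀ d = begin
      δ d (exp a d)
        -- One summand more than necessary: the term m = 0 dies under δ, and the reindexed rest
        -- again runs from 0 to d.
        ≈⟨ δ-cong d (exp≤-exp a a₀ {suc d} d (ℕ.n≤1+n d)) ⟨
      δ d (exp≤ (suc d) a d)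
        ≈⟨ ∑-hom (suc d) (δ d) (λ m → con (1/ m !) * (a ^⊛ m) d) (δ-+ d) ⟩
      δ d (con (1/ 0 !) * (a ^⊛ 0) d) + ∑ d (λ m → δ d (con (1/ suc m !) * (a ^⊛ suc m) d))
        ≈⟨ +-cong (trans (δ-con* d _ _) (trans (*-congˡ (∂-pow-0 d)) (zeroʳ _))) (∑-cong d λ m _ → step m) ⟩
      0# + ∑ d (λ m → con (1/ m !) * (∂ a ⊛ (a ^⊛ m)) d)
        ≈⟨ +-identityˡ _ ⟩
      ∑ d (λ m → con (1/ m !) * (∂ a ⊛ (a ^⊛ m)) d)
        ≈⟨ ∑-cong d (λ m _ → ⊛-scaleʳ (con (1/ m !)) (∂ a) (a ^⊛ m) d) ⟨
      ∑ d (λ m → (∂ a ⊛ λ i → con (1/ m !) * (a ^⊛ m) i) d)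
        ≈⟨ ⊛-∑-distribˡ d (∂ a) (λ m i → con (1/ m !) * (a ^⊛ m) i) d ⟨
      (∂ a ⊛ exp≤ d a) d
        ≈⟨ ⊛-cong≤ {∂ a} d (λ _ _ → refl) (λ i i≤d → exp≤-exp a a₀ i i≤d) ⟩
      (∂ a ⊛ exp a) d ∎
      where
      step : ∀ m → δ d (con (1/ suc m !) * (a ^⊛ suc m) d) ≈ con (1/ m !) * (∂ a ⊛ (a ^⊛ m)) d
      step m = begin
        δ d (con (1/ suc m !) * (a ^⊛ suc m) d)                             ≈⟨ δ-con* d _ _ ⟩
        con (1/ suc m !) * δ d ((a ^⊛ suc m) d)                              ≈⟨ *-congˡ (∂-pow a m d) ⟩
        con (1/ suc m !) * (con (ℕ→ℚ (suc m)) * (∂ a ⊛ (a ^⊛ m)) d)        ≈⟨ *-assoc _ _ _ ⟨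
        con (1/ suc m !) * con (ℕ→ℚ (suc m)) * (∂ a ⊛ (a ^⊛ m)) d          ≈⟨ *-congʳ (con-* _ _) ⟨
        con (1/ suc m ! ℚ.* ℕ→ℚ (suc m)) * (∂ a ⊛ (a ^⊛ m)) d
          ≡⟨ ≡.cong (λ q → con q * (∂ a ⊛ (a ^⊛ m)) d) (1/-*-cancel (suc m) (m !) {{_}} {{m ℕ.!≢0}} {{suc m ℕ.!≢0}}) ⟩
        con (1/ m !) * (∂ a ⊛ (a ^⊛ m)) d ∎

  euler : IsDerivation (λ d x → con (ℕ→ℚ d) * x)
  euler = record
    { δ-cong = λ d → *-congˡ
    ; δ-+ = λ d → distribˡ _
    ; δ-* = λ i j x y → trans (*-congʳ (trans (reflexive (≡.cong con (ℕ→ℚ-+ i j))) (con-+ _ _)))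
        (solveS 4 (λ i j x y → (i :+ j) :* (x :* y) := i :* x :* y :+ x :* (j :* y)) refl _ _ _ _)
    ; δ-con* = λ d q x → solveS 3 (λ a b c → a :* (b :* c) := b :* (a :* c)) refl _ _ _
    ; δ-1 = trans (*-congʳ (trans (reflexive (≡.cong con ℕ→ℚ-0)) con-0)) (zeroˡ _)
    ; δ-0 = λ d → zeroʳ _ }

  1/suc-cancel : ∀ d x → con (+ 1 ℚ./ suc d) * (con (ℕ→ℚ (suc d)) * x) ≈ x
  1/suc-cancel d x = begin
    con (+ 1 ℚ./ suc d) * (con (ℕ→ℚ (suc d)) * x)   ≈⟨ *-assoc _ _ _ ⟨
    con (+ 1 ℚ./ suc d) * con (ℕ→ℚ (suc d)) * x     ≈⟨ *-congʳ (con-* _ _) ⟨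
    con ((+ 1 ℚ./ suc d) ℚ.* ℕ→ℚ (suc d)) * x       ≡⟨ ≡.cong (λ q → con q * x) (1/suc*suc d) ⟩
    con 1ℚ * x                                        ≈⟨ *-congʳ con-1 ⟩
    1# * x                                            ≈⟨ *-identityˡ x ⟩
    x                                                 ∎

  logΩ : Carrier → Seq
  logΩ a zero    = 0#
  logΩ a (suc k) = con (+ 1 ℚ./ suc k) * ψ[1+ k ] a

  exp-cong : ∀ {a b} → a ≋ b → exp a ≋ exp b
  exp-cong {a} {b} eq d = ∑-cong d λ m _ → *-congˡ {con (1/ m !)} (pow m d)
    where
    pow : ∀ m → (a ^⊛ m) ≋ (b ^⊛ m)
    pow zero    d = refl
    pow (suc m) d = ⊛-cong eq (pow m) d

  Ω-frozen : ∀ a d → Ω a d ≈ exp (logΩ a) d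
  Ω-frozen a d = trans (exp-frozen _ d) (exp-cong (λ { zero → refl ; (suc k) → refl }) d)

  Ω-0 : ∀ a → Ω a 0 ≈ 1#
  Ω-0 a = trans (+-identityʳ _) (trans (*-identityʳ _) con-1)

  -- The chain rule for exp, with degrees lowered by one because `logΩ a` has no constant term. With
  -- `euler` it becomes Newton's identity, and with a partial derivative it differentiates Ω[a].
  Ω-derivation : ∀ {δ} → IsDerivation δ → ∀ a d →
    δ (suc d) (Ω a (suc d)) ≈ ((λ k → δ (suc k) (logΩ a (suc k))) ⊛ Ω a) d
  Ω-derivation {δ} isDerivation a d = begin
    δ (suc d) (Ω a (suc d))
      ≈⟨ δ-cong (suc d) (Ω-frozen a (suc d)) ⟩
    δ (suc d) (exp (logΩ a) (suc d))
      ≈⟨ ∂-exp (logΩ a) refl (suc d) ⟩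
    δ 0 0# * exp (logΩ a) (suc d) + ((λ k → δ (suc k) (logΩ a (suc k))) ⊛ exp (logΩ a)) d
      ≈⟨ trans (+-congʳ (trans (*-congʳ (δ-0 0)) (zeroˡ _))) (+-identityˡ _) ⟩
    ((λ k → δ (suc k) (logΩ a (suc k))) ⊛ exp (logΩ a)) d
      ≈⟨ ⊛-congˡ {λ k → δ (suc k) (logΩ a (suc k))} (Ω-frozen a) d ⟨
    ((λ k → δ (suc k) (logΩ a (suc k))) ⊛ Ω a) d ∎
    where
    open Derivation isDerivation
    open IsDerivation isDerivation

  newton : ∀ a d → con (ℕ→ℚ (suc d)) * Ω a (suc d) ≈ ((λ k → ψ[1+ k ] a) ⊛ Ω a) d
  newton a d = trans (Ω-derivation euler a d)
    (⊛-congʳ (λ k → trans (x∙yz≈y∙xz _ _ _) (1/suc-cancel k (ψ[1+ k ] a))) d)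

  scale-cancel : ∀ d {x y} → con (ℕ→ℚ (suc d)) * x ≈ con (ℕ→ℚ (suc d)) * y → x ≈ y
  scale-cancel d {x} {y} eq = trans (sym (1/suc-cancel d x)) (trans (*-congˡ eq) (1/suc-cancel d y))

  -- The recursion gives the multiple by d + 1 of the next coefficient, and d + 1 is invertible in
  -- ℚ. This identifies Ω[a] with other series without expanding an exponential.
  newton-unique : ∀ {p a b} → a 0 ≈ b 0 →
    (∀ d → con (ℕ→ℚ (suc d)) * a (suc d) ≈ (p ⊛ a) d) →
    (∀ d → con (ℕ→ℚ (suc d)) * b (suc d) ≈ (p ⊛ b) d) → a ≋ b
  newton-unique {p} {a} {b} eq₀ eqa eqb = <-rec _ λ
    { zero    rec → eq₀
    ; (suc d) rec → scale-cancel d (trans (eqa d) (trans (⊛-cong≤ {p} d (λ _ _ → refl) (λ i i≤d → rec (s≤s i≤d))) (sym (eqb d)))) }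

  -- Newton's recursion builds every Ω a d from power sums of a, so any property that is graded by
  -- degree and compatible with the ring operations spreads from the power sums to Ω. It serves for
  -- orders as well as for degrees.
  Ω-filtered : ∀ (Φ : ℕ → Carrier → Set) → (∀ {d x y} → x ≈ y → Φ d x → Φ d y) →
    (∀ {d x y} → Φ d x → Φ d y → Φ d (x + y)) → (∀ {i j x y} → Φ i x → Φ j y → Φ (i ℕ.+ j) (x * y)) →
    (∀ q → Φ 0 (con q)) → ∀ a → (∀ k → Φ (suc k) (ψ[1+ k ] a)) → ∀ d → Φ d (Ω a d)
  Ω-filtered Φ Φ-≈ Φ-+ Φ-* Φ-con a Φ-ψ = <-rec _ λ
    { zero    rec → Φ-≈ (trans con-1 (sym (Ω-0 a))) (Φ-con 1ℚ)
    ; (suc d) rec → Φ-≈ (trans (*-congˡ (sym (newton a d))) (1/suc-cancel d (Ω a (suc d))))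
        (Φ-* (Φ-con (+ 1 ℚ./ suc d)) (conv d (λ k → ψ[1+ k ] a) 0 (λ i _ → Φ-ψ i) (λ i i≤d → rec (s≤s i≤d)))) }
    where
    Φ-≡ : ∀ {i j x} → i ≡ j → Φ i x → Φ j x
    Φ-≡ ≡.refl Φx = Φx

    -- k counts the coefficients of p that have already been split off, so that the degrees still
    -- add up in the recursive call.
    conv : ∀ d p k → (∀ i → i ℕ.≤ d → Φ (suc (k ℕ.+ i)) (p i)) → (∀ i → i ℕ.≤ d → Φ i (Ω a i)) → Φ (suc (k ℕ.+ d)) ((p ⊛ Ω a) d)
    conv zero    p k Φp ΦΩ = Φ-≡ (ℕ.+-identityʳ (suc (k ℕ.+ 0))) (Φ-* (Φp 0 z≤n) (ΦΩ 0 z≤n))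
    conv (suc d) p k Φp ΦΩ = Φ-+
      (Φ-≡ (≡.cong (λ i → suc (i ℕ.+ suc d)) (ℕ.+-identityʳ k)) (Φ-* (Φp 0 z≤n) (ΦΩ (suc d) ℕ.≤-refl)))
      (Φ-≡ (≡.cong suc (≡.sym (ℕ.+-suc k d))) (conv d (p ∘ suc) (suc k)
        (λ i i≤d → Φ-≡ (≡.cong suc (ℕ.+-suc k i)) (Φp (suc i) (s≤s i≤d))) (λ i i≤d → ΦΩ i (ℕ.m≤n⇒m≤1+n i≤d))))

  shift : ℕ → Seq → Seq
  shift = delay 0#

  ⊛-0ˡ : ∀ {a b} d → (∀ i → i ℕ.≤ d → a i ≈ 0#) → (a ⊛ b) d ≈ 0#
  ⊛-0ˡ {a} {b} d eq = trans (⊛-comm a b d) (⊛-0ʳ {b} d eq)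

  ⊛-single : ∀ k {a b} → (∀ j → k ≢ j → a j ≈ 0#) → (a ⊛ b) ≋ λ d → a k * shift k b d
  ⊛-single zero    a≈0 zero    = refl
  ⊛-single zero    a≈0 (suc d) = trans (+-congˡ (⊛-0ˡ d λ i _ → a≈0 (suc i) λ ())) (+-identityʳ _)
  ⊛-single (suc k) a≈0 zero    = trans (trans (*-congʳ (a≈0 0 λ ())) (zeroˡ _)) (sym (zeroʳ _))
  ⊛-single (suc k) a≈0 (suc d) = trans (+-cong (trans (*-congʳ (a≈0 0 λ ())) (zeroˡ _))
    (⊛-single k (λ j k≢j → a≈0 (suc j) (k≢j ∘ ℕ.suc-injective)) d)) (+-identityˡ _)

  ∑-delay : ∀ {C : Set} (c₀ : C) k N (φ : ℕ → C → Carrier) b → (∀ i → φ i c₀ ≈ 0#) →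
    ∑ (k ℕ.+ N) (λ i → φ i (delay c₀ k b i)) ≈ ∑ N λ i → φ (k ℕ.+ i) (b i)
  ∑-delay c₀ zero    N φ b φ-0 = refl
  ∑-delay c₀ (suc k) N φ b φ-0 = trans (+-cong (φ-0 0) (∑-delay c₀ k N (φ ∘ suc) b (φ-0 ∘ suc))) (+-identityˡ _)

  -- A derivation that sees only one term of the logarithm, as k ∂/∂p_k does for Ω[YX], turns the
  -- convolution of the chain rule into a mere shift.
  Ω-single : ∀ {δ} → IsDerivation δ → ∀ k a {y} → (∀ j → k ≢ j → δ (suc j) (logΩ a (suc j)) ≈ 0#) →
    δ (suc k) (logΩ a (suc k)) ≈ y → ∀ d → δ d (Ω a d) ≈ y * shift (suc k) (Ω a) d
  Ω-single isDerivation k a a≈0 eq zero    = trans (trans (δ-cong 0 (Ω-0 a)) δ-1) (sym (zeroʳ _))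
    where open IsDerivation isDerivation
  Ω-single isDerivation k a a≈0 eq (suc d) = trans (Ω-derivation isDerivation a d)
    (trans (⊛-single k a≈0 d) (*-congʳ eq))

open import Defs

Λ-laws : Laws Λ-plethysticRing
Λ-laws = record
  { _∼_ = _≈_ ; isCommutativeRing = CommutativeRing.isCommutativeRing Λ-commutativeRing
  ; con-1 = ≈-refl ; con-+ = con-+ ; con-* = con-* }

module S = Series Λ-plethysticRing Λ-laws
open S public using (∑; Seq; _≋_; _⊛_; setoid; +-congˡ; +-congʳ; *-congˡ; *-congʳ; zeroˡ; zeroʳ; +-identityʳ; *-identityʳ; -‿inverseʳ; distribʳ;
  reflexive; interchange; x∙yz≈y∙xz; con-neg; shift) renaming (module Solver to ΛSolver)
open ΛSolver public using (_:+_; _:*_; _:-_; :-_; _:=_) renaming (solve to solveΛ; con to K)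
module ≈-Reasoning = SetoidReasoning setoid

-- Skewing as differential operators

der : (ℕ → Λ) → Λ → Λ
der g (con q)  = con 0ℚ
der g p[1+ k ] = g k
der g (P + Q)  = der g P + der g Q
der g (P * Q)  = der g P * Q + P * der g Q
der g (- P)    = - der g P

der-cong : ∀ g {P Q} → P ≈ Q → der g P ≈ der g Q
der-cong g ≈-refl             = ≈-refl
der-cong g (≈-sym eq)         = ≈-sym (der-cong g eq)
der-cong g (≈-trans eq eq′)   = ≈-trans (der-cong g eq) (der-cong g eq′)
der-cong g (+-cong eq eq′)    = +-cong (der-cong g eq) (der-cong g eq′)
der-cong g (*-cong eq eq′)    = +-cong (*-cong (der-cong g eq) eq′) (*-cong eq (der-cong g eq′))
der-cong g (-‿cong eq)        = -‿cong (der-cong g eq)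
der-cong g (+-assoc P Q S)    = +-assoc _ _ _
der-cong g (+-comm P Q)       = +-comm _ _
der-cong g (+-identityˡ P)    = +-identityˡ _
der-cong g (-‿inverseˡ P)     = -‿inverseˡ _
der-cong g (*-assoc P Q S)    = solveΛ 6 (λ P Q S P′ Q′ S′ → (P′ :* Q :+ P :* Q′) :* S :+ P :* Q :* S′
  := P′ :* (Q :* S) :+ P :* (Q′ :* S :+ Q :* S′)) ≈-refl P Q S _ _ _
der-cong g (*-comm P Q)       = solveΛ 4 (λ P Q P′ Q′ → P′ :* Q :+ P :* Q′ := Q′ :* P :+ Q :* P′) ≈-refl P Q _ _
der-cong g (*-identityˡ P)    = solveΛ 2 (λ P P′ → K 0ℚ :* P :+ K 1ℚ :* P′ := P′) ≈-refl P _
der-cong g (distribˡ P Q S)   = solveΛ 6 (λ P Q S P′ Q′ S′ → P′ :* (Q :+ S) :+ P :* (Q′ :+ S′)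
  := (P′ :* Q :+ P :* Q′) :+ (P′ :* S :+ P :* S′)) ≈-refl P Q S _ _ _
der-cong g (con-+ a b)        = ≈-sym (+-identityˡ _)
der-cong g (con-* a b)        = solveΛ 2 (λ a b → K 0ℚ := K 0ℚ :* b :+ a :* K 0ℚ) ≈-refl (con a) (con b)

δ : ℕ → ℕ → ℚ
δ zero    zero    = 1ℚ
δ zero    (suc j) = 0ℚ
δ (suc i) zero    = 0ℚ
δ (suc i) (suc j) = δ i j

δ-sym : ∀ i j → δ i j ≡ δ j i
δ-sym zero    zero    = ≡.refl
δ-sym zero    (suc j) = ≡.refl
δ-sym (suc i) zero    = ≡.refl
δ-sym (suc i) (suc j) = δ-sym i j

δ-≡ : ∀ i → δ i i ≡ 1ℚ
δ-≡ zero    = ≡.refl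
δ-≡ (suc i) = δ-≡ i

δ-cases : ∀ i j → i ≡ j ⊎ δ i j ≡ 0ℚ
δ-cases zero    zero    = inj₁ ≡.refl
δ-cases zero    (suc j) = inj₂ ≡.refl
δ-cases (suc i) zero    = inj₂ ≡.refl
δ-cases (suc i) (suc j) with δ-cases i j
... | inj₁ i≡j = inj₁ (≡.cong suc i≡j)
... | inj₂ eq  = inj₂ eq

∑-δ : ∀ N (a : ℕ → Λ) j → j ℕ.≤ N → ∑ N (λ k → con (δ k j) * a k) ≈ a j
∑-δ zero    a zero    _         = *-identityˡ _
∑-δ (suc N) a zero    _         = ≈-trans (+-cong (*-identityˡ _) (S.∑-0 N λ i _ → zeroˡ _)) (+-identityʳ _)
∑-δ (suc N) a (suc j) (s≤s j≤N) = ≈-trans (+-cong (zeroˡ _) (∑-δ N (a ∘ suc) j j≤N)) (+-identityˡ _)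

kron : ℕ → ℕ → ℚ
kron k j = ℕ→ℚ (suc k) ℚ.* δ k j

kron-sym : ∀ k j → kron k j ≡ kron j k
kron-sym k j with δ-cases k j
... | inj₁ ≡.refl = ≡.refl
... | inj₂ eq = ≡.trans (≡.cong (ℕ→ℚ (suc k) ℚ.*_) eq) (≡.trans (ℚ.*-zeroʳ (ℕ→ℚ (suc k)))
  (≡.sym (≡.trans (≡.cong (ℕ→ℚ (suc j) ℚ.*_) (≡.trans (δ-sym j k) eq)) (ℚ.*-zeroʳ (ℕ→ℚ (suc j))))))

kron-cases : ∀ k j → k ≡ j ⊎ kron k j ≡ 0ℚ
kron-cases k j with δ-cases k j
... | inj₁ eq = inj₁ eq
... | inj₂ eq = inj₂ (≡.trans (≡.cong (ℕ→ℚ (suc k) ℚ.*_) eq) (ℚ.*-zeroʳ (ℕ→ℚ (suc k))))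

kron-≢ : ∀ {k j} → k ≢ j → kron k j ≡ 0ℚ
kron-≢ {k} {j} k≢j with kron-cases k j
... | inj₁ k≡j = contradiction k≡j k≢j
... | inj₂ eq  = eq

kron-≡ : ∀ k → kron k k ≡ ℕ→ℚ (suc k)
kron-≡ k = ≡.trans (≡.cong (ℕ→ℚ (suc k) ℚ.*_) (δ-≡ k)) (ℚ.*-identityʳ (ℕ→ℚ (suc k)))

-- ∂ k is the operator p_{1+k}^⊥ = (1+k) ∂/∂p_{1+k}.
∂ : ℕ → Λ → Λ
∂ k = der λ j → con (kron k j)

D : Λ → Λ → Λ
D (con q)  Q = con q * Q
D p[1+ k ] Q = ∂ k Q
D (P + P′) Q = D P Q + D P′ Q
D (P * P′) Q = D P (D P′ Q)
D (- P)    Q = - D P Q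

∂-cong : ∀ k {P Q} → P ≈ Q → ∂ k P ≈ ∂ k Q
∂-cong k = der-cong _

D-congʳ : ∀ P {Q Q′} → Q ≈ Q′ → D P Q ≈ D P Q′
D-congʳ (con q)  eq = *-congˡ eq
D-congʳ p[1+ k ] eq = ∂-cong k eq
D-congʳ (P + P′) eq = +-cong (D-congʳ P eq) (D-congʳ P′ eq)
D-congʳ (P * P′) eq = D-congʳ P (D-congʳ P′ eq)
D-congʳ (- P)    eq = -‿cong (D-congʳ P eq)

neg-+ : ∀ P Q → - (P + Q) ≈ - P + - Q
neg-+ = solveΛ 2 (λ P Q → :- (P :+ Q) := :- P :+ :- Q) ≈-refl

D-+ : ∀ P Q Q′ → D P (Q + Q′) ≈ D P Q + D P Q′
D-+ (con q)  Q Q′ = distribˡ _ _ _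
D-+ p[1+ k ] Q Q′ = ≈-refl
D-+ (P + P′) Q Q′ = ≈-trans (+-cong (D-+ P Q Q′) (D-+ P′ Q Q′)) (interchange _ _ _ _)
D-+ (P * P′) Q Q′ = ≈-trans (D-congʳ P (D-+ P′ Q Q′)) (D-+ P _ _)
D-+ (- P)    Q Q′ = ≈-trans (-‿cong (D-+ P Q Q′)) (neg-+ _ _)

∂-con* : ∀ k a Q → ∂ k (con a * Q) ≈ con a * ∂ k Q
∂-con* k a Q = ≈-trans (+-congʳ (zeroˡ _)) (+-identityˡ _)

D-con* : ∀ P a Q → D P (con a * Q) ≈ con a * D P Q
D-con* (con q)  a Q = x∙yz≈y∙xz _ _ _
D-con* p[1+ k ] a Q = ∂-con* k a Q
D-con* (P + P′) a Q = ≈-trans (+-cong (D-con* P a Q) (D-con* P′ a Q)) (≈-sym (distribˡ _ _ _))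
D-con* (P * P′) a Q = ≈-trans (D-congʳ P (D-con* P′ a Q)) (D-con* P a _)
D-con* (- P)    a Q = ≈-trans (-‿cong (D-con* P a Q)) (S.-‿distribʳ-* _ _)

neg-con : ∀ P → - P ≈ con (ℚ.- 1ℚ) * P
neg-con = solveΛ 1 (λ P → :- P := K (ℚ.- 1ℚ) :* P) ≈-refl

D-neg : ∀ P Q → D P (- Q) ≈ - D P Q
D-neg P Q = ≈-trans (D-congʳ P (neg-con Q)) (≈-trans (D-con* P _ Q) (≈-sym (neg-con _)))

D-0 : ∀ P → D P (con 0ℚ) ≈ con 0ℚ
D-0 P = ≈-trans (D-congʳ P (≈-sym (zeroˡ _))) (≈-trans (D-con* P 0ℚ (con 0ℚ)) (zeroˡ _))

∂-comm : ∀ k l Q → ∂ k (∂ l Q) ≈ ∂ l (∂ k Q)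
∂-comm k l (con q)  = ≈-refl
∂-comm k l p[1+ j ] = ≈-refl
∂-comm k l (P + Q)  = +-cong (∂-comm k l P) (∂-comm k l Q)
∂-comm k l (P * Q)  = ≈-trans
  (+-cong (+-cong (*-congʳ (∂-comm k l P)) ≈-refl) (+-congˡ (*-congˡ (∂-comm k l Q))))
  (interchange (∂ l (∂ k P) * Q) (∂ l P * ∂ k Q) (∂ k P * ∂ l Q) (P * ∂ l (∂ k Q)))
∂-comm k l (- P)    = -‿cong (∂-comm k l P)

D-∂-comm : ∀ P k Q → D P (∂ k Q) ≈ ∂ k (D P Q)
D-∂-comm (con q)  k Q = ≈-sym (∂-con* k q Q)
D-∂-comm p[1+ l ] k Q = ∂-comm l k Q
D-∂-comm (P + P′) k Q = +-cong (D-∂-comm P k Q) (D-∂-comm P′ k Q)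
D-∂-comm (P * P′) k Q = ≈-trans (D-congʳ P (D-∂-comm P′ k Q)) (D-∂-comm P k _)
D-∂-comm (- P)    k Q = -‿cong (D-∂-comm P k Q)

D-comm : ∀ P P′ Q → D P (D P′ Q) ≈ D P′ (D P Q)
D-comm P (con q)   Q = D-con* P q Q
D-comm P p[1+ k ]  Q = D-∂-comm P k Q
D-comm P (P₁ + P₂) Q = ≈-trans (D-+ P _ _) (+-cong (D-comm P P₁ Q) (D-comm P P₂ Q))
D-comm P (P₁ * P₂) Q = ≈-trans (D-comm P P₁ _) (D-congʳ P₁ (D-comm P P₂ Q))
D-comm P (- P₁)    Q = ≈-trans (D-neg P _) (-‿cong (D-comm P P₁ Q))

-- P ↦ D P is a ring homomorphism into the operators on Λ; the relation `*-comm` is respected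
-- because the `∂ k` commute with each other.
D-congˡ : ∀ {P P′} → P ≈ P′ → ∀ Q → D P Q ≈ D P′ Q
D-congˡ ≈-refl           Q = ≈-refl
D-congˡ (≈-sym eq)       Q = ≈-sym (D-congˡ eq Q)
D-congˡ (≈-trans eq eq′) Q = ≈-trans (D-congˡ eq Q) (D-congˡ eq′ Q)
D-congˡ (+-cong eq eq′)  Q = +-cong (D-congˡ eq Q) (D-congˡ eq′ Q)
D-congˡ (*-cong {P} {P′ = P′} eq eq′) Q = ≈-trans (D-congˡ eq _) (D-congʳ P′ (D-congˡ eq′ Q))
D-congˡ (-‿cong eq)      Q = -‿cong (D-congˡ eq Q)
D-congˡ (+-assoc P₁ P₂ P₃) Q = +-assoc _ _ _
D-congˡ (+-comm P₁ P₂)     Q = +-comm _ _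
D-congˡ (+-identityˡ P)  Q = ≈-trans (+-congʳ (zeroˡ _)) (+-identityˡ _)
D-congˡ (-‿inverseˡ P)   Q = ≈-trans (-‿inverseˡ _) (≈-sym (zeroˡ _))
D-congˡ (*-assoc P₁ P₂ P₃) Q = ≈-refl
D-congˡ (*-comm P₁ P₂)     Q = D-comm P₁ P₂ Q
D-congˡ (*-identityˡ P)  Q = *-identityˡ _
D-congˡ (distribˡ P P₁ P₂) Q = D-+ P _ _
D-congˡ (con-+ a b)      Q = ≈-trans (*-congʳ (con-+ a b)) (distribʳ _ _ _)
D-congˡ (con-* a b)      Q = ≈-trans (*-congʳ (con-* a b)) (*-assoc _ _ _)

D-cong : ∀ {P P′ Q Q′} → P ≈ P′ → Q ≈ Q′ → D P Q ≈ D P′ Q′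
D-cong {P} eq eq′ = ≈-trans (D-congʳ P eq′) (D-congˡ eq _)

-- As in the Weyl algebra, the commutator of a constant-coefficient differential operator with
-- multiplication by a variable is the derivative of its symbol.
D-p* : ∀ P k Q → D P (p[1+ k ] * Q) ≈ p[1+ k ] * D P Q + D (∂ k P) Q
D-p* (con q)  k Q = ≈-trans (x∙yz≈y∙xz _ _ _) (≈-sym (≈-trans (+-congˡ (zeroˡ _)) (+-identityʳ _)))
D-p* p[1+ j ] k Q = ≈-trans (+-comm _ _) (+-congˡ (*-congʳ (reflexive (≡.cong con (kron-sym j k)))))
D-p* (P + P′) k Q = ≈-trans (+-cong (D-p* P k Q) (D-p* P′ k Q))
  (≈-trans (interchange _ _ _ _) (+-congʳ (≈-sym (distribˡ _ _ _))))
D-p* (P * P′) k Q = ≈-trans (D-congʳ P (D-p* P′ k Q)) (≈-trans (D-+ P _ _)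
  (≈-trans (+-congʳ (D-p* P k _)) (+-assoc _ _ _)))
D-p* (- P)    k Q = ≈-trans (-‿cong (D-p* P k Q)) (≈-trans (neg-+ _ _) (+-congʳ (S.-‿distribʳ-* _ _)))

ε : Λ → ℚ
ε (con q)  = q
ε p[1+ k ] = 0ℚ
ε (P + Q)  = ε P ℚ.+ ε Q
ε (P * Q)  = ε P ℚ.* ε Q
ε (- P)    = ℚ.- ε P

ε-cong : ∀ {P Q} → P ≈ Q → ε P ≡ ε Q
ε-cong ≈-refl           = ≡.refl
ε-cong (≈-sym eq)       = ≡.sym (ε-cong eq)
ε-cong (≈-trans eq eq′) = ≡.trans (ε-cong eq) (ε-cong eq′)
ε-cong (+-cong eq eq′)  = ≡.cong₂ ℚ._+_ (ε-cong eq) (ε-cong eq′)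
ε-cong (*-cong eq eq′)  = ≡.cong₂ ℚ._*_ (ε-cong eq) (ε-cong eq′)
ε-cong (-‿cong eq)      = ≡.cong (ℚ.-_) (ε-cong eq)
ε-cong (+-assoc P Q S)  = ℚ.+-assoc (ε P) (ε Q) (ε S)
ε-cong (+-comm P Q)     = ℚ.+-comm (ε P) (ε Q)
ε-cong (+-identityˡ P)  = ℚ.+-identityˡ (ε P)
ε-cong (-‿inverseˡ P)   = ℚ.+-inverseˡ (ε P)
ε-cong (*-assoc P Q S)  = ℚ.*-assoc (ε P) (ε Q) (ε S)
ε-cong (*-comm P Q)     = ℚ.*-comm (ε P) (ε Q)
ε-cong (*-identityˡ P)  = ℚ.*-identityˡ (ε P)
ε-cong (distribˡ P Q S) = ℚ.*-distribˡ-+ (ε P) (ε Q) (ε S)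
ε-cong (con-+ a b)      = ≡.refl
ε-cong (con-* a b)      = ≡.refl

D-con : ∀ P q → D P (con q) ≈ con (ε P ℚ.* q)
D-con (con a)  q = ≈-sym (con-* a q)
D-con p[1+ k ] q = reflexive (≡.cong con (≡.sym (ℚ.*-zeroˡ q)))
D-con (P + P′) q = ≈-trans (+-cong (D-con P q) (D-con P′ q)) (≈-trans (≈-sym (con-+ _ _))
  (reflexive (≡.cong con (≡.sym (ℚ.*-distribʳ-+ q (ε P) (ε P′))))))
D-con (P * P′) q = ≈-trans (D-congʳ P (D-con P′ q)) (≈-trans (D-con P _)
  (reflexive (≡.cong con (≡.sym (ℚ.*-assoc (ε P) (ε P′) q)))))
D-con (- P)    q = ≈-trans (-‿cong (D-con P q)) (≈-trans (≈-sym (con-neg _))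
  (reflexive (≡.cong con (ℚ.neg-distribˡ-* (ε P) q))))

-- Induction along multiplication by a generator rather than along terms: the operators studied here
-- have commutation rules with the p_k, but no rule for a general product.
Λ-ind : (Φ : Λ → Set) → (∀ {P Q} → P ≈ Q → Φ P → Φ Q) → (∀ {P Q} → Φ P → Φ Q → Φ (P + Q)) →
  (∀ q {P} → Φ P → Φ (con q * P)) → (∀ k {P} → Φ P → Φ (p[1+ k ] * P)) → Φ (con 1ℚ) → ∀ P → Φ P
Λ-ind Φ Φ-≈ Φ-+ Φ-con Φ-p Φ-1 P = Φ-≈ (*-identityʳ P) (mul P Φ-1)
  where
  mul : ∀ P {Q} → Φ Q → Φ (P * Q)
  mul (con q)  ΦQ = Φ-con q ΦQ
  mul p[1+ k ] ΦQ = Φ-p k ΦQ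
  mul (P + P′) ΦQ = Φ-≈ (≈-sym (distribʳ _ _ _)) (Φ-+ (mul P ΦQ) (mul P′ ΦQ))
  mul (P * P′) ΦQ = Φ-≈ (≈-sym (*-assoc _ _ _)) (mul P (mul P′ ΦQ))
  mul (- P) {Q} ΦQ = Φ-≈ (≈-trans (≈-sym (neg-con _)) (S.-‿distribˡ-* P Q)) (Φ-con (ℚ.- 1ℚ) (mul P ΦQ))

-- The form for which the adjoint of multiplication by p_k is k ∂/∂p_k.
⟪_,_⟫ : Λ → Λ → ℚ
⟪ P , Q ⟫ = ε (D P Q)

-- For a generator, `D-p*` yields the wanted term and a multiple of p_{1+k}, which ε kills. Products
-- then follow because the operators D P commute.
⟪⟫-adjoint : ∀ P Q S → ⟪ Q , P * S ⟫ ≡ ⟪ D P Q , S ⟫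
⟪⟫-adjoint (con q)  Q S = ε-cong (D-con* Q q S)
⟪⟫-adjoint p[1+ k ] Q S = ≡.trans (ε-cong (D-p* Q k S))
  (≡.trans (≡.cong (ℚ._+ ε (D (∂ k Q) S)) (ℚ.*-zeroˡ (ε (D Q S)))) (ℚ.+-identityˡ _))
⟪⟫-adjoint (P + P′) Q S = ≡.trans (ε-cong (≈-trans (D-congʳ Q (distribʳ S P P′)) (D-+ Q _ _)))
  (≡.cong₂ ℚ._+_ (⟪⟫-adjoint P Q S) (⟪⟫-adjoint P′ Q S))
⟪⟫-adjoint (P * P′) Q S = ≡.trans (ε-cong (D-congʳ Q (*-assoc P P′ S)))
  (≡.trans (⟪⟫-adjoint P Q (P′ * S)) (≡.trans (⟪⟫-adjoint P′ (D P Q) S) (ε-cong (D-congˡ (D-comm P′ P Q) S))))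
⟪⟫-adjoint (- P)    Q S = ≡.trans (ε-cong (≈-trans (D-congʳ Q (≈-sym (S.-‿distribˡ-* P S))) (D-neg Q _)))
  (≡.cong (ℚ.-_) (⟪⟫-adjoint P Q S))

⟪⟫-1 : ∀ P → ⟪ P , con 1ℚ ⟫ ≡ ε P
⟪⟫-1 P = ≡.trans (ε-cong (D-con P 1ℚ)) (ℚ.*-identityʳ (ε P))

⟪⟫-sym : ∀ P Q → ⟪ P , Q ⟫ ≡ ⟪ Q , P ⟫
⟪⟫-sym P Q = ≡.sym (≡.trans (ε-cong (D-congʳ Q (≈-sym (*-identityʳ P)))) (≡.trans (⟪⟫-adjoint P Q (con 1ℚ)) (⟪⟫-1 (D P Q))))

-- Degree less than n, with p_k of degree k.
data Low : ℕ → Λ → Set where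
  low-≈   : ∀ {n P Q} → P ≈ Q → Low n P → Low n Q
  low-0   : ∀ {n} → Low n (con 0ℚ)
  low-con : ∀ {n q} → Low (suc n) (con q)
  low-p   : ∀ {n k} → suc k ℕ.< n → Low n p[1+ k ]
  low-+   : ∀ {n P Q} → Low n P → Low n Q → Low n (P + Q)
  low-*   : ∀ {n a b P Q} → n ≡ suc (a ℕ.+ b) → Low (suc a) P → Low (suc b) Q → Low n (P * Q)

low-mono : ∀ {m n P} → m ℕ.≤ n → Low m P → Low n P
low-mono m≤n       (low-≈ eq l)  = low-≈ eq (low-mono m≤n l)
low-mono m≤n       low-0         = low-0
low-mono (s≤s m≤n) low-con       = low-con
low-mono m≤n       (low-p k<m)   = low-p (ℕ.≤-trans k<m m≤n)
low-mono m≤n       (low-+ l l′)  = low-+ (low-mono m≤n l) (low-mono m≤n l′)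
low-mono {n = suc n} (s≤s m≤n) (low-* {a = a} {b} ≡.refl l l′) =
  low-* {a = a} {b ℕ.+ (n ℕ.∸ (a ℕ.+ b))} (≡.cong suc (≡.trans (≡.sym (ℕ.m+[n∸m]≡n m≤n)) (ℕ.+-assoc a b _)))
    l (low-mono (s≤s (ℕ.m≤m+n b _)) l′)

low-≡ : ∀ {m n P} → m ≡ n → Low m P → Low n P
low-≡ ≡.refl l = l

low-zero : ∀ {P} → Low 0 P → P ≈ con 0ℚ
low-zero (low-≈ eq l) = ≈-trans (≈-sym eq) (low-zero l)
low-zero low-0        = ≈-refl
low-zero (low-+ l l′) = ≈-trans (+-cong (low-zero l) (low-zero l′)) (+-identityˡ _)

low-*ˡ : ∀ {m b P Q} → Low m P → Low (suc b) Q → Low (m ℕ.+ b) (P * Q)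
low-*ˡ {zero}  l l′ = low-≈ (≈-sym (≈-trans (*-congʳ (low-zero l)) (zeroˡ _))) low-0
low-*ˡ {suc m} l l′ = low-* ≡.refl l l′

low-con* : ∀ {n P} q → Low n P → Low n (con q * P)
low-con* {zero}  q l = low-≈ (≈-trans (≈-sym (zeroʳ _)) (*-congˡ (≈-sym (low-zero l)))) low-0
low-con* {suc n} q l = low-* ≡.refl low-con l

low-neg : ∀ {n P} → Low n P → Low n (- P)
low-neg l = low-≈ (≈-sym (neg-con _)) (low-con* (ℚ.- 1ℚ) l)

low-degree : ∀ P → Low (suc (degree P)) P
low-degree (con q)  = low-con
low-degree p[1+ k ] = low-p ℕ.≤-refl
low-degree (P + Q)  = low-+ (low-mono (s≤s (ℕ.m≤m⊔n _ _)) (low-degree P)) (low-mono (s≤s (ℕ.m≤n⊔m (degree P) _)) (low-degree Q))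
low-degree (P * Q)  = low-* ≡.refl (low-degree P) (low-degree Q)
low-degree (- P)    = low-neg (low-degree P)

low-∂ : ∀ k {n P} → Low n P → Low (n ℕ.∸ suc k) (∂ k P)
low-∂ k (low-≈ eq l) = low-≈ (∂-cong k eq) (low-∂ k l)
low-∂ k low-0        = low-0
low-∂ k low-con      = low-0
low-∂ k {n} (low-p {k = j} j<n) with kron-cases k j
... | inj₁ ≡.refl = low-mono (ℕ.m<n⇒0<n∸m j<n) low-con
... | inj₂ eq     = low-≈ (reflexive (≡.cong con (≡.sym eq))) low-0
low-∂ k (low-+ l l′) = low-+ (low-∂ k l) (low-∂ k l′)
low-∂ k (low-* {a = a} {b} {P} {Q} ≡.refl l l′) = low-+ left (low-≈ (*-comm _ _) right)
  where
  left : Low (a ℕ.+ b ℕ.∸ k) (∂ k P * Q)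
  left with k ℕ.≤? a
  ... | yes k≤a = low-≡ (≡.sym (ℕ.+-∸-comm b k≤a)) (low-*ˡ (low-∂ k l) l′)
  ... | no  k≰a = low-≈ (≈-sym (≈-trans (*-congʳ (low-zero
    (low-≡ (ℕ.m≤n⇒m∸n≡0 (ℕ.<⇒≤ (ℕ.≰⇒> k≰a))) (low-∂ k l)))) (zeroˡ _))) low-0
  right : Low (a ℕ.+ b ℕ.∸ k) (∂ k Q * P)
  right with k ℕ.≤? b
  ... | yes k≤b = low-≡ (≡.trans (≡.sym (ℕ.+-∸-comm a k≤b)) (≡.cong (ℕ._∸ k) (ℕ.+-comm b a))) (low-*ˡ (low-∂ k l′) l)
  ... | no  k≰b = low-≈ (≈-sym (≈-trans (*-congʳ (low-zero
    (low-≡ (ℕ.m≤n⇒m∸n≡0 (ℕ.<⇒≤ (ℕ.≰⇒> k≰b))) (low-∂ k l′)))) (zeroˡ _))) low-0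

-- Expressed through the action of `D P` on degrees: this is evidently invariant under `_≈_` and
-- makes `D P` vanish on everything of degree below d, which is why the sums defining Ω[A]^⊥ are
-- finite.
record Order≥ (d : ℕ) (P : Λ) : Set where
  constructor order
  field lowers : ∀ {n Q} → Low n Q → Low (n ℕ.∸ d) (D P Q)
open Order≥

order-≈ : ∀ {d P P′} → P ≈ P′ → Order≥ d P → Order≥ d P′
order-≈ eq o = order λ {n} {Q} l → low-≈ (D-congˡ eq Q) (lowers o l)

order-con : ∀ q → Order≥ 0 (con q)
order-con q = order (low-con* q)

order-p : ∀ k → Order≥ (suc k) p[1+ k ]
order-p k = order (low-∂ k)

order-+ : ∀ {d P P′} → Order≥ d P → Order≥ d P′ → Order≥ d (P + P′)
order-+ o o′ = order λ l → low-+ (lowers o l) (lowers o′ l)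

order-* : ∀ {i j P P′} → Order≥ i P → Order≥ j P′ → Order≥ (i ℕ.+ j) (P * P′)
order-* {i} {j} o o′ = order λ {n} l → low-≡ (≡.trans (ℕ.∸-+-assoc n j i) (≡.cong (n ℕ.∸_) (ℕ.+-comm j i))) (lowers o (lowers o′ l))

order-mono : ∀ {d e P} → d ℕ.≤ e → Order≥ e P → Order≥ d P
order-mono d≤e o = order λ {n} l → low-mono (ℕ.∸-monoʳ-≤ n d≤e) (lowers o l)

order-neg : ∀ {d P} → Order≥ d P → Order≥ d (- P)
order-neg o = order λ l → low-neg (lowers o l)

order-kills : ∀ {d P n Q} → Order≥ d P → Low n Q → n ℕ.≤ d → D P Q ≈ con 0ℚ
order-kills o l n≤d = low-zero (low-≡ (ℕ.m≤n⇒m∸n≡0 n≤d) (lowers o l))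

-- Euler's operator and Taylor's formula

eul : Λ → Λ
eul = der λ j → con (ℕ→ℚ (suc j)) * p[1+ j ]

ℕ→ℚ-∸ : ∀ {k n} → k ℕ.≤ n → ℕ→ℚ n ≡ ℕ→ℚ k ℚ.+ ℕ→ℚ (n ℕ.∸ k)
ℕ→ℚ-∸ {k} {n} k≤n = ≡.trans (≡.cong ℕ→ℚ (≡.sym (ℕ.m+[n∸m]≡n k≤n))) (ℕ→ℚ-+ k (n ℕ.∸ k))

-- `eul` multiplies the homogeneous part of degree j by j, so the difference has no part of the top
-- degree n.
low-eul : ∀ {m n P} → Low m P → m ≡ suc n → Low n (con (ℕ→ℚ n) * P + - eul P)
low-eul (low-≈ eq l) e = low-≈ (+-cong (*-congˡ eq) (-‿cong (der-cong _ eq))) (low-eul l e)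
low-eul {n = n} low-0 e = low-≈ (solveΛ 1 (λ n → K 0ℚ := n :* K 0ℚ :+ :- K 0ℚ) ≈-refl (con (ℕ→ℚ n))) low-0
low-eul {n = zero}  {P = con q} low-con e = low-≈ (≈-sym (≈-trans (+-congʳ (≈-trans (*-congʳ (reflexive (≡.cong con ℕ→ℚ-0))) (zeroˡ _))) (-‿inverseʳ _))) low-0
low-eul {n = suc n} low-con e = low-+ (low-con* _ low-con) (low-neg low-0)
low-eul {n = n} (low-p {k = k} k<m) ≡.refl = low-≈ eq (low-p′ (ℕ.m≤n⇒m<n∨m≡n (ℕ.≤-pred k<m)))
  where
  eq : con (ℕ→ℚ (n ℕ.∸ suc k)) * p[1+ k ] ≈ con (ℕ→ℚ n) * p[1+ k ] + - (con (ℕ→ℚ (suc k)) * p[1+ k ])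
  eq = ≈-sym (≈-trans (+-congʳ (*-congʳ (≈-trans (reflexive (≡.cong con (ℕ→ℚ-∸ (ℕ.≤-pred k<m)))) (con-+ _ _))))
    (solveΛ 3 (λ a b p → (a :+ b) :* p :+ :- (a :* p) := b :* p) ≈-refl _ _ _))
  low-p′ : suc k ℕ.< n ⊎ suc k ≡ n → Low n (con (ℕ→ℚ (n ℕ.∸ suc k)) * p[1+ k ])
  low-p′ (inj₁ k<n)    = low-con* _ (low-p k<n)
  low-p′ (inj₂ ≡.refl) = low-≈ (≈-sym (≈-trans (*-congʳ (reflexive (≡.cong con (≡.trans (≡.cong ℕ→ℚ (ℕ.n∸n≡0 k)) ℕ→ℚ-0)))) (zeroˡ _))) low-0
low-eul (low-+ {P = P} {Q} l l′) e = low-≈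
  (solveΛ 5 (λ n P Q P′ Q′ → (n :* P :+ :- P′) :+ (n :* Q :+ :- Q′) := n :* (P :+ Q) :+ :- (P′ :+ Q′)) ≈-refl _ P Q _ _)
  (low-+ (low-eul l e) (low-eul l′ e))
low-eul (low-* {a = a} {b} {P} {Q} ≡.refl l l′) ≡.refl = low-≈
  (≈-trans (solveΛ 6 (λ a b P Q P′ Q′ → (a :* P :+ :- P′) :* Q :+ (b :* Q :+ :- Q′) :* P := (a :+ b) :* (P :* Q) :+ :- (P′ :* Q :+ P :* Q′))
    ≈-refl (con (ℕ→ℚ a)) (con (ℕ→ℚ b)) P Q (eul P) (eul Q))
    (+-congʳ (*-congʳ (≈-trans (≈-sym (con-+ _ _)) (reflexive (≡.cong con (≡.sym (ℕ→ℚ-+ a b))))))))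
  (low-+ (low-*ˡ (low-eul l ≡.refl) l′)
    (low-≡ (ℕ.+-comm b a) (low-*ˡ (low-eul l′ ≡.refl) l)))

low-1-constant : ∀ {n P} → Low n P → n ≡ 1 → ∃ λ q → P ≈ con q
low-1-constant (low-≈ eq l) e with low-1-constant l e
... | q , eq′ = q , ≈-trans (≈-sym eq) eq′
low-1-constant low-0 e = _ , ≈-refl
low-1-constant low-con e = _ , ≈-refl
low-1-constant (low-p (s≤s (s≤s k<n))) ()
low-1-constant (low-+ l l′) e with low-1-constant l e | low-1-constant l′ e
... | q , eq | q′ , eq′ = q ℚ.+ q′ , ≈-trans (+-cong eq eq′) (≈-sym (con-+ q q′))
low-1-constant (low-* {a = zero} {zero} e′ l l′) e with low-1-constant l ≡.refl | low-1-constant l′ ≡.refl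
... | q , eq | q′ , eq′ = q ℚ.* q′ , ≈-trans (*-cong eq eq′) (≈-sym (con-* q q′))
low-1-constant (low-* {a = zero} {suc b} ≡.refl l l′) ()
low-1-constant (low-* {a = suc a} ≡.refl l l′) ()

-- When `eul P` is 0, the difference in `low-eul` is just a nonzero multiple of P, so the degree
-- bound on P drops until P is constant.
eul-0-constant : ∀ n {P} → Low n P → eul P ≈ con 0ℚ → ∃ λ q → P ≈ con q
eul-0-constant zero          l eq = 0ℚ , low-zero l
eul-0-constant (suc zero)    l eq = low-1-constant l ≡.refl
eul-0-constant (suc (suc n)) {P} l eq with eul-0-constant (suc n) (low-eul l ≡.refl) eul-0
  where
  eul-0 : eul (con (ℕ→ℚ (suc n)) * P + - eul P) ≈ con 0ℚ
  eul-0 = ≈-trans (+-cong (+-congˡ (*-congˡ eq)) (-‿cong (der-cong _ eq)))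
    (solveΛ 2 (λ n P → K 0ℚ :* P :+ n :* K 0ℚ :+ :- K 0ℚ := K 0ℚ) ≈-refl _ P)
... | q , eq′ = (+ 1 ℚ./ suc n) ℚ.* q , ≈-trans (≈-sym (S.1/suc-cancel n P))
  (≈-trans (*-congˡ (≈-trans (≈-trans (≈-sym (+-identityʳ _)) (+-congˡ (≈-sym (≈-trans (-‿cong eq) S.-0#≈0#)))) eq′)) (≈-sym (con-* _ q)))

eul-∂ : ∀ N P → degree P ℕ.≤ N → eul P ≈ ∑ N λ k → p[1+ k ] * ∂ k P
eul-∂ N (con q)  _ = ≈-sym (S.∑-0 N λ k _ → zeroʳ _)
eul-∂ N p[1+ j ] j<N = ≈-sym (≈-trans (S.∑-cong N λ k _ → ≈-trans (*-congˡ (con-* _ _))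
    (solveΛ 3 (λ p a b → p :* (a :* b) := b :* (a :* p)) ≈-refl p[1+ k ] (con (ℕ→ℚ (suc k))) (con (δ k j))))
  (∑-δ N (λ k → con (ℕ→ℚ (suc k)) * p[1+ k ]) j (ℕ.<⇒≤ j<N)))
eul-∂ N (P + Q)  ≤N = ≈-trans (+-cong (eul-∂ N P (ℕ.m⊔n≤o⇒m≤o _ _ ≤N)) (eul-∂ N Q (ℕ.m⊔n≤o⇒n≤o (degree P) _ ≤N)))
  (≈-sym (≈-trans (S.∑-cong N λ k _ → distribˡ _ _ _) (S.∑-+ N _ _)))
eul-∂ N (P * Q)  ≤N = ≈-trans
  (+-cong (*-congʳ (eul-∂ N P (ℕ.m+n≤o⇒m≤o _ ≤N))) (*-congˡ (eul-∂ N Q (ℕ.m+n≤o⇒n≤o (degree P) ≤N))))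
  (≈-sym (≈-trans (S.∑-cong N λ k _ →
      solveΛ 5 (λ p P Q P′ Q′ → p :* (P′ :* Q :+ P :* Q′) := p :* P′ :* Q :+ P :* (p :* Q′)) ≈-refl p[1+ k ] P Q (∂ k P) (∂ k Q))
    (≈-trans (S.∑-+ N _ _) (+-cong (S.∑-*ʳ N Q _) (S.∑-*ˡ N P _)))))
eul-∂ N (- P)    ≤N = ≈-trans (-‿cong (eul-∂ N P ≤N)) (≈-trans (S.∑-hom N -_ _ neg-+) (S.∑-cong N λ k _ → S.-‿distribʳ-* _ _))

-- A polynomial all of whose derivatives vanish at 0: by induction on the degree every `∂ k P` is 0,
-- hence so is `eul P`, so P is a constant, and its value at 0 is 0.
taylor-0 : ∀ m {n} → n ℕ.≤ m → ∀ {P} → Low n P → (∀ G → ε (D G P) ≡ 0ℚ) → P ≈ con 0ℚ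
taylor-0 zero    z≤n l vanish = low-zero l
taylor-0 (suc m) {n} n≤m {P} l vanish with eul-0-constant n l
  (≈-trans (eul-∂ (degree P) P ℕ.≤-refl) (S.∑-0 (degree P) λ k _ → ≈-trans (*-congˡ
    (taylor-0 m (ℕ.≤-trans (ℕ.∸-monoˡ-≤ (suc k) n≤m) (ℕ.m∸n≤m m k)) (low-∂ k l) (λ G → vanish (G * p[1+ k ])))) (zeroʳ _)))
... | q , eq = ≈-trans eq (reflexive (≡.cong con (≡.trans (≡.sym (≡.trans (ε-cong (*-congˡ {con 1ℚ} eq)) (ℚ.*-identityˡ q))) (vanish (con 1ℚ)))))

-- Nondegeneracy of the form. It serves to identify skewing with `D` and to compute the coefficients
-- of Ω[ZX].
taylor : ∀ {P Q} → (∀ G → ⟪ G , P ⟫ ≡ ⟪ G , Q ⟫) → P ≈ Q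
taylor {P} {Q} eq = ≈-trans (≈-sym (+-identityʳ P)) (≈-trans (+-congˡ (≈-sym (-‿inverseˡ Q)))
  (≈-trans (≈-sym (+-assoc P (- Q) Q)) (≈-trans (+-congʳ
    (taylor-0 _ ℕ.≤-refl (low-degree (P + - Q)) λ G → ≡.trans (ε-cong (≈-trans (D-+ G P (- Q)) (+-congˡ (D-neg G Q))))
      (≡.trans (≡.cong (ℚ._- ⟪ G , Q ⟫) (eq G)) (ℚ.+-inverseʳ ⟪ G , Q ⟫)))) (+-identityˡ Q))))

-- Vertex operators

sg : Sign → ℚ
sg Sign.+ = 1ℚ
sg Sign.- = ℚ.- 1ℚ

±X : Sign → Λ
±X Sign.+ = p[1+ 0 ]
±X Sign.- = - p[1+ 0 ]

ψ-±X : ∀ σ k → Λ-ψ[1+ k ] (±X σ) ≈ con (sg σ) * p[1+ k ]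
ψ-±X Sign.+ k = ≈-trans (reflexive (≡.cong p[1+_] (ℕ.*-identityʳ k))) (≈-sym (*-identityˡ _))
ψ-±X Sign.- k = ≈-trans (-‿cong (reflexive (≡.cong p[1+_] (ℕ.*-identityʳ k)))) (neg-con _)

∂-isDerivation : ∀ k → S.IsDerivation (λ _ → ∂ k)
∂-isDerivation k = record
  { δ-cong = λ _ → ∂-cong k ; δ-+ = λ _ _ _ → ≈-refl ; δ-* = λ _ _ _ _ → ≈-refl
  ; δ-con* = λ _ → ∂-con* k ; δ-1 = ≈-refl ; δ-0 = λ _ → ≈-refl }

order-Ω : ∀ a → (∀ k → Order≥ (suc k) (Λ-ψ[1+ k ] a)) → ∀ d → Order≥ d (ΩΛ a d)
order-Ω = S.Ω-filtered Order≥ order-≈ order-+ order-* order-con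

-- u + m = h_m and u - m = (-1)^m e_m.
abstract
  u : Sign → ℕ → Λ
  u σ = ΩΛ (±X σ)

  u-Ω : ∀ σ d → ΩΛ (±X σ) d ≡ u σ d
  u-Ω σ d = ≡.refl

  u-0 : ∀ σ → u σ 0 ≈ con 1ℚ
  u-0 σ = S.Ω-0 (±X σ)

  u-newton : ∀ σ d → con (ℕ→ℚ (suc d)) * u σ (suc d) ≈ ((λ k → con (sg σ) * p[1+ k ]) ⊛ u σ) d
  u-newton σ d = ≈-trans (S.newton (±X σ) d) (S.⊛-congʳ (ψ-±X σ) d)

  ∂-u : ∀ k σ d → ∂ k (u σ d) ≈ con (sg σ) * shift (suc k) (u σ) d
  ∂-u k σ = S.Ω-single (∂-isDerivation k) k (±X σ)
    (λ j k≢j → ≈-trans (eq j) (≈-trans (*-congˡ (*-congˡ (reflexive (≡.cong con (kron-≢ k≢j)))))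
      (solveΛ 2 (λ a b → a :* (b :* K 0ℚ) := K 0ℚ) ≈-refl _ _)))
    (≈-trans (eq k) (≈-trans (x∙yz≈y∙xz _ _ _) (≈-trans (*-congˡ (≈-trans (*-congˡ (reflexive (≡.cong con (kron-≡ k))))
      (≈-trans (*-congˡ (≈-sym (*-identityʳ _))) (S.1/suc-cancel k (con 1ℚ))))) (*-identityʳ _))))
    where
    eq : ∀ j → ∂ k (con (+ 1 ℚ./ suc j) * Λ-ψ[1+ j ] (±X σ)) ≈ con (+ 1 ℚ./ suc j) * (con (sg σ) * con (kron k j))
    eq j = ≈-trans (∂-con* k _ _) (*-congˡ (≈-trans (∂-cong k (ψ-±X σ j)) (∂-con* k (sg σ) p[1+ j ])))

  order-u : ∀ σ d → Order≥ d (u σ d)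
  order-u σ = order-Ω (±X σ) λ k → order-≈ (≈-sym (ψ-±X σ k)) (order-* {0} (order-con (sg σ)) (order-p k))

ε-u-suc : ∀ σ d → ε (u σ (suc d)) ≡ 0ℚ
ε-u-suc σ d = ≡.trans (≡.sym (⟪⟫-1 (u σ (suc d)))) (ε-cong (order-kills (order-u σ (suc d)) (low-con {0} {1ℚ}) (s≤s z≤n)))

uℤ : Sign → ℤ → Λ
uℤ σ (+ m)    = u σ m
uℤ σ -[1+ _ ] = con 0ℚ

ε-u-⊖ : ∀ σ i j → ε (uℤ σ (i ⊖ j)) ≡ δ i j
ε-u-⊖ σ zero    zero    = ε-cong (u-0 σ)
ε-u-⊖ σ zero    (suc j) = ≡.refl
ε-u-⊖ σ (suc i) zero    = ε-u-suc σ i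
ε-u-⊖ σ (suc i) (suc j) = ≡.trans (≡.cong (ε ∘ uℤ σ) (ℤ.[1+m]⊖[1+n]≡m⊖n i j)) (ε-u-⊖ σ i j)

shift-uℤ : ∀ σ k d → shift k (u σ) d ≈ uℤ σ (d ⊖ k)
shift-uℤ σ zero    d       = ≈-refl
shift-uℤ σ (suc k) zero    = ≈-refl
shift-uℤ σ (suc k) (suc d) = ≈-trans (shift-uℤ σ k d) (reflexive (≡.cong (uℤ σ) (≡.sym (ℤ.[1+m]⊖[1+n]≡m⊖n d k))))

∂-uℤ : ∀ k σ r → ∂ k (uℤ σ r) ≈ con (sg σ) * uℤ σ (r ℤ.- + suc k)
∂-uℤ k σ (+ d)    = ≈-trans (∂-u k σ d) (*-congˡ (shift-uℤ σ (suc k) d))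
∂-uℤ k σ -[1+ d ] = ≈-sym (zeroʳ _)

-- The vertex operators: V Sign.+ r is B_r, and V Sign.- (- r) is its adjoint.
V≤ : ℕ → Sign → ℤ → Λ → Λ
V≤ N σ r Q = ∑ N λ i → uℤ σ (r ℤ.+ + i) * D (u (opposite σ) i) Q

sg-opposite : ∀ σ → con (sg (opposite σ)) ≈ - con (sg σ)
sg-opposite Sign.+ = con-neg 1ℚ
sg-opposite Sign.- = con-neg (ℚ.- 1ℚ)

abstract
  V : Sign → ℤ → Λ → Λ
  V σ r Q = V≤ (degree Q) σ r Q

  -- Summands beyond the degree of Q vanish. This frees the operator from the degree of the
  -- particular term Q: two terms can be compared at a common bound.
  V-V≤ : ∀ {N Q} σ r → degree Q ℕ.≤ N → V σ r Q ≈ V≤ N σ r Q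
  V-V≤ {Q = Q} σ r deg≤N = ≈-sym (S.∑-extend _ deg≤N λ i deg<i →
    ≈-trans (*-congˡ {uℤ σ (r ℤ.+ + i)} (order-kills (order-u (opposite σ) i) (low-degree Q) deg<i)) (zeroʳ _))

V-cong : ∀ σ r {P Q} → P ≈ Q → V σ r P ≈ V σ r Q
V-cong σ r {P} {Q} eq = ≈-trans (V-V≤ σ r (ℕ.m≤m⊔n (degree P) (degree Q)))
  (≈-trans (S.∑-cong (degree P ℕ.⊔ degree Q) λ i _ → *-congˡ {uℤ σ (r ℤ.+ + i)} (D-congʳ (u (opposite σ) i) eq))
    (≈-sym (V-V≤ σ r (ℕ.m≤n⊔m (degree P) (degree Q)))))

V-+ : ∀ σ r P Q → V σ r (P + Q) ≈ V σ r P + V σ r Q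
V-+ σ r P Q = ≈-trans (V-V≤ {Q = P + Q} σ r ℕ.≤-refl) (≈-trans (S.∑-cong (degree P ℕ.⊔ degree Q) λ i _ →
    ≈-trans (*-congˡ {uℤ σ (r ℤ.+ + i)} (D-+ (u (opposite σ) i) P Q)) (distribˡ _ _ _))
  (≈-trans (S.∑-+ (degree P ℕ.⊔ degree Q) _ _)
    (≈-sym (+-cong (V-V≤ σ r (ℕ.m≤m⊔n (degree P) (degree Q))) (V-V≤ σ r (ℕ.m≤n⊔m (degree P) (degree Q)))))))

V-con* : ∀ σ r a Q → V σ r (con a * Q) ≈ con a * V σ r Q
V-con* σ r a Q = ≈-trans (V-V≤ {Q = con a * Q} σ r ℕ.≤-refl) (≈-trans (S.∑-cong (degree Q) λ i _ →
    ≈-trans (*-congˡ {uℤ σ (r ℤ.+ + i)} (D-con* (u (opposite σ) i) a Q)) (x∙yz≈y∙xz _ _ _))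
  (≈-trans (S.∑-*ˡ (degree Q) (con a) _) (*-congˡ (≈-sym (V-V≤ σ r ℕ.≤-refl)))))

V-0 : ∀ σ r → V σ r (con 0ℚ) ≈ con 0ℚ
V-0 σ r = ≈-trans (V-cong σ r (≈-sym (zeroˡ (con 0ℚ)))) (≈-trans (V-con* σ r 0ℚ (con 0ℚ)) (zeroˡ _))

V-neg : ∀ σ r Q → V σ r (- Q) ≈ - V σ r Q
V-neg σ r Q = ≈-trans (V-cong σ r (neg-con Q)) (≈-trans (V-con* σ r (ℚ.- 1ℚ) Q) (≈-sym (neg-con _)))

-- In generating form, V(z) p_{1+k} = (p_{1+k} - sg σ / z^{1+k}) V(z). Together with `V-1` this
-- determines V, so identities between vertex operators reduce to their values at 1.
V-p* : ∀ σ r k Q → V σ r (p[1+ k ] * Q) ≈ p[1+ k ] * V σ r Q + - (con (sg σ) * V σ (r ℤ.+ + suc k) Q)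
V-p* σ r k Q = begin
  V σ r (p[1+ k ] * Q)
    ≈⟨ V-V≤ {Q = p[1+ k ] * Q} σ r ℕ.≤-refl ⟩
  ∑ N (λ i → U i * D (ū i) (p[1+ k ] * Q))
    ≈⟨ S.∑-cong N (λ i _ → step i) ⟩
  ∑ N (λ i → p[1+ k ] * (U i * D (ū i) Q) + con (sg (opposite σ)) * (U i * D (shift (suc k) ū i) Q))
    ≈⟨ S.∑-+ N (λ i → p[1+ k ] * (U i * D (ū i) Q)) (λ i → con (sg (opposite σ)) * (U i * D (shift (suc k) ū i) Q)) ⟩
  ∑ N (λ i → p[1+ k ] * (U i * D (ū i) Q)) + ∑ N (λ i → con (sg (opposite σ)) * (U i * D (shift (suc k) ū i) Q))
    ≈⟨ +-cong (S.∑-*ˡ N p[1+ k ] (λ i → U i * D (ū i) Q)) (S.∑-*ˡ N (con (sg (opposite σ))) (λ i → U i * D (shift (suc k) ū i) Q)) ⟩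
  p[1+ k ] * V≤ N σ r Q + con (sg (opposite σ)) * ∑ N (λ i → U i * D (shift (suc k) ū i) Q)
    ≈⟨ +-cong (*-congˡ (≈-sym (V-V≤ σ r (ℕ.m≤n+m (degree Q) (suc k))))) (*-congˡ (S.∑-delay (con 0ℚ) (suc k) (degree Q) (λ i x → U i * D x Q) ū
         λ i → ≈-trans (*-congˡ (zeroˡ _)) (zeroʳ (U i)))) ⟩
  p[1+ k ] * V σ r Q + con (sg (opposite σ)) * ∑ (degree Q) (λ i → U (suc k ℕ.+ i) * D (ū i) Q)
    ≈⟨ +-congˡ (*-cong (sg-opposite σ) (S.∑-cong (degree Q) λ i _ →
         *-congʳ {D (ū i) Q} (reflexive (≡.cong (uℤ σ) (≡.trans (≡.cong (λ j → r ℤ.+ j) (ℤ.pos-+ (suc k) i)) (≡.sym (ℤ.+-assoc r (+ suc k) (+ i)))))))) ⟩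
  p[1+ k ] * V σ r Q + - con (sg σ) * V≤ (degree Q) σ (r ℤ.+ + suc k) Q
    ≈⟨ +-congˡ (*-congˡ (V-V≤ σ (r ℤ.+ + suc k) ℕ.≤-refl)) ⟨
  p[1+ k ] * V σ r Q + - con (sg σ) * V σ (r ℤ.+ + suc k) Q
    ≈⟨ +-congˡ (S.-‿distribˡ-* _ _) ⟨
  p[1+ k ] * V σ r Q + - (con (sg σ) * V σ (r ℤ.+ + suc k) Q) ∎
  where
  open ≈-Reasoning
  ū = u (opposite σ)
  N = suc k ℕ.+ degree Q
  U : ℕ → Λ
  U i = uℤ σ (r ℤ.+ + i)
  step : ∀ i → U i * D (ū i) (p[1+ k ] * Q) ≈ p[1+ k ] * (U i * D (ū i) Q) + con (sg (opposite σ)) * (U i * D (shift (suc k) ū i) Q)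
  step i = ≈-trans (*-congˡ (≈-trans (D-p* (ū i) k Q) (+-congˡ (D-congˡ (∂-u k (opposite σ) i) Q))))
    (solveΛ 5 (λ U p d s e → U :* (p :* d :+ s :* e) := p :* (U :* d) :+ s :* (U :* e)) ≈-refl _ _ _ _ _)

-- In generating form, ∂_k V(z) = V(z) ∂_k + sg σ z^{1+k} V(z): only the factor Ω[±zX] of V(z)
-- depends on the variable of the derivative.
V-∂ : ∀ σ r k Q → ∂ k (V σ r Q) ≈ V σ r (∂ k Q) + con (sg σ) * V σ (r ℤ.- + suc k) Q
V-∂ σ r k Q = begin
  ∂ k (V σ r Q)
    ≈⟨ ∂-cong k (V-V≤ σ r (ℕ.m≤m⊔n (degree Q) (degree (∂ k Q)))) ⟩
  ∂ k (V≤ N σ r Q)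
    ≈⟨ S.∑-hom N (∂ k) (λ i → U r i * D (ū i) Q) (λ _ _ → ≈-refl) ⟩
  ∑ N (λ i → ∂ k (U r i) * D (ū i) Q + U r i * ∂ k (D (ū i) Q))
    ≈⟨ S.∑-cong N (λ i _ → ≈-trans (+-comm _ _) (+-cong (*-congˡ (≈-sym (D-∂-comm (ū i) k Q)))
         (≈-trans (*-congʳ (≈-trans (∂-uℤ k σ (r ℤ.+ + i)) (*-congˡ (reflexive (≡.cong (uℤ σ) (eq r (+ i) (+ suc k))))))) (*-assoc _ _ _)))) ⟩
  ∑ N (λ i → U r i * D (ū i) (∂ k Q) + con (sg σ) * (U (r ℤ.- + suc k) i * D (ū i) Q))
    ≈⟨ S.∑-+ N _ _ ⟩
  V≤ N σ r (∂ k Q) + ∑ N (λ i → con (sg σ) * (U (r ℤ.- + suc k) i * D (ū i) Q))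
    ≈⟨ +-cong (≈-sym (V-V≤ σ r (ℕ.m≤n⊔m (degree Q) (degree (∂ k Q))))) (≈-trans (S.∑-*ˡ N (con (sg σ)) _)
         (*-congˡ (≈-sym (V-V≤ σ (r ℤ.- + suc k) (ℕ.m≤m⊔n (degree Q) (degree (∂ k Q))))))) ⟩
  V σ r (∂ k Q) + con (sg σ) * V σ (r ℤ.- + suc k) Q ∎
  where
  open ≈-Reasoning
  ū = u (opposite σ)
  N = degree Q ℕ.⊔ degree (∂ k Q)
  U : ℤ → ℕ → Λ
  U r i = uℤ σ (r ℤ.+ + i)
  eq : ∀ r i k → (r ℤ.+ i) ℤ.- k ≡ (r ℤ.- k) ℤ.+ i
  eq = solve-∀

V-1 : ∀ σ r → V σ r (con 1ℚ) ≈ uℤ σ r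
V-1 σ r = ≈-trans (V-V≤ {0} σ r ℕ.≤-refl) (≈-trans (*-cong (reflexive (≡.cong (uℤ σ) (ℤ.+-identityʳ r)))
  (≈-trans (D-congˡ (u-0 (opposite σ)) (con 1ℚ)) (*-identityˡ _))) (*-identityʳ _))

-- The factor u_{r+i} has a nonzero constant term only for r + i = 0, so a single summand survives.
V-ε : ∀ σ r Q → ε (V σ r Q) ≡ ⟪ uℤ (opposite σ) (ℤ.- r) , Q ⟫
V-ε σ r Q = ε-cong {con (ε (V σ r Q))} (begin
  con (ε (V σ r Q))
    ≡⟨ ≡.cong con (ε-cong (V-V≤ σ r (ℕ.m≤m⊔n (degree Q) ℤ.∣ r ∣))) ⟩
  con (ε (V≤ N σ r Q))
    ≈⟨ S.∑-hom N (con ∘ ε) _ (λ x y → con-+ (ε x) (ε y)) ⟩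
  ∑ N (λ i → con (ε (uℤ σ (r ℤ.+ + i)) ℚ.* ⟪ ū i , Q ⟫))
    ≈⟨ S.∑-cong N (λ i _ → con-* (ε (uℤ σ (r ℤ.+ + i))) ⟪ ū i , Q ⟫) ⟩
  ∑ N (λ i → con (ε (uℤ σ (r ℤ.+ + i))) * con ⟪ ū i , Q ⟫)
    ≈⟨ eval r (ℕ.m≤n⊔m (degree Q) ℤ.∣ r ∣) ⟩
  con ⟪ uℤ (opposite σ) (ℤ.- r) , Q ⟫ ∎)
  where
  open ≈-Reasoning
  ū = u (opposite σ)
  -- Including the absolute value of r keeps the surviving index i = -r within the bound.
  N = degree Q ℕ.⊔ ℤ.∣ r ∣
  eval : ∀ r → ℤ.∣ r ∣ ℕ.≤ N → ∑ N (λ i → con (ε (uℤ σ (r ℤ.+ + i))) * con ⟪ ū i , Q ⟫) ≈ con ⟪ uℤ (opposite σ) (ℤ.- r) , Q ⟫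
  eval (+ zero)  ∣r∣≤N = ≈-trans (S.∑-cong N λ i _ → *-congʳ {con ⟪ ū i , Q ⟫} (reflexive (≡.cong con (ε-u-⊖ σ i 0)))) (∑-δ N (λ i → con ⟪ ū i , Q ⟫) 0 ∣r∣≤N)
  eval (+ suc m) ∣r∣≤N = ≈-trans (S.∑-0 N λ i _ → ≈-trans (*-congʳ (reflexive (≡.cong con (ε-u-suc σ (m ℕ.+ i))))) (zeroˡ _))
    (reflexive (≡.cong con (≡.sym (ℚ.*-zeroˡ (ε Q)))))
  eval -[1+ m ]  ∣r∣≤N = ≈-trans (S.∑-cong N λ i _ → *-congʳ {con ⟪ ū i , Q ⟫} (reflexive (≡.cong con (ε-u-⊖ σ i (suc m))))) (∑-δ N (λ i → con ⟪ ū i , Q ⟫) (suc m) ∣r∣≤N)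

-- Fermionic relations

sg² : ∀ σ → con (sg σ) * con (sg σ) ≈ con 1ℚ
sg² Sign.+ = *-identityˡ _
sg² Sign.- = ≈-sym (con-* (ℚ.- 1ℚ) (ℚ.- 1ℚ))

opposite² : ∀ σ → opposite (opposite σ) ≡ σ
opposite² Sign.+ = ≡.refl
opposite² Sign.- = ≡.refl

D-∑ : ∀ N (a : ℕ → Λ) Q → D (∑ N a) Q ≈ ∑ N λ i → D (a i) Q
D-∑ N a Q = S.∑-hom N (λ P → D P Q) a λ _ _ → ≈-refl

D-⊛ : ∀ (a b : Seq) d Q → D ((a ⊛ b) d) Q ≈ ∑ d λ i → D (a i) (D (b (d ℕ.∸ i)) Q)
D-⊛ a b d Q = ≈-trans (D-congˡ (S.⊛-∑ a b d) Q) (D-∑ d (λ i → a i * b (d ℕ.∸ i)) Q)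

-- The x d are the coefficients of (1 - t)^(- sg σ sg τ), and the second hypothesis is Newton's
-- recursion for that series. Equal signs give 1 / (1 - t), opposite signs give 1 - t.
D-u-uℤ : ∀ σ τ (x : ℕ → ℚ) → x 0 ≡ 1ℚ →
  (∀ d → con (ℕ→ℚ (suc d)) * con (x (suc d)) ≈ con (sg σ) * con (sg τ) * ∑ d (con ∘ x)) →
  ∀ d r → D (u σ d) (uℤ τ r) ≈ con (x d) * uℤ τ (r ℤ.- + d)
D-u-uℤ σ τ x x₀ xₛ = <-rec _ λ
  { zero    rec r → ≈-trans (D-congˡ (u-0 σ) _) (*-cong (reflexive (≡.cong con (≡.sym x₀))) (reflexive (≡.cong (uℤ τ) (≡.sym (ℤ.+-identityʳ r)))))
  ; (suc d) rec r → S.scale-cancel d (step d r λ i i≤d → rec (s≤s i≤d)) }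
  where
  open ≈-Reasoning
  ℤ-eq : ∀ r a b → (r ℤ.- a) ℤ.- b ≡ r ℤ.- (a ℤ.+ b)
  ℤ-eq = solve-∀
  index : ∀ r {d i} → i ℕ.≤ d → (r ℤ.- + suc (d ℕ.∸ i)) ℤ.- + i ≡ r ℤ.- + suc d
  index r {d} {i} i≤d = ≡.trans (ℤ-eq r (+ suc (d ℕ.∸ i)) (+ i)) (≡.cong (λ j → r ℤ.- + suc j) (ℕ.m∸n+n≡m i≤d))
  sp : ℕ → Λ
  sp k = con (sg σ) * p[1+ k ]
  step : ∀ d r → (∀ i → i ℕ.≤ d → ∀ r → D (u σ i) (uℤ τ r) ≈ con (x i) * uℤ τ (r ℤ.- + i)) →
    con (ℕ→ℚ (suc d)) * D (u σ (suc d)) (uℤ τ r) ≈ con (ℕ→ℚ (suc d)) * (con (x (suc d)) * uℤ τ (r ℤ.- + suc d))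
  step d r rec = begin
    D (con (ℕ→ℚ (suc d)) * u σ (suc d)) (uℤ τ r)
      ≈⟨ D-congˡ (≈-trans (u-newton σ d) (S.⊛-comm sp (u σ) d)) (uℤ τ r) ⟩
    D ((u σ ⊛ sp) d) (uℤ τ r)
      ≈⟨ D-⊛ (u σ) sp d (uℤ τ r) ⟩
    ∑ d (λ i → D (u σ i) (con (sg σ) * ∂ (d ℕ.∸ i) (uℤ τ r)))
      ≈⟨ S.∑-cong d (λ i i≤d → ≈-trans (D-congʳ (u σ i) (≈-trans (*-congˡ {con (sg σ)} (∂-uℤ (d ℕ.∸ i) τ r)) (≈-sym (*-assoc _ _ _))))
           (≈-trans (≈-trans (D-congʳ (u σ i) (*-congʳ (≈-sym (con-* _ _)))) (D-con* (u σ i) (sg σ ℚ.* sg τ) (uℤ τ (r ℤ.- + suc (d ℕ.∸ i)))))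
             (≈-trans (*-cong (con-* (sg σ) (sg τ)) (≈-trans (rec i i≤d (r ℤ.- + suc (d ℕ.∸ i))) (*-congˡ {con (x i)} (reflexive (≡.cong (uℤ τ) (index r i≤d))))))
               (≈-sym (*-assoc _ _ _))))) ⟩
    ∑ d (λ i → con (sg σ) * con (sg τ) * con (x i) * uℤ τ (r ℤ.- + suc d))
      ≈⟨ S.∑-*ʳ d (uℤ τ (r ℤ.- + suc d)) (λ i → con (sg σ) * con (sg τ) * con (x i)) ⟩
    ∑ d (λ i → con (sg σ) * con (sg τ) * con (x i)) * uℤ τ (r ℤ.- + suc d)
      ≈⟨ *-congʳ (≈-trans (S.∑-*ˡ d (con (sg σ) * con (sg τ)) (con ∘ x)) (≈-sym (xₛ d))) ⟩
    con (ℕ→ℚ (suc d)) * con (x (suc d)) * uℤ τ (r ℤ.- + suc d)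
      ≈⟨ *-assoc _ _ _ ⟩
    con (ℕ→ℚ (suc d)) * (con (x (suc d)) * uℤ τ (r ℤ.- + suc d)) ∎

D-u-same : ∀ σ d r → D (u σ d) (uℤ σ r) ≈ uℤ σ (r ℤ.- + d)
D-u-same σ d r = ≈-trans (D-u-uℤ σ σ (const 1ℚ) ≡.refl
  (λ d → ≈-trans (*-identityʳ _) (≈-sym (≈-trans (*-congʳ (sg² σ)) (≈-trans (*-identityˡ _) (count d))))) d r) (*-identityˡ _)
  where
  count : ∀ d → ∑ d (λ _ → con 1ℚ) ≈ con (ℕ→ℚ (suc d))
  count zero    = reflexive (≡.cong con (≡.sym ℕ→ℚ-1))
  count (suc d) = ≈-trans (+-congˡ (count d)) (≈-trans (≈-sym (con-+ _ _)) (reflexive (≡.cong con (≡.sym (ℕ→ℚ-suc (suc d))))))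

1-t : ℕ → ℚ
1-t zero          = 1ℚ
1-t (suc zero)    = ℚ.- 1ℚ
1-t (suc (suc _)) = 0ℚ

D-u-opposite : ∀ σ d r → D (u (opposite σ) d) (uℤ σ r) ≈ con (1-t d) * uℤ σ (r ℤ.- + d)
D-u-opposite σ = D-u-uℤ (opposite σ) σ 1-t ≡.refl λ
  { zero    → ≈-trans (*-congʳ (reflexive (≡.cong con ℕ→ℚ-1))) (≈-trans (≈-sym (con-* 1ℚ (ℚ.- 1ℚ))) (≈-sym (≈-trans (*-identityʳ _)
      (≈-trans (*-congʳ (sg-opposite σ)) (≈-trans (≈-sym (S.-‿distribˡ-* _ _)) (≈-trans (-‿cong (sg² σ)) (≈-sym (con-neg 1ℚ))))))))
  ; (suc d) → ≈-trans (zeroʳ _) (≈-sym (≈-trans (*-congˡ (vanish d)) (zeroʳ _))) }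
  where
  vanish : ∀ d → ∑ (suc d) (con ∘ 1-t) ≈ con 0ℚ
  vanish zero    = ≈-sym (con-+ 1ℚ (ℚ.- 1ℚ))
  vanish (suc d) = ≈-trans (+-congˡ (≈-trans (+-congˡ (S.∑-0 d λ i _ → ≈-refl)) (+-identityʳ _))) (≈-sym (con-+ 1ℚ (ℚ.- 1ℚ)))

D-u0 : ∀ σ Q → D (u σ 0) Q ≈ Q
D-u0 σ Q = ≈-trans (D-congˡ (u-0 σ) Q) (*-identityˡ Q)

-- In generating form, V(z) u(w) = (1 - w/z) u(w) u(z).
V-u-same : ∀ σ r c → V σ r (uℤ σ c) ≈ uℤ σ c * uℤ σ r + - (uℤ σ (c ℤ.- + 1) * uℤ σ (r ℤ.+ + 1))
V-u-same σ r c = ≈-trans (V-V≤ σ r (ℕ.n≤1+n N)) (+-cong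
  (≈-trans (*-cong (reflexive (≡.cong (uℤ σ) (ℤ.+-identityʳ r))) (D-u0 (opposite σ) (uℤ σ c))) (*-comm _ _))
  (≈-trans (S.∑-extend {0} {N} _ z≤n λ { (suc i) _ → ≈-trans (*-congˡ (≈-trans (D-u-opposite σ (suc (suc i)) c) (zeroˡ _))) (zeroʳ _) })
    (≈-trans (*-congˡ (≈-trans (D-u-opposite σ 1 c) (≈-sym (neg-con _)))) (≈-trans (*-comm _ _) (≈-sym (S.-‿distribˡ-* _ _))))))
  where N = degree (uℤ σ c)

-- For opposite signs the factor 1 - w/z stands in the denominator; clearing it leaves this
-- recursion in place of a closed formula.
V-u-opposite : ∀ σ r c → V σ r (uℤ (opposite σ) c) ≈ uℤ σ r * uℤ (opposite σ) c + V σ (r ℤ.+ + 1) (uℤ (opposite σ) (c ℤ.- + 1))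
V-u-opposite σ r c = ≈-trans (V-V≤ σ r (ℕ.m≤n⇒m≤1+n (ℕ.m≤m⊔n (degree (w c)) (degree (w (c ℤ.- + 1))))))
  (+-cong (*-cong (reflexive (≡.cong (uℤ σ) (ℤ.+-identityʳ r))) (D-u0 (opposite σ) (w c)))
    (≈-trans (S.∑-cong N λ i _ → *-cong (reflexive (≡.cong (uℤ σ) (≡.sym (ℤ.+-assoc r (+ 1) (+ i)))))
        (≈-trans (D-u-same (opposite σ) (suc i) c) (≈-trans (reflexive (≡.cong w (ℤ-eq c (+ i)))) (≈-sym (D-u-same (opposite σ) i (c ℤ.- + 1))))))
      (≈-sym (V-V≤ σ (r ℤ.+ + 1) (ℕ.m≤n⊔m (degree (w c)) (degree (w (c ℤ.- + 1))))))))
  where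
  w = uℤ (opposite σ)
  N = degree (w c) ℕ.⊔ degree (w (c ℤ.- + 1))
  ℤ-eq : ∀ c i → c ℤ.- (+ 1 ℤ.+ i) ≡ (c ℤ.- + 1) ℤ.- i
  ℤ-eq = solve-∀

ℤ-swap : ∀ r a b → (r ℤ.+ a) ℤ.+ b ≡ (r ℤ.+ b) ℤ.+ a
ℤ-swap = solve-∀

V-≡ : ∀ σ {r r′} Q → r ≡ r′ → V σ r Q ≈ V σ r′ Q
V-≡ σ Q eq = reflexive (≡.cong (λ r → V σ r Q) eq)

V-p*-V : ∀ σ τ r t k Q → V σ r (V τ t (p[1+ k ] * Q)) ≈
  p[1+ k ] * V σ r (V τ t Q) + - (con (sg σ) * V σ (r ℤ.+ + suc k) (V τ t Q)) + - (con (sg τ) * V σ r (V τ (t ℤ.+ + suc k) Q))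
V-p*-V σ τ r t k Q = ≈-trans (V-cong σ r (V-p* τ t k Q)) (≈-trans (V-+ σ r _ _) (+-cong (V-p* σ r k (V τ t Q))
  (≈-trans (V-neg σ r _) (-‿cong (V-con* σ r (sg τ) _)))))

-- Moving V(z) past multiplication by u(w) costs the factor 1 - w/z. At Q = 1 this is `V-u-same`,
-- and both sides obey the same rule for p_{1+k}. It underlies the Jacobi-Trudi formula, the
-- spanning argument and the product R(Z).
V-u* : ∀ σ r c Q → V σ r (uℤ σ c * Q) ≈ uℤ σ c * V σ r Q + - (uℤ σ (c ℤ.- + 1) * V σ (r ℤ.+ + 1) Q)
V-u* σ r c Q = Λ-ind (λ Q → ∀ r → V σ r (w c * Q) ≈ w c * V σ r Q + - (w (c ℤ.- + 1) * V σ (r ℤ.+ + 1) Q))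
  (λ eq IH r → ≈-trans (V-cong σ r (*-congˡ (≈-sym eq))) (≈-trans (IH r) (+-cong (*-congˡ (V-cong σ r eq)) (-‿cong (*-congˡ (V-cong σ _ eq))))))
  (λ {P} {Q} IH IH′ r → ≈-trans (V-cong σ r (distribˡ _ P Q)) (≈-trans (V-+ σ r _ _) (≈-trans (+-cong (IH r) (IH′ r))
    (≈-trans (solveΛ 6 (λ a b p q p′ q′ → (a :* p :+ :- (b :* p′)) :+ (a :* q :+ :- (b :* q′)) := a :* (p :+ q) :+ :- (b :* (p′ :+ q′))) ≈-refl (w c) (w (c ℤ.- + 1)) _ _ _ _)
      (+-cong (*-congˡ (≈-sym (V-+ σ r P Q))) (-‿cong (*-congˡ (≈-sym (V-+ σ (r ℤ.+ + 1) P Q)))))))))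
  (λ q {P} IH r → ≈-trans (V-cong σ r (x∙yz≈y∙xz _ _ _)) (≈-trans (V-con* σ r q _) (≈-trans (*-congˡ (IH r))
    (≈-trans (solveΛ 5 (λ q a b p p′ → q :* (a :* p :+ :- (b :* p′)) := a :* (q :* p) :+ :- (b :* (q :* p′))) ≈-refl (con q) (w c) (w (c ℤ.- + 1)) _ _)
      (+-cong (*-congˡ (≈-sym (V-con* σ r q P))) (-‿cong (*-congˡ (≈-sym (V-con* σ (r ℤ.+ + 1) q P)))))))))
  (λ k {P} IH r → ≈-trans (V-cong σ r (x∙yz≈y∙xz _ _ _)) (≈-trans (V-p* σ r k _) (≈-trans (+-cong (*-congˡ (IH r)) (-‿cong (*-congˡ (IH (r ℤ.+ + suc k)))))
    (≈-trans (+-congˡ (-‿cong (*-congˡ (+-congˡ (-‿cong (*-congˡ (V-≡ σ P (ℤ-swap r (+ suc k) (+ 1)))))))))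
    (≈-trans (solveΛ 8 (λ p s a b x y z t → p :* (a :* x :+ :- (b :* y)) :+ :- (s :* (a :* z :+ :- (b :* t))) :=
        a :* (p :* x :+ :- (s :* z)) :+ :- (b :* (p :* y :+ :- (s :* t)))) ≈-refl p[1+ k ] (con (sg σ)) (w c) (w (c ℤ.- + 1)) _ _ _ _)
      (+-cong (*-congˡ (≈-sym (V-p* σ r k P))) (-‿cong (*-congˡ (≈-sym (V-p* σ (r ℤ.+ + 1) k P))))))))))
  (λ r → ≈-trans (V-cong σ r (*-identityʳ _)) (≈-trans (V-u-same σ r c) (+-cong (*-congˡ (≈-sym (V-1 σ r))) (-‿cong (*-congˡ (≈-sym (V-1 σ (r ℤ.+ + 1))))))))
  Q r
  where w = uℤ σ

-- By `V-u-same`, z V(z) V(w) 1 = (z - w) u(z) u(w), which is antisymmetric in z and w; the rule for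
-- p_{1+k} carries this to every Q.
V-anticomm : ∀ σ r t Q → V σ r (V σ t Q) + V σ (t ℤ.- + 1) (V σ (r ℤ.+ + 1) Q) ≈ con 0ℚ
V-anticomm σ r t Q = Λ-ind (λ Q → ∀ r t → C r t Q ≈ con 0ℚ)
  (λ eq IH r t → ≈-trans (+-cong (V-cong σ _ (V-cong σ _ (≈-sym eq))) (V-cong σ _ (V-cong σ _ (≈-sym eq)))) (IH r t))
  (λ {P} {Q} IH IH′ r t → ≈-trans (+-cong (VV-+ r t P Q) (VV-+ _ _ P Q)) (≈-trans (interchange _ _ _ _) (≈-trans (+-cong (IH r t) (IH′ r t)) (+-identityˡ _))))
  (λ q {P} IH r t → ≈-trans (+-cong (VV-con* r t q P) (VV-con* _ _ q P)) (≈-trans (≈-sym (distribˡ _ _ _)) (≈-trans (*-congˡ (IH r t)) (zeroʳ _))))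
  (λ k {P} IH r t → ≈-trans (+-cong (V-p*-V σ σ r t k P) (V-p*-V σ σ (t ℤ.- + 1) (r ℤ.+ + 1) k P))
    (≈-trans (solveΛ 8 (λ p s a b c a′ b′ c′ → p :* a :+ :- (s :* b) :+ :- (s :* c) :+ (p :* a′ :+ :- (s :* c′) :+ :- (s :* b′)) :=
       p :* (a :+ a′) :+ :- (s :* (b :+ b′)) :+ :- (s :* (c :+ c′))) ≈-refl p[1+ k ] (con (sg σ)) _ _ _ _ _ _)
    (≈-trans (+-cong (+-cong (*-congˡ (IH r t)) (-‿cong (*-congˡ (≈-trans (+-congˡ (V-cong σ _ (V-≡ σ P (ℤ-swap r (+ 1) (+ suc k))))) (IH (r ℤ.+ + suc k) t)))))
        (-‿cong (*-congˡ (≈-trans (+-congˡ (V-≡ σ _ (ℤ-swap t (ℤ.- + 1) (+ suc k)))) (IH r (t ℤ.+ + suc k))))))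
      (solveΛ 2 (λ p s → p :* K 0ℚ :+ :- (s :* K 0ℚ) :+ :- (s :* K 0ℚ) := K 0ℚ) ≈-refl _ _))))
  (λ r t → ≈-trans (+-cong (≈-trans (V-cong σ r (V-1 σ t)) (V-u-same σ r t))
      (≈-trans (V-cong σ _ (V-1 σ _)) (≈-trans (V-u-same σ (t ℤ.- + 1) (r ℤ.+ + 1))
        (+-congˡ (-‿cong (*-cong (reflexive (≡.cong (uℤ σ) (ℤ-cancel r))) (reflexive (≡.cong (uℤ σ) (ℤ-cancel′ t)))))))))
    (solveΛ 4 (λ t r t′ r′ → (t :* r :+ :- (t′ :* r′)) :+ (r′ :* t′ :+ :- (r :* t)) := K 0ℚ) ≈-refl _ _ _ _))
  Q r t
  where
  C : ℤ → ℤ → Λ → Λ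
  C r t Q = V σ r (V σ t Q) + V σ (t ℤ.- + 1) (V σ (r ℤ.+ + 1) Q)
  VV-+ : ∀ r t P Q → V σ r (V σ t (P + Q)) ≈ V σ r (V σ t P) + V σ r (V σ t Q)
  VV-+ r t P Q = ≈-trans (V-cong σ r (V-+ σ t P Q)) (V-+ σ r _ _)
  VV-con* : ∀ r t q P → V σ r (V σ t (con q * P)) ≈ con q * V σ r (V σ t P)
  VV-con* r t q P = ≈-trans (V-cong σ r (V-con* σ t q P)) (V-con* σ r q _)
  ℤ-cancel : ∀ r → (r ℤ.+ + 1) ℤ.- + 1 ≡ r
  ℤ-cancel = solve-∀
  ℤ-cancel′ : ∀ r → (r ℤ.- + 1) ℤ.+ + 1 ≡ r
  ℤ-cancel′ = solve-∀

δℤ : ℤ → ℚ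
δℤ (+ zero)  = 1ℚ
δℤ (+ suc _) = 0ℚ
δℤ -[1+ _ ]  = 0ℚ

-- The logarithmic derivatives of the two series cancel, so t d/dt annihilates their product and
-- only the constant term remains.
u⊛u : ∀ σ → (u σ ⊛ u (opposite σ)) ≋ S.1⊛
u⊛u σ zero    = ≈-trans (*-cong (u-0 σ) (u-0 (opposite σ))) (*-identityˡ _)
u⊛u σ (suc d) = S.scale-cancel d (≈-trans (S.⊛-leibniz E E E (λ d → distribˡ _) (S.IsDerivation.δ-* S.euler) (u σ) ū (suc d)) (≈-trans (+-cong
    (≈-trans (+-congʳ (E0 _ _)) (≈-trans (+-identityˡ _) (≈-trans (S.⊛-congʳ (u-newton σ) d) (S.⊛-assoc (sp σ) (u σ) ū d))))
    (≈-trans (S.⊛-sucʳ (u σ) (λ i → E i (ū i)) d) (≈-trans (+-congʳ (≈-trans (*-comm _ _) (E0 _ _))) (≈-trans (+-identityˡ _)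
      (≈-trans (S.⊛-congˡ (u-newton (opposite σ)) d) (S.⊛-exchange (u σ) (sp (opposite σ)) ū d))))))
  (≈-trans (≈-sym (S.⊛-distribʳ (u σ ⊛ ū) (sp σ) (sp (opposite σ)) d)) (≈-trans (S.⊛-0ˡ d λ k _ →
      ≈-trans (+-congˡ (≈-trans (*-congʳ (sg-opposite σ)) (≈-sym (S.-‿distribˡ-* _ _)))) (-‿inverseʳ _)) (≈-sym (zeroʳ _))))))
  where
  ū = u (opposite σ)
  E : ℕ → Λ → Λ
  E d Q = con (ℕ→ℚ d) * Q
  E0 : ∀ P Q → E 0 P * Q ≈ con 0ℚ
  E0 P Q = ≈-trans (*-congʳ (≈-trans (*-congʳ (reflexive (≡.cong con ℕ→ℚ-0))) (zeroˡ P))) (zeroˡ Q)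
  sp : Sign → ℕ → Λ
  sp σ k = con (sg σ) * p[1+ k ]

module _ (σ : Sign) where
  private
    σ̄ = opposite σ

    w w̄ : ℤ → Λ
    w = uℤ σ
    w̄ = uℤ σ̄

    -- The value at Q = 1 of the anticommutator in `V-adjoint-relation`.
    b : ℤ → ℤ → Λ
    b r t = V σ̄ r (w t) + V σ (t ℤ.+ + 1) (w̄ (r ℤ.- + 1))

    V-w : ∀ r t → V σ̄ r (w t) ≈ w̄ r * w t + V σ̄ (r ℤ.+ + 1) (w (t ℤ.- + 1))
    V-w r t = ≡.subst (λ τ → V σ̄ r (uℤ τ t) ≈ w̄ r * uℤ τ t + V σ̄ (r ℤ.+ + 1) (uℤ τ (t ℤ.- + 1))) (opposite² σ) (V-u-opposite σ̄ r t)

    ℤ-cancel : ∀ r → (r ℤ.+ + 1) ℤ.- + 1 ≡ r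
    ℤ-cancel = solve-∀

    ℤ-cancel′ : ∀ r → (r ℤ.- + 1) ℤ.+ + 1 ≡ r
    ℤ-cancel′ = solve-∀

    -- By `V-u-opposite`, a shift moves one and the same product from the first summand to the
    -- second. Hence b depends on r + t alone.
    b-step : ∀ r t → b r t ≈ b (r ℤ.+ + 1) (t ℤ.- + 1)
    b-step r t = ≈-trans (+-congʳ (V-w r t)) (≈-trans
      (solveΛ 3 (λ a b c → (a :+ b) :+ c := b :+ (a :+ c)) ≈-refl _ _ _) (+-congˡ (≈-sym
        (≈-trans (V-cong σ _ (reflexive (≡.cong w̄ (ℤ-cancel r)))) (≈-trans (V-≡ σ (w̄ r) (ℤ-cancel′ t)) (≈-trans (V-u-opposite σ t r) (+-congʳ (*-comm _ _))))))))

    b-cong : ∀ {r r′ t t′} → r ≡ r′ → t ≡ t′ → b r t ≈ b r′ t′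
    b-cong ≡.refl ≡.refl = ≈-refl

    V-0-w̄ : ∀ N → V σ (+ 0) (w̄ N) ≈ con (δℤ N)
    V-0-w̄ (+ n) = begin
      V σ (+ 0) (w̄ (+ n))
        ≈⟨ V-V≤ σ (+ 0) (ℕ.m≤m⊔n (degree (w̄ (+ n))) n) ⟩
      ∑ M (λ i → u σ i * D (u σ̄ i) (w̄ (+ n)))
        ≈⟨ S.∑-cong M (λ i _ → *-congˡ {u σ i} (D-u-same σ̄ i (+ n))) ⟩
      ∑ M (λ i → u σ i * w̄ (+ n ℤ.- + i))
        ≈⟨ S.∑-extend (λ i → u σ i * w̄ (+ n ℤ.- + i)) (ℕ.m≤n⊔m (degree (w̄ (+ n))) n) (λ i n<i → ≈-trans (*-congˡ (reflexive (negative n<i))) (zeroʳ _)) ⟩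
      ∑ n (λ i → u σ i * w̄ (+ n ℤ.- + i))
        ≈⟨ S.∑-cong n (λ i i≤n → *-congˡ {u σ i} (reflexive (≡.cong w̄ (≡.trans (ℤ.m-n≡m⊖n n i) (ℤ.⊖-≥ i≤n))))) ⟩
      ∑ n (λ i → u σ i * u σ̄ (n ℕ.∸ i))
        ≈⟨ S.⊛-∑ (u σ) (u σ̄) n ⟨
      (u σ ⊛ u σ̄) n
        ≈⟨ u⊛u σ n ⟩
      S.1⊛ n
        ≈⟨ δ-1⊛ n ⟩
      con (δℤ (+ n)) ∎
      where
      open ≈-Reasoning
      M = degree (w̄ (+ n)) ℕ.⊔ n
      negative : ∀ {i} → n ℕ.< i → w̄ (+ n ℤ.- + i) ≡ con 0ℚ
      negative {i} n<i with i ℕ.∸ n | ℕ.m<n⇒0<n∸m n<i | ≡.trans (ℤ.m-n≡m⊖n n i) (ℤ.⊖-< n<i)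
      ... | suc m | _ | eq = ≡.cong w̄ eq
      δ-1⊛ : ∀ n → S.1⊛ n ≈ con (δℤ (+ n))
      δ-1⊛ zero    = ≈-refl
      δ-1⊛ (suc n) = ≈-refl
    V-0-w̄ -[1+ n ] = V-0 σ (+ 0)

    -- At t = -1 the first summand is 0, the index being negative, and the second is a coefficient
    -- of the product in `u⊛u`.
    b-final : ∀ r → b r (ℤ.- + 1) ≈ con (δℤ (r ℤ.- + 1))
    b-final r = ≈-trans (+-cong (V-0 σ̄ r) (V-0-w̄ (r ℤ.- + 1))) (+-identityˡ _)

    ℤ-up : ∀ r n → (r ℤ.+ + 1) ℤ.+ n ≡ r ℤ.+ (+ 1 ℤ.+ n)
    ℤ-up = solve-∀

    b-pos : ∀ n r → b r (+ n) ≈ con (δℤ (r ℤ.+ + n))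
    b-pos zero    r = ≈-trans (b-step r (+ 0)) (≈-trans (b-final (r ℤ.+ + 1)) (reflexive (≡.cong (con ∘ δℤ) (≡.trans (ℤ-cancel r) (≡.sym (ℤ.+-identityʳ r))))))
    b-pos (suc n) r = ≈-trans (b-step r (+ suc n)) (≈-trans (b-pos n (r ℤ.+ + 1)) (reflexive (≡.cong (con ∘ δℤ) (ℤ-up r (+ n)))))

    ℤ-down : ∀ r n → (r ℤ.- + 1) ℤ.- n ≡ r ℤ.- (+ 1 ℤ.+ n)
    ℤ-down = solve-∀

    b-neg : ∀ n r → b r -[1+ n ] ≈ con (δℤ (r ℤ.- + suc n))
    b-neg zero    r = b-final r
    b-neg (suc n) r = ≈-trans (b-cong (≡.sym (ℤ-cancel′ r)) (≡.cong (λ m → -[1+ suc m ]) (≡.sym (ℕ.+-identityʳ n))))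
      (≈-trans (≈-sym (b-step (r ℤ.- + 1) -[1+ n ])) (≈-trans (b-neg n (r ℤ.- + 1)) (reflexive (≡.cong (con ∘ δℤ) (ℤ-down r (+ suc n))))))

    b-δ : ∀ r t → b r t ≈ con (δℤ (r ℤ.+ t))
    b-δ r (+ n)    = b-pos n r
    b-δ r -[1+ n ] = b-neg n r

  -- At Q = 1 this is `b-δ`. Multiplying Q by p_{1+k} shifts r or t, and both shifts give the same
  -- value of `δℤ`, with opposite signs because the two operators have opposite signs.
  V-adjoint-relation : ∀ r t Q → V σ̄ r (V σ t Q) + V σ (t ℤ.+ + 1) (V σ̄ (r ℤ.- + 1) Q) ≈ con (δℤ (r ℤ.+ t)) * Q
  V-adjoint-relation r t Q = Λ-ind (λ Q → ∀ r t → C r t Q ≈ con (δℤ (r ℤ.+ t)) * Q)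
    (λ eq IH r t → ≈-trans (+-cong (V-cong σ̄ _ (V-cong σ _ (≈-sym eq))) (V-cong σ _ (V-cong σ̄ _ (≈-sym eq)))) (≈-trans (IH r t) (*-congˡ eq)))
    (λ {P} {Q} IH IH′ r t → ≈-trans (+-cong (≈-trans (V-cong σ̄ r (V-+ σ t P Q)) (V-+ σ̄ r _ _)) (≈-trans (V-cong σ _ (V-+ σ̄ _ P Q)) (V-+ σ _ _ _)))
      (≈-trans (interchange _ _ _ _) (≈-trans (+-cong (IH r t) (IH′ r t)) (≈-sym (distribˡ _ _ _)))))
    (λ q {P} IH r t → ≈-trans (+-cong (≈-trans (V-cong σ̄ r (V-con* σ t q P)) (V-con* σ̄ r q _)) (≈-trans (V-cong σ _ (V-con* σ̄ _ q P)) (V-con* σ _ q _)))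
      (≈-trans (≈-sym (distribˡ _ _ _)) (≈-trans (*-congˡ (IH r t)) (x∙yz≈y∙xz _ _ _))))
    (λ k {P} IH r t → ≈-trans (+-cong (V-p*-V σ̄ σ r t k P) (V-p*-V σ σ̄ (t ℤ.+ + 1) (r ℤ.- + 1) k P))
      (≈-trans (+-congʳ (+-congʳ (+-congˡ (-‿cong (*-congʳ (sg-opposite σ)))))) (≈-trans (+-congˡ (+-congˡ (-‿cong (*-congʳ (sg-opposite σ)))))
      (≈-trans (solveΛ 8 (λ p s a b c a′ b′ c′ → p :* a :+ :- (:- s :* b) :+ :- (s :* c) :+ (p :* a′ :+ :- (s :* c′) :+ :- (:- s :* b′)) :=
         p :* (a :+ a′) :+ s :* (b :+ b′) :+ :- (s :* (c :+ c′))) ≈-refl p[1+ k ] (con (sg σ)) _ _ _ _ _ _)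
      (≈-trans (+-cong (+-cong (*-congˡ (IH r t)) (*-congˡ (≈-trans (+-congˡ (V-cong σ _ (V-≡ σ̄ P (ℤ-swap r (ℤ.- + 1) (+ suc k))))) (IH (r ℤ.+ + suc k) t))))
          (-‿cong (*-congˡ (≈-trans (+-congˡ (V-≡ σ _ (ℤ-swap t (+ 1) (+ suc k)))) (≈-trans (IH r (t ℤ.+ + suc k))
            (*-congʳ (reflexive (≡.cong (con ∘ δℤ) (ℤ-move r t (+ suc k))))))))))
        (solveΛ 5 (λ p s P d e → p :* (d :* P) :+ s :* (e :* P) :+ :- (s :* (e :* P)) := d :* (p :* P)) ≈-refl _ _ P _ _))))))
    (λ r t → ≈-trans (+-cong (V-cong σ̄ r (V-1 σ t)) (V-cong σ _ (V-1 σ̄ _))) (≈-trans (b-δ r t) (≈-sym (*-identityʳ _))))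
    Q r t
    where
    C : ℤ → ℤ → Λ → Λ
    C r t Q = V σ̄ r (V σ t Q) + V σ (t ℤ.+ + 1) (V σ̄ (r ℤ.- + 1) Q)
    ℤ-move : ∀ r t k → r ℤ.+ (t ℤ.+ k) ≡ (r ℤ.+ k) ℤ.+ t
    ℤ-move = solve-∀

⟪⟫-cong : ∀ {P P′ Q Q′} → P ≈ P′ → Q ≈ Q′ → ⟪ P , Q ⟫ ≡ ⟪ P′ , Q′ ⟫
⟪⟫-cong eq eq′ = ε-cong (D-cong eq eq′)

⟪⟫-+ʳ : ∀ P Q Q′ → ⟪ P , Q + Q′ ⟫ ≡ ⟪ P , Q ⟫ ℚ.+ ⟪ P , Q′ ⟫
⟪⟫-+ʳ P Q Q′ = ε-cong (D-+ P Q Q′)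

-- Exchanging p_{1+k} with its adjoint `∂ k` turns the rule `V-p*` of one operator into the rule
-- `V-∂` of the other; at P = 1 the claim is `V-ε`.
V-adjoint : ∀ P r Q → ⟪ V Sign.+ r P , Q ⟫ ≡ ⟪ P , V Sign.- (ℤ.- r) Q ⟫
V-adjoint = Λ-ind (λ P → ∀ r Q → ⟪ V Sign.+ r P , Q ⟫ ≡ ⟪ P , V Sign.- (ℤ.- r) Q ⟫)
  (λ eq IH r Q → ≡.trans (⟪⟫-cong (V-cong Sign.+ r (≈-sym eq)) ≈-refl) (≡.trans (IH r Q) (⟪⟫-cong eq ≈-refl)))
  (λ {P} {P′} IH IH′ r Q → ≡.trans (⟪⟫-cong (V-+ Sign.+ r P P′) ≈-refl) (≡.cong₂ ℚ._+_ (IH r Q) (IH′ r Q)))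
  (λ q {P} IH r Q → ≡.trans (⟪⟫-cong (V-con* Sign.+ r q P) ≈-refl) (≡.cong (q ℚ.*_) (IH r Q)))
  step
  (λ r Q → ≡.trans (⟪⟫-cong (V-1 Sign.+ r) ≈-refl) (≡.trans (≡.sym (≡.trans (V-ε Sign.- (ℤ.- r) Q) (≡.cong (λ r → ⟪ uℤ Sign.+ r , Q ⟫) (ℤ.neg-involutive r)))) (≡.sym (ℚ.*-identityˡ _))))
  where
  open ≡-Reasoning
  ℤ-eq : ∀ r k → ℤ.- (r ℤ.+ k) ≡ (ℤ.- r) ℤ.- k
  ℤ-eq = solve-∀
  step : ∀ k {P} → (∀ r Q → ⟪ V Sign.+ r P , Q ⟫ ≡ ⟪ P , V Sign.- (ℤ.- r) Q ⟫) → ∀ r Q → ⟪ V Sign.+ r (p[1+ k ] * P) , Q ⟫ ≡ ⟪ p[1+ k ] * P , V Sign.- (ℤ.- r) Q ⟫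
  step k {P} IH r Q = begin
    ⟪ V Sign.+ r (p[1+ k ] * P) , Q ⟫
      ≡⟨ ⟪⟫-cong (≈-trans (V-p* Sign.+ r k P) (+-cong (*-comm _ _) (-‿cong (*-identityˡ _)))) ≈-refl ⟩
    ⟪ V Sign.+ r P , ∂ k Q ⟫ ℚ.- ⟪ V Sign.+ (r ℤ.+ + suc k) P , Q ⟫
      ≡⟨ ≡.cong₂ ℚ._-_ (IH r (∂ k Q)) (IH (r ℤ.+ + suc k) Q) ⟩
    ⟪ P , V Sign.- (ℤ.- r) (∂ k Q) ⟫ ℚ.- ⟪ P , V Sign.- (ℤ.- (r ℤ.+ + suc k)) Q ⟫
      ≡⟨ ≡.cong (λ t → ⟪ P , V Sign.- (ℤ.- r) (∂ k Q) ⟫ ℚ.- ⟪ P , V Sign.- t Q ⟫) (ℤ-eq r (+ suc k)) ⟩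
    ⟪ P , V Sign.- (ℤ.- r) (∂ k Q) ⟫ ℚ.- ⟪ P , V Sign.- ((ℤ.- r) ℤ.- + suc k) Q ⟫
      ≡⟨ ≡.cong (⟪ P , V Sign.- (ℤ.- r) (∂ k Q) ⟫ ℚ.+_) (ε-cong (≈-sym (D-neg P (V Sign.- ((ℤ.- r) ℤ.- + suc k) Q)))) ⟩
    ⟪ P , V Sign.- (ℤ.- r) (∂ k Q) ⟫ ℚ.+ ⟪ P , - V Sign.- ((ℤ.- r) ℤ.- + suc k) Q ⟫
      ≡⟨ ⟪⟫-+ʳ P _ _ ⟨
    ⟪ P , V Sign.- (ℤ.- r) (∂ k Q) + - V Sign.- ((ℤ.- r) ℤ.- + suc k) Q ⟫
      ≡⟨ ε-cong (D-congʳ P (≈-sym (≈-trans (V-∂ Sign.- (ℤ.- r) k Q) (+-congˡ (≈-sym (neg-con _)))))) ⟩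
    ⟪ P , ∂ k (V Sign.- (ℤ.- r) Q) ⟫
      ≡⟨ ε-cong (D-∂-comm P k _) ⟩
    ⟪ p[1+ k ] * P , V Sign.- (ℤ.- r) Q ⟫ ∎

-- The Jacobi–Trudi formula

H : ℤ → Λ
H = uℤ Sign.+

h-H : ∀ r → h r ≡ H r
h-H (+ m)    = u-Ω Sign.+ m
h-H -[1+ m ] = ≡.refl

B⁺ : ℤ → Λ → Λ
B⁺ = V Sign.+

-- expand is the Laplace expansion along a first row whose entry in column c is g c;
-- F is the minor of the remaining columns.
expand : (ℤ → Λ) → (List ℤ → Λ) → List ℤ → Λ
expand g F []      = con 0ℚ
expand g F (c ∷ w) = g c * F w + - expand g (F ∘ (c ∷_)) w

-- detH αs w has the entries h_{α + c} for α in αs and c in w.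
detH : List ℤ → List ℤ → Λ
detH []       []      = con 1ℚ
detH []       (_ ∷ _) = con 0ℚ
detH (α ∷ αs) w       = expand (λ c → H (α ℤ.+ c)) (detH αs) w

expand-cong : ∀ {g g′ F F′} → (∀ c → g c ≈ g′ c) → (∀ w → F w ≈ F′ w) → ∀ w → expand g F w ≈ expand g′ F′ w
expand-cong eq eq′ []      = ≈-refl
expand-cong eq eq′ (c ∷ w) = +-cong (*-cong (eq c) (eq′ w)) (-‿cong (expand-cong eq (eq′ ∘ (c ∷_)) w))

-- A column of the determinant of B_r detH αs w: the entry of raw c is h_{α + c}, and that of
-- diff c is h_{α + c} - t h_{α + c - 1}, where t raises r.
data Column : Set where
  raw diff : ℤ → Column

-- A function of the index r of `B⁺ r`, on which t acts by raising r by one.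
Vector : Set
Vector = ℤ → Λ

act : ℤ → Column → Vector → Vector
act α (raw c)  v r = H (α ℤ.+ c) * v r
act α (diff c) v r = H (α ℤ.+ c) * v r + - (H (α ℤ.+ c ℤ.- + 1) * v (r ℤ.+ + 1))

expandᵛ : ℤ → (List Column → Vector) → List Column → Vector
expandᵛ α G []      r = con 0ℚ
expandᵛ α G (x ∷ w) r = act α x (G w) r + - expandᵛ α (G ∘ (x ∷_)) w r

detᵛ : List ℤ → List Column → Vector
-- With no entries left, B_r acts on 1 and gives h_r.
detᵛ []       []      = H
detᵛ []       (_ ∷ _) = λ _ → con 0ℚ
detᵛ (α ∷ αs) w       = expandᵛ α (detᵛ αs) w

-- By `V-u*`, B passes an entry h_a by turning it into h_a - t h_{a-1}, so it passes the whole
-- determinant entry by entry.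
B⁺-detH : ∀ αs w r → B⁺ r (detH αs w) ≈ detᵛ αs (List.map diff w) r
B⁺-detH []       []      r = V-1 Sign.+ r
B⁺-detH []       (c ∷ w) r = V-0 Sign.+ r
B⁺-detH (α ∷ αs) w       r = step (detH αs) (detᵛ αs) (λ w r → B⁺-detH αs w r) w r
  where
  step : ∀ F G → (∀ w r → B⁺ r (F w) ≈ G (List.map diff w) r) →
    ∀ w r → B⁺ r (expand (λ c → H (α ℤ.+ c)) F w) ≈ expandᵛ α G (List.map diff w) r
  step F G eq []      r = V-0 Sign.+ r
  step F G eq (c ∷ w) r = ≈-trans (V-+ Sign.+ r _ _) (+-cong
    (≈-trans (V-u* Sign.+ r (α ℤ.+ c) (F w)) (+-cong (*-congˡ (eq w r)) (-‿cong (*-congˡ (eq w (r ℤ.+ + 1))))))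
    (≈-trans (V-neg Sign.+ r _) (-‿cong (step (F ∘ (c ∷_)) (G ∘ (diff c ∷_)) (eq ∘ (c ∷_)) w r))))

detᵛ-raw : ∀ αs w r → detᵛ αs (List.map raw w) r ≈ detH αs w * H r
detᵛ-raw []       []      r = ≈-sym (*-identityˡ _)
detᵛ-raw []       (c ∷ w) r = ≈-sym (zeroˡ _)
detᵛ-raw (α ∷ αs) w       r = step (detH αs) (detᵛ αs) (λ w → detᵛ-raw αs w r) w
  where
  step : ∀ F G → (∀ w → G (List.map raw w) r ≈ F w * H r) → ∀ w → expandᵛ α G (List.map raw w) r ≈ expand (λ c → H (α ℤ.+ c)) F w * H r
  step F G eq []      = ≈-sym (zeroˡ _)
  step F G eq (c ∷ w) = ≈-trans (+-cong (≈-trans (*-congˡ (eq w)) (≈-sym (*-assoc _ _ _)))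
    (≈-trans (-‿cong (step (F ∘ (c ∷_)) (G ∘ (raw c ∷_)) (eq ∘ (c ∷_)) w)) (S.-‿distribˡ-* _ _))) (≈-sym (distribʳ _ _ _))

Alternating : (List Column → Vector) → Set
Alternating G = ∀ p x q r → G (p ++ x ∷ x ∷ q) r ≈ con 0ℚ

act-0 : ∀ α x {v} → (∀ r → v r ≈ con 0ℚ) → ∀ r → act α x v r ≈ con 0ℚ
act-0 α (raw c)  v≈0 r = ≈-trans (*-congˡ (v≈0 r)) (zeroʳ _)
act-0 α (diff c) v≈0 r = ≈-trans (+-cong (*-congˡ (v≈0 r)) (-‿cong (*-congˡ (v≈0 (r ℤ.+ + 1)))))
  (solveΛ 2 (λ a b → a :* K 0ℚ :+ :- (b :* K 0ℚ) := K 0ℚ) ≈-refl _ _)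

expandᵛ-0 : ∀ α {G} → (∀ w r → G w r ≈ con 0ℚ) → ∀ w r → expandᵛ α G w r ≈ con 0ℚ
expandᵛ-0 α G≈0 []      r = ≈-refl
expandᵛ-0 α G≈0 (x ∷ w) r = ≈-trans (+-cong (act-0 α x (G≈0 w) r) (-‿cong (expandᵛ-0 α (G≈0 ∘ (x ∷_)) w r))) (-‿inverseʳ _)

-- In the expansion, the two terms that pick one of the equal columns cancel; all others keep both
-- columns in the minor.
detᵛ-alternating : ∀ αs → Alternating (detᵛ αs)
detᵛ-alternating []       []      x q r = ≈-refl
detᵛ-alternating []       (y ∷ p) x q r = ≈-refl
detᵛ-alternating (α ∷ αs) = step (detᵛ αs) (detᵛ-alternating αs)
  where
  step : ∀ G → Alternating G → Alternating (expandᵛ α G)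
  step G alt []      x q r = ≈-trans (+-congˡ (-‿cong (+-congˡ (-‿cong (expandᵛ-0 α (λ w → alt [] x w) q r)))))
    (solveΛ 1 (λ a → a :+ :- (a :+ :- K 0ℚ) := K 0ℚ) ≈-refl _)
  step G alt (y ∷ p) x q r = ≈-trans (+-cong (act-0 α y (alt p x q) r) (-‿cong (step (G ∘ (y ∷_)) (alt ∘ (y ∷_)) p x q r))) (-‿inverseʳ _)

Linear : (List Column → Vector) → Set
Linear G = ∀ p c q r → G (p ++ diff c ∷ q) r ≈ G (p ++ raw c ∷ q) r + - G (p ++ raw (c ℤ.- + 1) ∷ q) (r ℤ.+ + 1)

act-linear : ∀ α x {v v₁ v₂} → (∀ r → v r ≈ v₁ r + - v₂ (r ℤ.+ + 1)) → ∀ r → act α x v r ≈ act α x v₁ r + - act α x v₂ (r ℤ.+ + 1)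
act-linear α (raw c)  eq r = ≈-trans (*-congˡ (eq r)) (solveΛ 3 (λ a b c → a :* (b :+ :- c) := a :* b :+ :- (a :* c)) ≈-refl _ _ _)
act-linear α (diff c) eq r = ≈-trans (+-cong (*-congˡ (eq r)) (-‿cong (*-congˡ (eq (r ℤ.+ + 1)))))
  (solveΛ 6 (λ a b c d e f → a :* (b :+ :- c) :+ :- (d :* (e :+ :- f)) := (a :* b :+ :- (d :* e)) :+ :- (a :* c :+ :- (d :* f))) ≈-refl _ _ _ _ _ _)

expandᵛ-linear : ∀ α {G G₁ G₂} → (∀ w r → G w r ≈ G₁ w r + - G₂ w (r ℤ.+ + 1)) →
  ∀ w r → expandᵛ α G w r ≈ expandᵛ α G₁ w r + - expandᵛ α G₂ w (r ℤ.+ + 1)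
expandᵛ-linear α eq []      r = ≈-sym (-‿inverseʳ _)
expandᵛ-linear α eq (x ∷ w) r = ≈-trans (+-cong (act-linear α x (eq w) r) (-‿cong (expandᵛ-linear α (eq ∘ (x ∷_)) w r)))
  (solveΛ 4 (λ a b c d → a :+ :- b :+ :- (c :+ :- d) := a :+ :- c :+ :- (b :+ :- d)) ≈-refl _ _ _ _)

detᵛ-linear : ∀ αs → Linear (detᵛ αs)
detᵛ-linear []       []      c q r = ≈-sym (-‿inverseʳ _)
detᵛ-linear []       (y ∷ p) c q r = ≈-sym (-‿inverseʳ _)
detᵛ-linear (α ∷ αs) = step (detᵛ αs) (detᵛ-linear αs)
  where
  step : ∀ G → Linear G → Linear (expandᵛ α G)
  step G lin []      c q r = ≈-trans (+-cong (+-congˡ (-‿cong (*-congʳ (reflexive (≡.cong H (ℤ.+-assoc α c (ℤ.- + 1)))))))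
      (-‿cong (expandᵛ-linear α (λ w → lin [] c w) q r)))
    (solveΛ 4 (λ a b c d → a :+ :- b :+ :- (c :+ :- d) := a :+ :- c :+ :- (b :+ :- d)) ≈-refl _ _ _ _)
  step G lin (y ∷ p) c q r = ≈-trans (+-cong (act-linear α y (lin p c q) r) (-‿cong (step (G ∘ (y ∷_)) (lin ∘ (y ∷_)) p c q r)))
    (solveΛ 4 (λ a b c d → a :+ :- b :+ :- (c :+ :- d) := a :+ :- c :+ :- (b :+ :- d)) ≈-refl _ _ _ _)

range : ℤ → ℕ → List ℤ
range c zero    = []
range c (suc n) = c ∷ range (c ℤ.+ + 1) n

range-∷ʳ : ∀ c n → range c (suc n) ≡ range c n ∷ʳ (c ℤ.+ + n)
range-∷ʳ c zero    = ≡.cong (_∷ []) (≡.sym (ℤ.+-identityʳ c))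
range-∷ʳ c (suc n) = ≡.cong (c ∷_) (≡.trans (range-∷ʳ (c ℤ.+ + 1) n) (≡.cong (range (c ℤ.+ + 1) n ∷ʳ_) (ℤ.+-assoc c (+ 1) (+ n))))

-- The alternating sum of G (w without its m-th column), multiplied by t^m.
omit : (List Column → Vector) → List Column → Vector
omit G []      r = con 0ℚ
omit G (x ∷ w) r = G w r + - omit (G ∘ (x ∷_)) w (r ℤ.+ + 1)

omit-0 : ∀ {G} → (∀ w r → G w r ≈ con 0ℚ) → ∀ w r → omit G w r ≈ con 0ℚ
omit-0 G≈0 []      r = ≈-refl
omit-0 G≈0 (x ∷ w) r = ≈-trans (+-cong (G≈0 w r) (-‿cong (omit-0 (G≈0 ∘ (x ∷_)) w _))) (-‿inverseʳ _)

omit-cong : ∀ {G G′} → (∀ w r → G w r ≈ G′ w r) → ∀ w r → omit G w r ≈ omit G′ w r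
omit-cong eq []      r = ≈-refl
omit-cong eq (x ∷ w) r = +-cong (eq w r) (-‿cong (omit-cong (eq ∘ (x ∷_)) w _))

last-term : (List Column → Vector) → List Column → ℕ → Vector
last-term G w zero    r = G w r
last-term G w (suc n) r = - last-term G w n (r ℤ.+ + 1)

last-term-cons : ∀ G x w n r → last-term (G ∘ (x ∷_)) w n r ≡ last-term G (x ∷ w) n r
last-term-cons G x w zero    r = ≡.refl
last-term-cons G x w (suc n) r = ≡.cong -_ (last-term-cons G x w n (r ℤ.+ + 1))

omit-∷ʳ : ∀ G w y r → omit G (w ∷ʳ y) r ≈ omit (λ w → G (w ∷ʳ y)) w r + last-term G w (List.length w) r
omit-∷ʳ G []      y r = ≈-trans (+-congˡ S.-0#≈0#) (+-comm _ _)
omit-∷ʳ G (x ∷ w) y r = ≈-trans (+-congˡ (≈-trans (-‿cong (≈-trans (omit-∷ʳ (G ∘ (x ∷_)) w y (r ℤ.+ + 1))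
    (+-congˡ (reflexive (last-term-cons G x w (List.length w) (r ℤ.+ + 1)))))) (neg-+ _ _))) (≈-sym (+-assoc _ _ _))

last-term-cong : ∀ {G G′ w w′} → (∀ r → G w r ≈ G′ w′ r) → ∀ n r → last-term G w n r ≈ last-term G′ w′ n r
last-term-cong eq zero    r = eq r
last-term-cong {G} {G′} eq (suc n) r = -‿cong (last-term-cong {G} {G′} eq n _)

length-range : ∀ c n → List.length (List.map raw (range c n)) ≡ n
length-range c zero    = ≡.refl
length-range c (suc n) = ≡.cong suc (length-range (c ℤ.+ + 1) n)

map-range-∷ʳ : ∀ (f : ℤ → Column) c n → List.map f (range c (suc n)) ≡ List.map f (range c n) ∷ʳ f (c ℤ.+ + n)
map-range-∷ʳ f c n = ≡.trans (≡.cong (List.map f) (range-∷ʳ c n)) (List.map-++ f (range c n) _)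

-- Expand diff k, diff (k - 1), ... in turn: a column raw (k - 1) next to itself contributes nothing.
diff-columns : ∀ G → Linear G → Alternating G → ∀ k rest r →
  G (List.map diff (range (+ 0) k) ++ rest) r ≈ omit (λ w → G (w ++ rest)) (List.map raw (range (ℤ.- + 1) (suc k))) r
diff-columns G lin alt zero    rest r = ≈-sym (≈-trans (+-congˡ S.-0#≈0#) (+-identityʳ _))
diff-columns G lin alt (suc k) rest r = begin
  G (List.map diff (range (+ 0) (suc k)) ++ rest) r
    ≡⟨ ≡.cong (λ w → G w r) (≡.trans (≡.cong (_++ rest) (map-range-∷ʳ diff (+ 0) k)) (List.∷ʳ-++ diffs (diff c) rest)) ⟩
  G (diffs ++ diff c ∷ rest) r
    ≈⟨ lin diffs c rest r ⟩
  G (diffs ++ raw c ∷ rest) r + - G (diffs ++ raw (c ℤ.- + 1) ∷ rest) (r ℤ.+ + 1)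
    ≈⟨ +-cong (diff-columns G lin alt k (raw c ∷ rest) r) (-‿cong (diff-columns G lin alt k (raw (c ℤ.- + 1) ∷ rest) (r ℤ.+ + 1))) ⟩
  omit (λ w → G (w ++ raw c ∷ rest)) raws r + - omit (λ w → G (w ++ raw (c ℤ.- + 1) ∷ rest)) raws (r ℤ.+ + 1)
    ≈⟨ +-congˡ (-‿cong (≈-trans (reflexive (≡.cong₂ (λ x w → omit (λ w → G (w ++ raw x ∷ rest)) w (r ℤ.+ + 1)) (ℤ-eq (+ k)) (map-range-∷ʳ raw (ℤ.- + 1) k)))
        (≈-trans (omit-∷ʳ (λ w → G (w ++ y ∷ rest)) raws⁻ y (r ℤ.+ + 1)) (≈-trans (+-congʳ
          (omit-0 (λ w r → ≈-trans (reflexive (≡.cong (λ w → G w r) (List.∷ʳ-++ w y (y ∷ rest)))) (alt w y rest r)) raws⁻ (r ℤ.+ + 1)))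
          (+-identityˡ _))))) ⟩
  omit (λ w → G (w ++ raw c ∷ rest)) raws r + - last-term (λ w → G (w ++ y ∷ rest)) raws⁻ (List.length raws⁻) (r ℤ.+ + 1)
    ≈⟨ +-cong (omit-cong (λ w r → reflexive (≡.cong (λ w → G w r) (≡.sym (List.∷ʳ-++ w (raw c) rest)))) raws r)
        (-‿cong (last-term-cong {λ w → G (w ++ y ∷ rest)} {λ w → G (w ++ rest)} (λ r → reflexive (≡.cong (λ w → G w r)
          (≡.sym (≡.trans (≡.cong (_++ rest) (map-range-∷ʳ raw (ℤ.- + 1) k)) (List.∷ʳ-++ raws⁻ y rest))))) (List.length raws⁻) (r ℤ.+ + 1))) ⟩
  omit (λ w → G ((w ∷ʳ raw c) ++ rest)) raws r + last-term (λ w → G (w ++ rest)) raws (suc (List.length raws⁻)) r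
    ≡⟨ ≡.cong (λ n → omit (λ w → G ((w ∷ʳ raw c) ++ rest)) raws r + last-term (λ w → G (w ++ rest)) raws n r)
        (≡.trans (≡.cong suc (length-range (ℤ.- + 1) k)) (≡.sym (length-range (ℤ.- + 1) (suc k)))) ⟩
  omit (λ w → G ((w ∷ʳ raw c) ++ rest)) raws r + last-term (λ w → G (w ++ rest)) raws (List.length raws) r
    ≈⟨ omit-∷ʳ (λ w → G (w ++ rest)) raws (raw c) r ⟨
  omit (λ w → G (w ++ rest)) (raws ∷ʳ raw c) r
    ≡⟨ ≡.cong (λ w → omit (λ w → G (w ++ rest)) w r) (map-range-∷ʳ raw (ℤ.- + 1) (suc k)) ⟨
  omit (λ w → G (w ++ rest)) (List.map raw (range (ℤ.- + 1) (suc (suc k)))) r ∎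
  where
  open ≈-Reasoning
  c = + 0 ℤ.+ + k
  y = raw (ℤ.- + 1 ℤ.+ + k)
  diffs = List.map diff (range (+ 0) k)
  raws  = List.map raw (range (ℤ.- + 1) (suc k))
  raws⁻ = List.map raw (range (ℤ.- + 1) k)
  ℤ-eq : ∀ k → (+ 0 ℤ.+ k) ℤ.- + 1 ≡ ℤ.- + 1 ℤ.+ k
  ℤ-eq = solve-∀

-- The factor h_r produced by `detᵛ-raw`, with r raised by t once for each column passed, is the
-- entry of a new first row. The alternating sum is thus a Laplace expansion along that row.
omit-expand : ∀ {G F} → (∀ w r → G (List.map raw w) r ≈ F w * H r) → ∀ n s c r → s ℤ.+ c ≡ r →
  omit G (List.map raw (range c n)) r ≈ expand (λ x → H (s ℤ.+ x)) F (range c n)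
omit-expand eq zero    s c r e = ≈-refl
omit-expand {G} {F} eq (suc n) s c r e = +-cong (≈-trans (eq _ r) (≈-trans (*-comm _ _) (*-congʳ (reflexive (≡.cong H (≡.sym e))))))
  (-‿cong (omit-expand {G ∘ (raw c ∷_)} {F ∘ (c ∷_)} (eq ∘ (c ∷_)) n s (c ℤ.+ + 1) (r ℤ.+ + 1)
    (≡.trans (≡.sym (ℤ.+-assoc s c (+ 1))) (≡.cong (ℤ._+ + 1) e))))

expand-map : ∀ f g F w → expand g F (List.map f w) ≡ expand (g ∘ f) (F ∘ List.map f) w
expand-map f g F []      = ≡.refl
expand-map f g F (c ∷ w) = ≡.cong (λ x → g (f c) * F (List.map f w) + - x) (expand-map f g (F ∘ (f c ∷_)) w)

pred-ℤ : ℤ → ℤ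
pred-ℤ c = c ℤ.- + 1

range-pred : ∀ c n → range (pred-ℤ c) n ≡ List.map pred-ℤ (range c n)
range-pred c zero    = ≡.refl
range-pred c (suc n) = ≡.cong (pred-ℤ c ∷_) (≡.trans (≡.cong (λ x → range x n) (ℤ-swap c (ℤ.- + 1) (+ 1))) (range-pred (c ℤ.+ + 1) n))

detH-pred : ∀ αs w → detH αs (List.map pred-ℤ w) ≈ detH (List.map pred-ℤ αs) w
detH-pred []       []      = ≈-refl
detH-pred []       (c ∷ w) = ≈-refl
detH-pred (α ∷ αs) w       = ≈-trans (reflexive (expand-map pred-ℤ (λ c → H (α ℤ.+ c)) (detH αs) w))
  (expand-cong (λ c → reflexive (≡.cong H (ℤ-eq α c))) (λ w → detH-pred αs w) w)
  where
  ℤ-eq : ∀ α c → α ℤ.+ (c ℤ.- + 1) ≡ (α ℤ.- + 1) ℤ.+ c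
  ℤ-eq = solve-∀

-- The columns come out numbered from -1. Renumbering them from 0 lowers the old rows by one, which
-- is how the indices μ_i - i of Jacobi-Trudi arise.
B⁺-detH-range : ∀ r αs n → B⁺ r (detH αs (range (+ 0) n)) ≈ detH (r ∷ List.map pred-ℤ αs) (range (+ 0) (suc n))
B⁺-detH-range r αs n = begin
  B⁺ r (detH αs (range (+ 0) n))
    ≈⟨ B⁺-detH αs (range (+ 0) n) r ⟩
  detᵛ αs (List.map diff (range (+ 0) n)) r
    ≡⟨ ≡.cong (λ w → detᵛ αs w r) (List.++-identityʳ _) ⟨
  detᵛ αs (List.map diff (range (+ 0) n) ++ []) r
    ≈⟨ diff-columns (detᵛ αs) (detᵛ-linear αs) (detᵛ-alternating αs) n [] r ⟩
  omit (λ w → detᵛ αs (w ++ [])) (List.map raw (range (ℤ.- + 1) (suc n))) r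
    ≈⟨ omit-cong {λ w → detᵛ αs (w ++ [])} {detᵛ αs} (λ w r → reflexive (≡.cong (λ w → detᵛ αs w r) (List.++-identityʳ w))) (List.map raw (range (ℤ.- + 1) (suc n))) r ⟩
  omit (detᵛ αs) (List.map raw (range (ℤ.- + 1) (suc n))) r
    ≈⟨ omit-expand {detᵛ αs} {detH αs} (detᵛ-raw αs) (suc n) (r ℤ.+ + 1) (ℤ.- + 1) r (ℤ-cancel r) ⟩
  expand (λ x → H (r ℤ.+ + 1 ℤ.+ x)) (detH αs) (range (ℤ.- + 1) (suc n))
    ≡⟨ ≡.cong (expand (λ x → H (r ℤ.+ + 1 ℤ.+ x)) (detH αs)) (range-pred (+ 0) (suc n)) ⟩
  expand (λ x → H (r ℤ.+ + 1 ℤ.+ x)) (detH αs) (List.map pred-ℤ (range (+ 0) (suc n)))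
    ≡⟨ expand-map pred-ℤ (λ x → H (r ℤ.+ + 1 ℤ.+ x)) (detH αs) (range (+ 0) (suc n)) ⟩
  expand (λ x → H (r ℤ.+ + 1 ℤ.+ (x ℤ.- + 1))) (detH αs ∘ List.map pred-ℤ) (range (+ 0) (suc n))
    ≈⟨ expand-cong (λ c → reflexive (≡.cong H (ℤ-eq r c))) (λ w → detH-pred αs w) (range (+ 0) (suc n)) ⟩
  detH (r ∷ List.map pred-ℤ αs) (range (+ 0) (suc n)) ∎
  where
  open ≈-Reasoning
  ℤ-cancel : ∀ r → (r ℤ.+ + 1) ℤ.- + 1 ≡ r
  ℤ-cancel = solve-∀
  ℤ-eq : ∀ r c → (r ℤ.+ + 1) ℤ.+ (c ℤ.- + 1) ≡ r ℤ.+ c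
  ℤ-eq = solve-∀

open RingOps Λ-rawRing using (det; sum; _^_)

sum-cong : ∀ n {a b : Fin.Fin n → Λ} → (∀ i → a i ≈ b i) → sum a ≈ sum b
sum-cong zero    eq = ≈-refl
sum-cong (suc n) eq = +-cong (eq Fin.zero) (sum-cong n (eq ∘ Fin.suc))

sum-neg : ∀ n (a : Fin.Fin n → Λ) → sum (λ i → - a i) ≈ - sum a
sum-neg zero    a = ≈-sym S.-0#≈0#
sum-neg (suc n) a = ≈-trans (+-congˡ (sum-neg n (a ∘ Fin.suc))) (≈-sym (neg-+ _ _))

-- The powers of -1 in `det` unfold into the nested subtractions of `expand`.
sum-expand : ∀ n g F (w : Fin.Fin (suc n) → ℤ) →
  sum (λ j → (- con 1ℚ) ^ Fin.toℕ j * (g (w j) * F (List.tabulate (w ∘ Fin.punchIn j)))) ≈ expand g F (List.tabulate w)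
sum-expand n g F w = +-cong (*-identityˡ _) (rest n g F w)
  where
  neg-* : ∀ P Q → - con 1ℚ * P * Q ≈ - (P * Q)
  neg-* = solveΛ 2 (λ P Q → :- K 1ℚ :* P :* Q := :- (P :* Q)) ≈-refl
  rest : ∀ n g F (w : Fin.Fin (suc n) → ℤ) →
    sum (λ j → (- con 1ℚ) ^ suc (Fin.toℕ j) * (g (w (Fin.suc j)) * F (List.tabulate (w ∘ Fin.punchIn (Fin.suc j))))) ≈
    - expand g (F ∘ (w Fin.zero ∷_)) (List.tabulate (w ∘ Fin.suc))
  rest zero    g F w = ≈-sym S.-0#≈0#
  rest (suc n) g F w = ≈-trans (sum-cong (suc n) λ j → neg-* ((- con 1ℚ) ^ Fin.toℕ j) (g (w (Fin.suc j)) * F (w Fin.zero ∷ List.tabulate (w ∘ Fin.suc ∘ Fin.punchIn j))))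
    (≈-trans (sum-neg (suc n) (λ j → (- con 1ℚ) ^ Fin.toℕ j * (g (w (Fin.suc j)) * F (w Fin.zero ∷ List.tabulate (w ∘ Fin.suc ∘ Fin.punchIn j))))) (-‿cong (sum-expand n g (F ∘ (w Fin.zero ∷_)) (w ∘ Fin.suc))))

det-cong : ∀ n {M M′ : Fin.Fin n → Fin.Fin n → Λ} → (∀ i j → M i j ≈ M′ i j) → det M ≈ det M′
det-cong zero    eq = ≈-refl
det-cong (suc n) eq = sum-cong (suc n) λ j → *-congˡ {(- con 1ℚ) ^ Fin.toℕ j} (*-cong (eq Fin.zero j) (det-cong n λ i k → eq (Fin.suc i) (Fin.punchIn j k)))

det-detH : ∀ n (a w : Fin.Fin n → ℤ) → det (λ i j → H (a i ℤ.+ w j)) ≈ detH (List.tabulate a) (List.tabulate w)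
det-detH zero    a w = ≈-refl
det-detH (suc n) a w = ≈-trans (sum-cong (suc n) λ j → *-congˡ {(- con 1ℚ) ^ Fin.toℕ j} (*-congˡ {H (a Fin.zero ℤ.+ w j)} (det-detH n (a ∘ Fin.suc) (w ∘ Fin.punchIn j))))
  (sum-expand n (λ c → H (a Fin.zero ℤ.+ c)) (detH (List.tabulate (a ∘ Fin.suc))) w)

-- The numbers μ_i - i, with i counted from 0: a new row on top pushes all the others down by one.
rows : List ℕ → List ℤ
rows []      = []
rows (r ∷ μ) = + r ∷ List.map pred-ℤ (rows μ)

B⁺s : List ℕ → Λ
B⁺s []      = con 1ℚ
B⁺s (r ∷ μ) = B⁺ (+ r) (B⁺s μ)

s-B⁺s : ∀ μ → s μ ≈ B⁺s μ
s-B⁺s μ = ≈-trans (det-cong n λ i j → reflexive (≡.trans (h-H ((List.lookup μ i ℕ.+ Fin.toℕ j) ⊖ Fin.toℕ i)) (≡.cong H (index (List.lookup μ i) (Fin.toℕ j) (Fin.toℕ i)))))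
  (≈-trans (det-detH n (λ i → + List.lookup μ i ℤ.- + Fin.toℕ i) (λ j → + 0 ℤ.+ + Fin.toℕ j))
  (≈-trans (reflexive (≡.cong₂ detH (tabulate-rows μ) (tabulate-range n (+ 0)))) (≈-sym (B⁺s-detH μ))))
  where
  n = List.length μ
  index : ∀ m j i → (m ℕ.+ j) ⊖ i ≡ (+ m ℤ.- + i) ℤ.+ (+ 0 ℤ.+ + j)
  index m j i = ≡.trans (≡.sym (ℤ.m-n≡m⊖n (m ℕ.+ j) i)) (ℤ-eq (+ m) (+ j) (+ i))
    where
    ℤ-eq : ∀ m j i → (m ℤ.+ j) ℤ.- i ≡ (m ℤ.- i) ℤ.+ (+ 0 ℤ.+ j)
    ℤ-eq = solve-∀
  tabulate-range : ∀ n c → List.tabulate {n = n} (λ j → c ℤ.+ + Fin.toℕ j) ≡ range c n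
  tabulate-range zero    c = ≡.refl
  tabulate-range (suc n) c = ≡.cong₂ _∷_ (ℤ.+-identityʳ c)
    (≡.trans (List.tabulate-cong λ j → ≡.sym (ℤ.+-assoc c (+ 1) (+ Fin.toℕ j))) (tabulate-range n (c ℤ.+ + 1)))
  tabulate-rows : ∀ μ → List.tabulate (λ i → + List.lookup μ i ℤ.- + Fin.toℕ i) ≡ rows μ
  tabulate-rows []      = ≡.refl
  tabulate-rows (r ∷ μ) = ≡.cong₂ _∷_ (ℤ.+-identityʳ (+ r)) (≡.trans
    (List.tabulate-cong λ i → ℤ-eq (+ List.lookup μ i) (+ Fin.toℕ i))
    (≡.trans (≡.sym (List.map-tabulate (λ i → + List.lookup μ i ℤ.- + Fin.toℕ i) pred-ℤ)) (≡.cong (List.map pred-ℤ) (tabulate-rows μ))))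
    where
    ℤ-eq : ∀ m i → m ℤ.- (+ 1 ℤ.+ i) ≡ (m ℤ.- i) ℤ.- + 1
    ℤ-eq = solve-∀
  B⁺s-detH : ∀ μ → B⁺s μ ≈ detH (rows μ) (range (+ 0) (List.length μ))
  B⁺s-detH []      = ≈-refl
  B⁺s-detH (r ∷ μ) = ≈-trans (V-cong Sign.+ (+ r) (B⁺s-detH μ)) (B⁺-detH-range (+ r) (rows μ) (List.length μ))

-- Orthonormality of the Schur functions

-- Partitions in the shape in which the first part can be split off: each part is the bound for the
-- rest.
data PartsAtMost : ℕ → List ℕ → Set where
  []  : ∀ {m} → PartsAtMost m []
  _∷_ : ∀ {m r μ} → suc r ℕ.≤ m → PartsAtMost (suc r) μ → PartsAtMost m (suc r ∷ μ)

PartsAtMost-mono : ∀ {l m μ} → l ℕ.≤ m → PartsAtMost l μ → PartsAtMost m μ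
PartsAtMost-mono l≤m []       = []
PartsAtMost-mono l≤m (r≤l ∷ π) = ℕ.≤-trans r≤l l≤m ∷ π

PartsAtMost⇒IsPartition : ∀ {m μ} → PartsAtMost m μ → IsPartition μ
PartsAtMost⇒IsPartition []              = [] , []
PartsAtMost⇒IsPartition (_ ∷ [])        = [-] , (_ ∷ [])
PartsAtMost⇒IsPartition (_ ∷ (r≤m ∷ π)) with PartsAtMost⇒IsPartition (r≤m ∷ π)
... | linked , nonZero = (r≤m ∷ linked) , (_ ∷ nonZero)

-- The bound m on the parts has to be recorded, because straightening applies `span-B⁺-pred` to sums
-- in which no part may exceed 1 + r.
data Span (m : ℕ) : Λ → Set where
  span-≈ : ∀ {P Q} → P ≈ Q → Span m P → Span m Q
  span-0 : Span m (con 0ℚ)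
  span-+ : ∀ {P Q} → Span m P → Span m Q → Span m (P + Q)
  span-* : ∀ q {P} → Span m P → Span m (con q * P)
  span-s : ∀ {μ} → PartsAtMost m μ → Span m (B⁺s μ)

span-mono : ∀ {l m P} → l ℕ.≤ m → Span l P → Span m P
span-mono l≤m (span-≈ eq σ) = span-≈ eq (span-mono l≤m σ)
span-mono l≤m span-0        = span-0
span-mono l≤m (span-+ σ σ′) = span-+ (span-mono l≤m σ) (span-mono l≤m σ′)
span-mono l≤m (span-* q σ)  = span-* q (span-mono l≤m σ)
span-mono l≤m (span-s π)    = span-s (PartsAtMost-mono l≤m π)

span-neg : ∀ {m P} → Span m P → Span m (- P)
span-neg σ = span-≈ (≈-sym (neg-con _)) (span-* _ σ)

span-B⁺ : ∀ {l m b P} → (∀ {μ} → PartsAtMost l μ → Span m (B⁺ b (B⁺s μ))) → Span l P → Span m (B⁺ b P)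
span-B⁺ {b = b} gen (span-≈ eq σ) = span-≈ (V-cong Sign.+ b eq) (span-B⁺ gen σ)
span-B⁺ {b = b} gen span-0        = span-≈ (≈-sym (V-0 Sign.+ b)) span-0
span-B⁺ {b = b} gen (span-+ σ σ′) = span-≈ (≈-sym (V-+ Sign.+ b _ _)) (span-+ (span-B⁺ gen σ) (span-B⁺ gen σ′))
span-B⁺ {b = b} gen (span-* q σ)  = span-≈ (≈-sym (V-con* Sign.+ b q _)) (span-* q (span-B⁺ gen σ))
span-B⁺ gen (span-s π)            = gen π

B⁺-1 : ∀ r → B⁺ (+ r) (con 1ℚ) ≈ H (+ r)
B⁺-1 r = V-1 Sign.+ (+ r)

double-0 : ∀ {P} → P + P ≈ con 0ℚ → P ≈ con 0ℚ
double-0 {P} eq = ≈-trans (solveΛ 1 (λ P → P := K ℚ.½ :* (P :+ P)) ≈-refl P) (≈-trans (*-congˡ eq) (zeroʳ _))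

-- B_r does not increase the largest part beyond 1 + r, since B_r B_{1+r} = 0.
span-B⁺-pred : ∀ r {μ} → PartsAtMost (suc r) μ → Span (suc r) (B⁺ (+ r) (B⁺s μ))
span-B⁺-pred zero    [] = span-≈ (≈-sym (≈-trans (B⁺-1 0) (u-0 Sign.+))) (span-s [])
span-B⁺-pred (suc r) [] = span-s (ℕ.n≤1+n _ ∷ [])
span-B⁺-pred r (_∷_ {r = k} {μ} k≤r π) with ℕ.m≤n⇒m<n∨m≡n k≤r
... | inj₂ ≡.refl = span-≈ (≈-sym (double-0 (≈-trans (+-congˡ (V-cong Sign.+ (+ r) (V-≡ Sign.+ (B⁺s μ) (≡.cong +_ (≡.sym (ℕ.+-comm r 1))))))
  (V-anticomm Sign.+ (+ r) (+ suc r) (B⁺s μ))))) span-0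
span-B⁺-pred (suc r) (_∷_ {r = k} _ π) | inj₁ (s≤s k≤r) = span-s (ℕ.n≤1+n _ ∷ (k≤r ∷ π))

-- If b is at least the first part 1 + k, this is a partition already. Otherwise B_b B_{1+k} = - B_k
-- B_{b+1}, where B_{b+1} meets a shorter partition and stays within parts up to 1 + k since b + 1
-- is at most 1 + k.
straighten : ∀ {l m} b {μ} → PartsAtMost l μ → l ℕ.≤ m → b ℤ.≤ + m → Span m (B⁺ b (B⁺s μ))
straighten -[1+ n ]  [] l≤m b≤m = span-≈ (≈-sym (V-1 Sign.+ -[1+ n ])) span-0
straighten (+ zero)  [] l≤m b≤m = span-≈ (≈-sym (≈-trans (B⁺-1 0) (u-0 Sign.+))) (span-s [])
straighten (+ suc n) [] l≤m (ℤ.+≤+ n≤m) = span-s (n≤m ∷ [])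
straighten b (_∷_ {r = k} {μ} k≤l π) l≤m b≤m with + suc k ℤ.≤? b
straighten (+ zero)  (_∷_ k≤l π) l≤m b≤m | yes (ℤ.+≤+ ())
straighten (+ suc n) (_∷_ k≤l π) l≤m (ℤ.+≤+ n≤m) | yes (ℤ.+≤+ k≤n) = span-s (n≤m ∷ (k≤n ∷ π))
straighten b (_∷_ {r = k} {μ} k≤l π) l≤m b≤m | no k≰b =
  span-≈ (≈-sym (solve-for (V-anticomm Sign.+ b (+ suc k) (B⁺s μ))))
    (span-neg (span-mono (ℕ.≤-trans k≤l l≤m) (span-B⁺ (span-B⁺-pred k)
      (straighten (b ℤ.+ + 1) π ℕ.≤-refl (≡.subst (ℤ._≤ + suc k) (ℤ.+-comm (+ 1) b) (ℤ.i<j⇒suc[i]≤j (ℤ.≰⇒> k≰b)))))))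
  where
  solve-for : ∀ {P Q} → P + Q ≈ con 0ℚ → P ≈ - Q
  solve-for {P} {Q} eq = ≈-trans (solveΛ 2 (λ P Q → P := (P :+ Q) :+ :- Q) ≈-refl P Q) (≈-trans (+-congʳ eq) (+-identityˡ _))

Spanned : Λ → Set
Spanned P = ∃ λ m → Span m P

spanned-≈ : ∀ {P Q} → P ≈ Q → Spanned P → Spanned Q
spanned-≈ eq (m , σ) = m , span-≈ eq σ

spanned-+ : ∀ {P Q} → Spanned P → Spanned Q → Spanned (P + Q)
spanned-+ (m , σ) (n , τ) = m ℕ.⊔ n , span-+ (span-mono (ℕ.m≤m⊔n m n) σ) (span-mono (ℕ.m≤n⊔m m n) τ)

spanned-* : ∀ q {P} → Spanned P → Spanned (con q * P)
spanned-* q (m , σ) = m , span-* q σ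

spanned-neg : ∀ {P} → Spanned P → Spanned (- P)
spanned-neg (m , σ) = m , span-neg σ

spanned-∑ : ∀ n {a : ℕ → Λ} → (∀ i → i ℕ.≤ n → Spanned (a i)) → Spanned (∑ n a)
spanned-∑ zero    sp = sp 0 z≤n
spanned-∑ (suc n) sp = spanned-+ (sp 0 z≤n) (spanned-∑ n λ i i≤n → sp (suc i) (s≤s i≤n))

i≤∣i∣ : ∀ i → i ℤ.≤ + ℤ.∣ i ∣
i≤∣i∣ (+ n)    = ℤ.≤-refl
i≤∣i∣ -[1+ n ] = ℤ.-≤+

spanned-B⁺ : ∀ b {P} → Spanned P → Spanned (B⁺ b P)
spanned-B⁺ b (m , σ) = m ℕ.⊔ ℤ.∣ b ∣ , span-B⁺ (λ π → straighten b π (ℕ.m≤m⊔n m _) (ℤ.≤-trans (i≤∣i∣ b) (ℤ.+≤+ (ℕ.m≤n⊔m m _)))) σ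

-- `V-u*` reads h_n B_r = B_r h_n + h_{n-1} B_{r+1}: the first term has h_n before a shorter
-- partition, the second has a smaller n.
spanned-H* : ∀ n {P} → Spanned P → Spanned (H (+ n) * P)
spanned-H* n (m , σ) = linear σ
  where
  step : ∀ {Q} → Spanned Q → (∀ n → Spanned (H (+ n) * Q)) → ∀ n r → Spanned (H (+ n) * B⁺ r Q)
  step {Q} sp IH zero    r = spanned-≈ (≈-sym (≈-trans (*-congʳ (u-0 Sign.+)) (*-identityˡ _))) (spanned-B⁺ r sp)
  step {Q} sp IH (suc n) r = spanned-≈ (≈-trans (+-congʳ (V-u* Sign.+ r (+ suc n) Q))
      (solveΛ 2 (λ a b → a :+ :- b :+ b := a) ≈-refl _ _))
    (spanned-+ (spanned-B⁺ r (IH (suc n))) (step sp IH n (r ℤ.+ + 1)))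
  gen : ∀ {l μ} → PartsAtMost l μ → ∀ n → Spanned (H (+ n) * B⁺s μ)
  gen []      n = spanned-≈ (≈-trans (B⁺-1 n) (≈-sym (*-identityʳ _))) (spanned-B⁺ (+ n) (0 , span-s []))
  gen (_ ∷ π) n = step (_ , span-s π) (gen π) n _
  linear : ∀ {P} → Span m P → Spanned (H (+ n) * P)
  linear (span-≈ eq σ) = spanned-≈ (*-congˡ eq) (linear σ)
  linear span-0        = spanned-≈ (≈-sym (zeroʳ _)) (0 , span-0)
  linear (span-+ σ σ′) = spanned-≈ (≈-sym (distribˡ _ _ _)) (spanned-+ (linear σ) (linear σ′))
  linear (span-* q σ)  = spanned-≈ (x∙yz≈y∙xz _ _ _) (spanned-* q (linear σ))
  linear (span-s π)    = gen π n

-- Newton's identity gives p_{1+k} as (1+k) h_{1+k} minus products of a lower power sum with some h,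
-- the coefficient of p_{1+k} itself being h_0 = 1.
spanned-p* : ∀ k {P} → Spanned P → Spanned (p[1+ k ] * P)
spanned-p* = <-rec _ λ
  { zero    rec {P} sp → spanned-≈ (≈-trans (*-congʳ (u-newton Sign.+ 0)) (unit P p[1+ 0 ])) (solved 0 sp)
  ; (suc k) rec {P} sp → spanned-≈ (≈-trans (+-congʳ (*-congʳ (≈-trans (u-newton Sign.+ (suc k)) (≈-trans (S.⊛-∑ q (u Sign.+) (suc k))
        (S.∑-last k (λ i → q i * u Sign.+ (suc k ℕ.∸ i)))))))
      (≈-trans (+-cong (distribʳ P _ _) (-‿cong (S.∑-*ʳ k P (λ i → q i * u Sign.+ (suc k ℕ.∸ i)))))
      (≈-trans (solveΛ 2 (λ a b → a :+ b :+ :- a := b) ≈-refl _ _)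
      (≈-trans (*-congʳ (*-congˡ {q (suc k)} (reflexive (≡.cong (u Sign.+) (ℕ.n∸n≡0 k))))) (unit P p[1+ suc k ])))))
    (spanned-+ (solved (suc k) sp) (spanned-neg (spanned-∑ k λ i i≤k →
      spanned-≈ (≈-trans (*-congʳ (≈-sym (*-identityˡ p[1+ i ]))) (≈-sym (*-assoc (q i) (u Sign.+ (suc k ℕ.∸ i)) P))) (rec (s≤s i≤k) (spanned-H* (suc k ℕ.∸ i) sp))))) }
  where
  q : ℕ → Λ
  q i = con 1ℚ * p[1+ i ]
  unit : ∀ P p → con 1ℚ * p * u Sign.+ 0 * P ≈ p * P
  unit P p = ≈-trans (*-congʳ (*-congˡ (u-0 Sign.+))) (solveΛ 2 (λ p P → K 1ℚ :* p :* K 1ℚ :* P := p :* P) ≈-refl p P)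
  solved : ∀ k {P} → Spanned P → Spanned (con (ℕ→ℚ (suc k)) * u Sign.+ (suc k) * P)
  solved k sp = spanned-≈ (≈-sym (*-assoc _ _ _)) (spanned-* _ (spanned-H* (suc k) sp))

s-spans : ∀ P → Spanned P
s-spans = Λ-ind Spanned spanned-≈ spanned-+ spanned-* spanned-p* (0 , span-s [])

-- The hypothesis removes the second summand of the fermionic relation, leaving only its scalar
-- right side.
V⁻-solve : ∀ r t Q → V Sign.- (ℤ.- (r ℤ.+ + 1)) Q ≈ con 0ℚ → V Sign.- (ℤ.- r) (B⁺ t Q) ≈ con (δℤ (ℤ.- r ℤ.+ t)) * Q
V⁻-solve r t Q eq = ≈-trans (≈-sym (+-identityʳ _)) (≈-trans (+-congˡ (≈-sym (≈-trans (V-cong Sign.+ (t ℤ.+ + 1)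
  (≈-trans (V-≡ Sign.- Q (ℤ-eq r)) eq)) (V-0 Sign.+ _)))) (V-adjoint-relation Sign.+ (ℤ.- r) t Q))
  where
  ℤ-eq : ∀ r → ℤ.- r ℤ.- + 1 ≡ ℤ.- (r ℤ.+ + 1)
  ℤ-eq = solve-∀

-- The adjoint of B_a moves past each factor, its index a growing by one each time; the scalar is 0
-- because a exceeds every part, and at 1 a negative index gives 0.
V⁻-kills : ∀ {l μ} → PartsAtMost l μ → ∀ a → l ℕ.< a → V Sign.- (ℤ.- + a) (B⁺s μ) ≈ con 0ℚ
V⁻-kills [] (suc a) l<a = V-1 Sign.- -[1+ a ]
V⁻-kills (_∷_ {r = k} {μ} k≤l π) a l<a = ≈-trans
  (V⁻-solve (+ a) (+ suc k) (B⁺s μ) (V⁻-kills π (a ℕ.+ 1) (ℕ.<-trans k<a (ℕ.m<m+n a (s≤s z≤n)))))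
  (≈-trans (*-congʳ (reflexive (≡.cong con (δ-neg k<a)))) (zeroˡ _))
  where
  k<a : suc k ℕ.< a
  k<a = ℕ.≤-<-trans k≤l l<a
  δ-neg : ∀ {k a} → k ℕ.< a → δℤ (ℤ.- + a ℤ.+ + k) ≡ 0ℚ
  δ-neg {k} {a} k<a with a ℕ.∸ k | ℕ.m<n⇒0<n∸m k<a | ≡.trans (ℤ.+-comm (ℤ.- + a) (+ k)) (≡.trans (ℤ.m-n≡m⊖n k a) (ℤ.⊖-< k<a))
  ... | suc n | _ | eq = ≡.cong δℤ eq

V⁻-undoes : ∀ {r μ} → PartsAtMost (suc r) μ → V Sign.- (ℤ.- + suc r) (B⁺ (+ suc r) (B⁺s μ)) ≈ B⁺s μ
V⁻-undoes {r} {μ} π = ≈-trans (V⁻-solve (+ suc r) (+ suc r) (B⁺s μ) (V⁻-kills π (suc r ℕ.+ 1) (ℕ.m<m+n (suc r) (s≤s z≤n))))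
  (≈-trans (*-congʳ (reflexive (≡.cong (con ∘ δℤ) (ℤ.+-inverseˡ (+ suc r))))) (*-identityˡ _))

⟪⟫-0ʳ : ∀ P → ⟪ P , con 0ℚ ⟫ ≡ 0ℚ
⟪⟫-0ʳ P = ε-cong (D-0 P)

s-normal : ∀ {m μ} → PartsAtMost m μ → ⟪ B⁺s μ , B⁺s μ ⟫ ≡ 1ℚ
s-normal []                   = ≡.refl
s-normal (_∷_ {r = r} {μ} _ π) = ≡.trans (V-adjoint (B⁺s μ) (+ suc r) _) (≡.trans (⟪⟫-cong {B⁺s μ} ≈-refl (V⁻-undoes π)) (s-normal π))

-- If the first parts differ, the adjoint belonging to the larger one kills the other side; if they
-- agree, `V⁻-undoes` strips both.
s-orthogonal : ∀ {l m λ′ μ} → PartsAtMost l λ′ → PartsAtMost m μ → λ′ ≢ μ → ⟪ B⁺s λ′ , B⁺s μ ⟫ ≡ 0ℚ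
s-orthogonal []       []       ≢ = contradiction ≡.refl ≢
s-orthogonal (_∷_ {r = r} {λ′} _ π) [] ≢ = ≡.trans (V-adjoint (B⁺s λ′) (+ suc r) (con 1ℚ))
  (≡.trans (⟪⟫-cong {B⁺s λ′} ≈-refl (V⁻-kills {0} [] (suc r) (s≤s z≤n))) (⟪⟫-0ʳ (B⁺s λ′)))
s-orthogonal [] (_∷_ {r = r} {μ} _ π) ≢ = ≡.trans (⟪⟫-sym (con 1ℚ) (B⁺ (+ suc r) (B⁺s μ))) (≡.trans (V-adjoint (B⁺s μ) (+ suc r) (con 1ℚ))
  (≡.trans (⟪⟫-cong {B⁺s μ} ≈-refl (V⁻-kills {0} [] (suc r) (s≤s z≤n))) (⟪⟫-0ʳ (B⁺s μ))))
s-orthogonal (_∷_ {r = a} {λ′} _ π) (_∷_ {r = t} {μ} _ π′) ≢ with ℕ.<-cmp a t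
... | tri< a<t _ _ = ≡.trans (⟪⟫-sym (B⁺s (suc a ∷ λ′)) (B⁺s (suc t ∷ μ))) (≡.trans (V-adjoint (B⁺s μ) (+ suc t) _)
  (≡.trans (⟪⟫-cong {B⁺s μ} ≈-refl (V⁻-kills {suc a} (ℕ.≤-refl ∷ π) (suc t) (s≤s a<t))) (⟪⟫-0ʳ (B⁺s μ))))
... | tri≈ _ ≡.refl _ = ≡.trans (V-adjoint (B⁺s λ′) (+ suc a) _) (≡.trans (⟪⟫-cong {B⁺s λ′} ≈-refl (V⁻-undoes π′)) (s-orthogonal π π′ (≢ ∘ ≡.cong (suc a ∷_))))
... | tri> _ _ t<a = ≡.trans (V-adjoint (B⁺s λ′) (+ suc a) _)
  (≡.trans (⟪⟫-cong {B⁺s λ′} ≈-refl (V⁻-kills {suc t} (ℕ.≤-refl ∷ π′) (suc a) (s≤s t<a))) (⟪⟫-0ʳ (B⁺s λ′)))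

-- Uniqueness of the Hall scalar product and of skewing

module _ {⟨_,_⟩ : Λ → Λ → ℚ} (hall : IsHallScalarProduct ⟨_,_⟩) where
  private module Hall = IsHallScalarProduct hall

  hall-0 : ∀ Q → ⟨ con 0ℚ , Q ⟩ ≡ 0ℚ
  hall-0 Q = ≡.trans (Hall.cong (≈-sym (zeroˡ (con 0ℚ))) ≈-refl) (≡.trans (Hall.homogeneous 0ℚ (con 0ℚ) Q) (ℚ.*-zeroˡ ⟨ con 0ℚ , Q ⟩))

  hall-s : ∀ {l m λ′ μ} → PartsAtMost l λ′ → PartsAtMost m μ → ⟨ B⁺s λ′ , B⁺s μ ⟩ ≡ ⟪ B⁺s λ′ , B⁺s μ ⟫
  hall-s {λ′ = λ′} {μ} π π′ with List.≡-dec ℕ._≟_ λ′ μ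
  ... | yes ≡.refl = ≡.trans (Hall.cong (≈-sym (s-B⁺s μ)) (≈-sym (s-B⁺s μ))) (≡.trans (Hall.s-normal μ (PartsAtMost⇒IsPartition π)) (≡.sym (s-normal π)))
  ... | no  ≢      = ≡.trans (Hall.cong (≈-sym (s-B⁺s λ′)) (≈-sym (s-B⁺s μ)))
    (≡.trans (Hall.s-orthogonal λ′ μ (PartsAtMost⇒IsPartition π) (PartsAtMost⇒IsPartition π′) ≢) (≡.sym (s-orthogonal π π′ ≢)))

  hall-span : ∀ {m P Q} → Span m P → (∀ {l μ} → PartsAtMost l μ → ⟨ B⁺s μ , Q ⟩ ≡ ⟪ B⁺s μ , Q ⟫) → ⟨ P , Q ⟩ ≡ ⟪ P , Q ⟫
  hall-span (span-≈ eq σ) gen = ≡.trans (Hall.cong (≈-sym eq) ≈-refl) (≡.trans (hall-span σ gen) (⟪⟫-cong eq ≈-refl))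
  hall-span {Q = Q} span-0 gen = ≡.trans (hall-0 Q) (≡.sym (ℚ.*-zeroˡ (ε Q)))
  hall-span {Q = Q} (span-+ {P} {P′} σ σ′) gen = ≡.trans (Hall.additive P P′ Q) (≡.cong₂ ℚ._+_ (hall-span σ gen) (hall-span σ′ gen))
  hall-span {Q = Q} (span-* q {P} σ) gen = ≡.trans (Hall.homogeneous q P Q) (≡.cong (q ℚ.*_) (hall-span σ gen))
  hall-span (span-s π)    gen = gen π

  -- Both arguments are expanded in Schur functions one after the other, with symmetry in between
  -- because linearity is given in the first argument.
  hall-⟪⟫ : ∀ P Q → ⟨ P , Q ⟩ ≡ ⟪ P , Q ⟫
  hall-⟪⟫ P Q = hall-span (proj₂ (s-spans P)) λ {_} {μ} π → ≡.trans (Hall.symmetric (B⁺s μ) Q)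
    (≡.trans (hall-span (proj₂ (s-spans Q)) (λ π′ → hall-s π′ π)) (⟪⟫-sym Q (B⁺s μ)))

  -- Both operators are adjoint to multiplication by P for the same form, and that form is
  -- nondegenerate.
  skewing-D : ∀ {_⊥ : Λ → Λ → Λ} → IsSkewing ⟨_,_⟩ _⊥ → ∀ P Q → (P ⊥) Q ≈ D P Q
  skewing-D {_⊥} skewing P Q = taylor λ G → begin
    ⟪ G , (P ⊥) Q ⟫     ≡⟨ ⟪⟫-sym G ((P ⊥) Q) ⟩
    ⟪ (P ⊥) Q , G ⟫     ≡⟨ hall-⟪⟫ ((P ⊥) Q) G ⟨
    ⟨ (P ⊥) Q , G ⟩     ≡⟨ skewing P Q G ⟩
    ⟨ Q , P * G ⟩       ≡⟨ hall-⟪⟫ Q (P * G) ⟩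
    ⟪ Q , P * G ⟫       ≡⟨ ⟪⟫-adjoint P Q G ⟩
    ⟪ D P Q , G ⟫       ≡⟨ ⟪⟫-sym (D P Q) G ⟩
    ⟪ G , D P Q ⟫       ∎
    where open ≡-Reasoning

-- Laurent polynomials

zipWith-minus-plus : ∀ {n} (ν μ μ′ : Vec ℤ n) → Vec.zipWith ℤ._-_ ν (Vec.zipWith ℤ._+_ μ μ′) ≡ Vec.zipWith ℤ._-_ (Vec.zipWith ℤ._-_ ν μ) μ′
zipWith-minus-plus []      []      []        = ≡.refl
zipWith-minus-plus (a ∷ ν) (b ∷ μ) (c ∷ μ′) = ≡.cong₂ _∷_ (eq a b c) (zipWith-minus-plus ν μ μ′)
  where
  eq : ∀ a b c → a ℤ.- (b ℤ.+ c) ≡ (a ℤ.- b) ℤ.- c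
  eq = solve-∀

zipWith-minus-0 : ∀ {n} (ν : Vec ℤ n) → Vec.zipWith ℤ._-_ ν (Vec.replicate n ℤ.0ℤ) ≡ ν
zipWith-minus-0 []      = ≡.refl
zipWith-minus-0 (a ∷ ν) = ≡.cong₂ _∷_ (ℤ.+-identityʳ a) (zipWith-minus-0 ν)

map-*-+ : ∀ {n} k (μ ν : Vec ℤ n) → Vec.map (k ℤ.*_) (Vec.zipWith ℤ._+_ μ ν) ≡ Vec.zipWith ℤ._+_ (Vec.map (k ℤ.*_) μ) (Vec.map (k ℤ.*_) ν)
map-*-+ k []      []      = ≡.refl
map-*-+ k (a ∷ μ) (b ∷ ν) = ≡.cong₂ _∷_ (ℤ.*-distribˡ-+ k a b) (map-*-+ k μ ν)

map-*-0 : ∀ {n} k → Vec.map (k ℤ.*_) (Vec.replicate n ℤ.0ℤ) ≡ Vec.replicate n ℤ.0ℤ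
map-*-0 {zero}  k = ≡.refl
map-*-0 {suc n} k = ≡.cong₂ _∷_ (ℤ.*-zeroʳ k) (map-*-0 k)

Λ-ψ-cong : ∀ k {P Q} → P ≈ Q → Λ-ψ[1+ k ] P ≈ Λ-ψ[1+ k ] Q
Λ-ψ-cong k ≈-refl           = ≈-refl
Λ-ψ-cong k (≈-sym eq)       = ≈-sym (Λ-ψ-cong k eq)
Λ-ψ-cong k (≈-trans eq eq′) = ≈-trans (Λ-ψ-cong k eq) (Λ-ψ-cong k eq′)
Λ-ψ-cong k (+-cong eq eq′)  = +-cong (Λ-ψ-cong k eq) (Λ-ψ-cong k eq′)
Λ-ψ-cong k (*-cong eq eq′)  = *-cong (Λ-ψ-cong k eq) (Λ-ψ-cong k eq′)
Λ-ψ-cong k (-‿cong eq)      = -‿cong (Λ-ψ-cong k eq)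
Λ-ψ-cong k (+-assoc P Q S)  = +-assoc _ _ _
Λ-ψ-cong k (+-comm P Q)     = +-comm _ _
Λ-ψ-cong k (+-identityˡ P)  = +-identityˡ _
Λ-ψ-cong k (-‿inverseˡ P)   = -‿inverseˡ _
Λ-ψ-cong k (*-assoc P Q S)  = *-assoc _ _ _
Λ-ψ-cong k (*-comm P Q)     = *-comm _ _
Λ-ψ-cong k (*-identityˡ P)  = *-identityˡ _
Λ-ψ-cong k (distribˡ P Q S) = distribˡ _ _ _
Λ-ψ-cong k (con-+ a b)      = con-+ a b
Λ-ψ-cong k (con-* a b)      = con-* a b

order-any : ∀ P → Order≥ 0 P
order-any (con q)  = order-con q
order-any p[1+ k ] = order-mono z≤n (order-p k)
order-any (P + Q)  = order-+ (order-any P) (order-any Q)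
order-any (P * Q)  = order-* {0} (order-any P) (order-any Q)
order-any (- P)    = order-neg (order-any P)

module LaurentRing (n : ℕ) where
  open Laurent n

  -- The test functions for the equality `_≃_`: additivity in the coefficient is what allows terms
  -- with equal exponents to be merged or cancelled.
  record Additive (g : Λ → Vec ℤ n → Λ) : Set where
    field
      cong : ∀ {c c′} μ → c ≈ c′ → g c μ ≈ g c′ μ
      add  : ∀ c c′ μ → g (c + c′) μ ≈ g c μ + g c′ μ

    zero′ : ∀ μ → g (con 0ℚ) μ ≈ con 0ℚ
    zero′ μ = begin
      g (con 0ℚ) μ                                                  ≈⟨ solveΛ 1 (λ x → x := x :+ x :+ :- x) ≈-refl (g (con 0ℚ) μ) ⟩
      g (con 0ℚ) μ + g (con 0ℚ) μ + - g (con 0ℚ) μ                  ≈⟨ +-congʳ (add (con 0ℚ) (con 0ℚ) μ) ⟨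
      g (con 0ℚ + con 0ℚ) μ + - g (con 0ℚ) μ                        ≈⟨ +-congʳ (cong μ (+-identityˡ _)) ⟩
      g (con 0ℚ) μ + - g (con 0ℚ) μ                                 ≈⟨ -‿inverseʳ _ ⟩
      con 0ℚ                                                        ∎
      where open ≈-Reasoning

    neg : ∀ c μ → g (- c) μ ≈ - g c μ
    neg c μ = begin
      g (- c) μ                         ≈⟨ solveΛ 2 (λ x y → x := x :+ y :+ :- y) ≈-refl (g (- c) μ) (g c μ) ⟩
      g (- c) μ + g c μ + - g c μ       ≈⟨ +-congʳ (add (- c) c μ) ⟨
      g (- c + c) μ + - g c μ           ≈⟨ +-congʳ (≈-trans (cong μ (-‿inverseˡ c)) (zero′ μ)) ⟩
      con 0ℚ + - g c μ                  ≈⟨ +-identityˡ _ ⟩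
      - g c μ                           ∎
      where open ≈-Reasoning

  sumTerms-cong : ∀ L {g g′} → (∀ c μ → g c μ ≈ g′ c μ) → sumTerms L g ≈ sumTerms L g′
  sumTerms-cong []            eq = ≈-refl
  sumTerms-cong ((c , μ) ∷ L) eq = +-cong (eq c μ) (sumTerms-cong L eq)

  sumTerms-++ : ∀ L M g → sumTerms (L ++ M) g ≈ sumTerms L g + sumTerms M g
  sumTerms-++ []            M g = ≈-sym (+-identityˡ _)
  sumTerms-++ ((c , μ) ∷ L) M g = ≈-trans (+-congˡ (sumTerms-++ L M g)) (≈-sym (+-assoc _ _ _))

  sumTerms-+ : ∀ L g g′ → sumTerms L (λ c μ → g c μ + g′ c μ) ≈ sumTerms L g + sumTerms L g′
  sumTerms-+ []            g g′ = ≈-sym (+-identityˡ _)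
  sumTerms-+ ((c , μ) ∷ L) g g′ = ≈-trans (+-congˡ (sumTerms-+ L g g′)) (interchange _ _ _ _)

  sumTerms-0 : ∀ L {g} → (∀ c μ → g c μ ≈ con 0ℚ) → sumTerms L g ≈ con 0ℚ
  sumTerms-0 []            eq = ≈-refl
  sumTerms-0 ((c , μ) ∷ L) eq = ≈-trans (+-cong (eq c μ) (sumTerms-0 L eq)) (+-identityˡ _)

  sumTerms-hom : ∀ L (φ : Λ → Λ) g → (∀ x y → φ (x + y) ≈ φ x + φ y) → φ (con 0ℚ) ≈ con 0ℚ →
    φ (sumTerms L g) ≈ sumTerms L λ c μ → φ (g c μ)
  sumTerms-hom []            φ g hom φ-0 = φ-0
  sumTerms-hom ((c , μ) ∷ L) φ g hom φ-0 = ≈-trans (hom _ _) (+-congˡ (sumTerms-hom L φ g hom φ-0))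

  sumTerms-*ˡ : ∀ L P g → sumTerms L (λ c μ → P * g c μ) ≈ P * sumTerms L g
  sumTerms-*ˡ L P g = ≈-sym (sumTerms-hom L (P *_) g (distribˡ P) (zeroʳ P))

  sumTerms-swap : ∀ L M (g : Λ → Vec ℤ n → Λ → Vec ℤ n → Λ) →
    sumTerms L (λ c μ → sumTerms M (g c μ)) ≈ sumTerms M λ d ν → sumTerms L λ c μ → g c μ d ν
  sumTerms-swap []            M g = ≈-sym (sumTerms-0 M λ _ _ → ≈-refl)
  sumTerms-swap ((c , μ) ∷ L) M g = ≈-trans (+-congˡ (sumTerms-swap L M g)) (≈-sym (sumTerms-+ M (g c μ) (λ d ν → sumTerms L λ c μ → g c μ d ν)))

  sumTerms-∑ : ∀ N L (g : ℕ → Λ → Vec ℤ n → Λ) → ∑ N (λ i → sumTerms L (g i)) ≈ sumTerms L λ c μ → ∑ N λ i → g i c μ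
  sumTerms-∑ zero    L g = ≈-refl
  sumTerms-∑ (suc N) L g = ≈-trans (+-congˡ (sumTerms-∑ N L (g ∘ suc))) (≈-sym (sumTerms-+ L (g 0) (λ c μ → ∑ N λ i → g (suc i) c μ)))

  sumTerms-map : ∀ (φ : Λ × Vec ℤ n → Λ × Vec ℤ n) L g → sumTerms (List.map φ L) g ≡ sumTerms L λ c μ → g (proj₁ (φ (c , μ))) (proj₂ (φ (c , μ)))
  sumTerms-map φ []      g = ≡.refl
  sumTerms-map φ (t ∷ L) g = ≡.cong (λ x → g (proj₁ (φ t)) (proj₂ (φ t)) + x) (sumTerms-map φ L g)

  sumTerms-* : ∀ L M g → sumTerms (L *ᴸ M) g ≈ sumTerms L λ c μ → sumTerms M λ d ν → g (c * d) (Vec.zipWith ℤ._+_ μ ν)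
  sumTerms-* []            M g = ≈-refl
  sumTerms-* ((c , μ) ∷ L) M g = ≈-trans (sumTerms-++ (List.map _ M) (L *ᴸ M) g) (+-cong (reflexive (sumTerms-map _ M g)) (sumTerms-* L M g))

  sumTerms-neg : ∀ L g → Additive g → sumTerms (-ᴸ L) g ≈ - sumTerms L g
  sumTerms-neg []            g ag = ≈-sym S.-0#≈0#
  sumTerms-neg ((c , μ) ∷ L) g ag = ≈-trans (+-cong (Additive.neg ag c μ) (sumTerms-neg L g ag)) (≈-sym (neg-+ _ _))

  -- The equality on which the ring structure is built: it implies equality of coefficients, and is
  -- what makes an expression that is linear in the coefficients well defined.
  infix 4 _≃_
  record _≃_ (L M : LaurentPolynomial) : Set where
    constructor equal
    field on : ∀ g → Additive g → sumTerms L g ≈ sumTerms M g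
  open _≃_ public

  -- Multiplication by a term turns test functions into test functions; with `left-additive` this
  -- makes the product respect `_≃_`.
  right-additive : ∀ {g} → Additive g → ∀ c μ → Additive (λ d ν → g (c * d) (Vec.zipWith ℤ._+_ μ ν))
  right-additive ag c μ = record
    { cong = λ ν eq → cong _ (*-congˡ eq) ; add = λ d d′ ν → ≈-trans (cong _ (distribˡ c d d′)) (add _ _ _) }
    where open Additive ag

  left-additive : ∀ {g} → Additive g → ∀ M → Additive (λ c μ → sumTerms M λ d ν → g (c * d) (Vec.zipWith ℤ._+_ μ ν))
  left-additive ag M = record
    { cong = λ μ eq → sumTerms-cong M λ d ν → cong _ (*-congʳ eq)
    ; add = λ c c′ μ → ≈-trans (sumTerms-cong M λ d ν → ≈-trans (cong _ (distribʳ d c c′)) (add _ _ _)) (sumTerms-+ M _ _) }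
    where open Additive ag

  isCommutativeRing : IsCommutativeRing _≃_ _+ᴸ_ _*ᴸ_ -ᴸ_ [] 1ᴸ
  isCommutativeRing = record
    { isRing = record
      { +-isAbelianGroup = record
        { isGroup = record
          { isMonoid = record
            { isSemigroup = record
              { isMagma = record
                { isEquivalence = record
                  { refl = equal λ g ag → ≈-refl ; sym = λ eq → equal λ g ag → ≈-sym (on eq g ag)
                  ; trans = λ eq eq′ → equal λ g ag → ≈-trans (on eq g ag) (on eq′ g ag) }
                ; ∙-cong = λ {L} {L′} {M} {M′} eq eq′ → equal λ g ag → ≈-trans (sumTerms-++ L M g)
                    (≈-trans (+-cong (on eq g ag) (on eq′ g ag)) (≈-sym (sumTerms-++ L′ M′ g))) }
              ; assoc = λ L M N → equal λ g ag → reflexive (≡.cong (λ L → sumTerms L g) (List.++-assoc L M N)) }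
            ; identity = (λ L → equal λ g ag → ≈-refl) , λ L → equal λ g ag → reflexive (≡.cong (λ L → sumTerms L g) (List.++-identityʳ L)) }
          ; inverse = (λ L → equal λ g ag → ≈-trans (sumTerms-++ (-ᴸ L) L g) (≈-trans (+-congʳ (sumTerms-neg L g ag)) (-‿inverseˡ _)))
              , λ L → equal λ g ag → ≈-trans (sumTerms-++ L (-ᴸ L) g) (≈-trans (+-congˡ (sumTerms-neg L g ag)) (-‿inverseʳ _))
          ; ⁻¹-cong = λ {L} {M} eq → equal λ g ag → ≈-trans (sumTerms-neg L g ag) (≈-trans (-‿cong (on eq g ag)) (≈-sym (sumTerms-neg M g ag))) }
        ; comm = λ L M → equal λ g ag → ≈-trans (sumTerms-++ L M g) (≈-trans (+-comm _ _) (≈-sym (sumTerms-++ M L g))) }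
      ; *-cong = λ {L} {L′} {M} {M′} eq eq′ → equal λ g ag → ≈-trans (sumTerms-* L M g)
          (≈-trans (sumTerms-cong L λ c μ → on eq′ _ (right-additive ag c μ))
          (≈-trans (on eq _ (left-additive ag M′)) (≈-sym (sumTerms-* L′ M′ g))))
      ; *-assoc = λ L M N → equal λ g ag → ≈-trans (sumTerms-* (L *ᴸ M) N g) (≈-trans (sumTerms-* L M _)
          (≈-sym (≈-trans (sumTerms-* L (M *ᴸ N) g) (sumTerms-cong L λ c μ → ≈-trans (sumTerms-* M N _)
            (sumTerms-cong M λ d ν → sumTerms-cong N λ e ξ → ≈-trans (Additive.cong ag _ (≈-sym (*-assoc c d e)))
              (reflexive (≡.cong (g (c * d * e)) (≡.sym (Vec.zipWith-assoc ℤ.+-assoc μ ν ξ)))))))))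
      ; *-identity = identityˡ , λ L → equal λ g ag → ≈-trans (on (comm L 1ᴸ) g ag) (on (identityˡ L) g ag)
      ; distrib = distˡ , λ L M N → equal λ g ag → ≈-trans (on (comm (M +ᴸ N) L) g ag) (≈-trans (on (distˡ L M N) g ag)
          (≈-trans (sumTerms-++ (L *ᴸ M) (L *ᴸ N) g) (≈-trans (+-cong (on (comm L M) g ag) (on (comm L N) g ag))
            (≈-sym (sumTerms-++ (M *ᴸ L) (N *ᴸ L) g))))) }
    ; *-comm = comm }
    where
    comm : ∀ L M → L *ᴸ M ≃ M *ᴸ L
    comm L M = equal λ g ag → ≈-trans (sumTerms-* L M g) (≈-trans (sumTerms-swap L M _)
      (≈-trans (sumTerms-cong M λ d ν → sumTerms-cong L λ c μ → ≈-trans (Additive.cong ag _ (*-comm c d))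
        (reflexive (≡.cong (g (d * c)) (Vec.zipWith-comm ℤ.+-comm μ ν)))) (≈-sym (sumTerms-* M L g))))
    identityˡ : ∀ L → 1ᴸ *ᴸ L ≃ L
    identityˡ L = equal λ g ag → ≈-trans (sumTerms-* 1ᴸ L g) (≈-trans (+-identityʳ _)
      (sumTerms-cong L λ c μ → ≈-trans (Additive.cong ag _ (*-identityˡ c)) (reflexive (≡.cong (g c) (Vec.zipWith-identityˡ ℤ.+-identityˡ μ)))))
    distˡ : ∀ L M N → L *ᴸ (M +ᴸ N) ≃ L *ᴸ M +ᴸ L *ᴸ N
    distˡ L M N = equal λ g ag → ≈-trans (sumTerms-* L (M +ᴸ N) g) (≈-trans
      (≈-trans (sumTerms-cong L λ c μ → sumTerms-++ M N _) (sumTerms-+ L _ _))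
      (≈-sym (≈-trans (sumTerms-++ (L *ᴸ M) (L *ᴸ N) g) (+-cong (sumTerms-* L M g) (sumTerms-* L N g)))))

  laws : Laws plethysticRing
  laws = record
    { _∼_ = _≃_ ; isCommutativeRing = isCommutativeRing
    ; con-1 = equal λ g ag → ≈-refl
    ; con-+ = λ a b → equal λ g ag → ≈-trans (+-congʳ (≈-trans (Additive.cong ag _ (con-+ a b)) (Additive.add ag _ _ _))) (+-assoc _ _ _)
    ; con-* = λ a b → equal λ g ag → +-congʳ (≈-trans (Additive.cong ag _ (con-* a b))
        (reflexive (≡.cong (g (con a * con b)) (≡.sym (Vec.zipWith-replicate ℤ._+_ ℤ.0ℤ ℤ.0ℤ))))) }

module Skewed (n : ℕ) where
  open Laurent n
  open LaurentRing n
  module SL = Series plethysticRing laws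

  sumTerms-sum≤ : ∀ N (a : ℕ → LaurentPolynomial) g → sumTerms (SL.sum≤ N a) g ≈ ∑ N λ d → sumTerms (a d) g
  sumTerms-sum≤ zero    a g = ≈-trans (sumTerms-++ (a 0) [] g) (+-identityʳ _)
  sumTerms-sum≤ (suc N) a g = ≈-trans (sumTerms-++ (a 0) (SL.sum≤ N (a ∘ suc)) g) (+-congˡ (sumTerms-sum≤ N (a ∘ suc) g))

  ∂ᴸ : ℕ → LaurentPolynomial → LaurentPolynomial
  ∂ᴸ k = List.map (map₁ (∂ k))

  ψ : ℕ → LaurentPolynomial → LaurentPolynomial
  ψ = SL.ψ[1+_]

  sumTerms-∂ᴸ : ∀ k L g → sumTerms (∂ᴸ k L) g ≡ sumTerms L λ c μ → g (∂ k c) μ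
  sumTerms-∂ᴸ k = sumTerms-map (map₁ (∂ k))

  ∂-additive : ∀ k {g} → Additive g → Additive (λ c μ → g (∂ k c) μ)
  ∂-additive k ag = record { cong = λ μ eq → cong μ (∂-cong k eq) ; add = λ c c′ μ → add (∂ k c) (∂ k c′) μ }
    where open Additive ag

  ∂ᴸ-cong : ∀ k {L M} → L ≃ M → ∂ᴸ k L ≃ ∂ᴸ k M
  ∂ᴸ-cong k {L} {M} eq = equal λ g ag → ≈-trans (reflexive (sumTerms-∂ᴸ k L g)) (≈-trans (on eq _ (∂-additive k ag)) (reflexive (≡.sym (sumTerms-∂ᴸ k M g))))

  ∂ᴸ-* : ∀ k L M → ∂ᴸ k (L *ᴸ M) ≃ ∂ᴸ k L *ᴸ M +ᴸ L *ᴸ ∂ᴸ k M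
  ∂ᴸ-* k L M = equal λ g ag → begin
    sumTerms (∂ᴸ k (L *ᴸ M)) g
      ≡⟨ sumTerms-∂ᴸ k (L *ᴸ M) g ⟩
    sumTerms (L *ᴸ M) (λ c μ → g (∂ k c) μ)
      ≈⟨ sumTerms-* L M _ ⟩
    sumTerms L (λ c μ → sumTerms M λ d ν → g (∂ k c * d + c * ∂ k d) (Vec.zipWith ℤ._+_ μ ν))
      ≈⟨ sumTerms-cong L (λ c μ → ≈-trans (sumTerms-cong M λ d ν → Additive.add ag _ _ _) (sumTerms-+ M _ _)) ⟩
    sumTerms L (λ c μ → sumTerms M (λ d ν → g (∂ k c * d) (Vec.zipWith ℤ._+_ μ ν)) + sumTerms M (λ d ν → g (c * ∂ k d) (Vec.zipWith ℤ._+_ μ ν)))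
      ≈⟨ sumTerms-+ L _ _ ⟩
    sumTerms L (λ c μ → sumTerms M (λ d ν → g (∂ k c * d) (Vec.zipWith ℤ._+_ μ ν))) + sumTerms L (λ c μ → sumTerms M (λ d ν → g (c * ∂ k d) (Vec.zipWith ℤ._+_ μ ν)))
      ≈⟨ +-cong (≈-trans (sumTerms-* (∂ᴸ k L) M g) (reflexive (sumTerms-∂ᴸ k L _)))
           (≈-trans (sumTerms-* L (∂ᴸ k M) g) (sumTerms-cong L λ c μ → reflexive (sumTerms-∂ᴸ k M _))) ⟨
    sumTerms (∂ᴸ k L *ᴸ M) g + sumTerms (L *ᴸ ∂ᴸ k M) g
      ≈⟨ sumTerms-++ (∂ᴸ k L *ᴸ M) (L *ᴸ ∂ᴸ k M) g ⟨
    sumTerms (∂ᴸ k L *ᴸ M +ᴸ L *ᴸ ∂ᴸ k M) g ∎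
    where open ≈-Reasoning

  ∂ᴸ-isDerivation : ∀ k → SL.IsDerivation (λ _ → ∂ᴸ k)
  ∂ᴸ-isDerivation k = record
    { δ-cong = λ _ → ∂ᴸ-cong k
    ; δ-+ = λ _ L M → SL.reflexive (List.map-++ (map₁ (∂ k)) L M)
    ; δ-* = λ _ _ → ∂ᴸ-* k
    ; δ-con* = λ _ q L → SL.trans (∂ᴸ-* k (SL.con q) L) (equal λ g ag → ≈-trans (sumTerms-++ (∂ᴸ k (SL.con q) *ᴸ L) _ g)
        (≈-trans (+-congʳ (≈-trans (sumTerms-* (∂ᴸ k (SL.con q)) L g) (≈-trans (+-identityʳ _)
          (sumTerms-0 L λ c μ → ≈-trans (Additive.cong ag _ (zeroˡ c)) (Additive.zero′ ag _))))) (+-identityˡ _)))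
    ; δ-1 = equal λ g ag → ≈-trans (+-identityʳ _) (Additive.zero′ ag _)
    ; δ-0 = λ _ → SL.refl }

  Scalar : LaurentPolynomial → Set
  Scalar = All λ (c , _) → ∃ λ q → c ≈ con q

  scalar-∂ : ∀ k {L} → Scalar L → ∂ᴸ k L ≃ []
  scalar-∂ k sc = equal λ g ag → vanish g ag sc
    where
    vanish : ∀ g → Additive g → ∀ {L} → Scalar L → sumTerms (∂ᴸ k L) g ≈ con 0ℚ
    vanish g ag []                = ≈-refl
    vanish g ag ((q , eq) ∷ sc) = ≈-trans (+-cong (≈-trans (Additive.cong ag _ (∂-cong k eq)) (Additive.zero′ ag _)) (vanish g ag sc)) (+-identityˡ _)

  scalar-++ : ∀ {L M} → Scalar L → Scalar M → Scalar (L ++ M)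
  scalar-++ = All.++⁺

  scalar-neg : ∀ {L} → Scalar L → Scalar (-ᴸ L)
  scalar-neg sc = All.map⁺ (All.map (λ (q , eq) → ℚ.- q , ≈-trans (-‿cong eq) (≈-sym (con-neg q))) sc)

  scalar-ψ : ∀ k {L} → Scalar L → Scalar (ψ k L)
  scalar-ψ k sc = All.map⁺ (All.map (λ (q , eq) → q , Λ-ψ-cong k eq) sc)

  ψ-* : ∀ k L M → ψ k (L *ᴸ M) ≃ ψ k L *ᴸ ψ k M
  ψ-* k L M = equal λ g ag → begin
    sumTerms (ψ k (L *ᴸ M)) g
      ≡⟨ sumTerms-map _ (L *ᴸ M) g ⟩
    sumTerms (L *ᴸ M) (λ c μ → g (Λ-ψ[1+ k ] c) (Vec.map (+ suc k ℤ.*_) μ))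
      ≈⟨ sumTerms-* L M _ ⟩
    sumTerms L (λ c μ → sumTerms M λ d ν → g (Λ-ψ[1+ k ] c * Λ-ψ[1+ k ] d) (Vec.map (+ suc k ℤ.*_) (Vec.zipWith ℤ._+_ μ ν)))
      ≈⟨ sumTerms-cong L (λ c μ → ≈-trans (sumTerms-cong M λ d ν → reflexive (≡.cong (g _) (map-*-+ (+ suc k) μ ν))) (reflexive (≡.sym (sumTerms-map _ M _)))) ⟩
    sumTerms L (λ c μ → sumTerms (ψ k M) λ d ν → g (Λ-ψ[1+ k ] c * d) (Vec.zipWith ℤ._+_ (Vec.map (+ suc k ℤ.*_) μ) ν))
      ≡⟨ sumTerms-map _ L _ ⟨
    sumTerms (ψ k L) (λ c μ → sumTerms (ψ k M) λ d ν → g (c * d) (Vec.zipWith ℤ._+_ μ ν))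
      ≈⟨ sumTerms-* (ψ k L) (ψ k M) g ⟨
    sumTerms (ψ k L *ᴸ ψ k M) g ∎
    where open ≈-Reasoning

  ψ-neg : ∀ k L → ψ k (-ᴸ L) ≃ -ᴸ ψ k L
  ψ-neg k L = SL.reflexive (≡.trans (≡.sym (List.map-∘ L)) (List.map-∘ L))

  ψ-X : ∀ k → ψ k X ≃ Laurent.const n p[1+ k ]
  ψ-X k = SL.reflexive (≡.cong₂ (λ p μ → (p , μ) ∷ []) (≡.cong p[1+_] (ℕ.*-identityʳ k)) (map-*-0 (+ suc k)))

  -- A is Y X for a Y without X.
  record _IsTimesX_ (A Y : LaurentPolynomial) : Set where
    field
      ψ-A    : ∀ k → ψ k A ≃ ψ k Y *ᴸ Laurent.const n p[1+ k ]
      scalar : Scalar Y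

  *X : ∀ {Y} → Scalar Y → (Y *ᴸ X) IsTimesX Y
  *X {Y} sc = record { ψ-A = λ k → SL.trans (ψ-* k Y X) (SL.*-congˡ {ψ k Y} (ψ-X k)) ; scalar = sc }

  -*X : ∀ {Y} → Scalar Y → (-ᴸ (Y *ᴸ X)) IsTimesX (-ᴸ Y)
  -*X {Y} sc = record
    { ψ-A = λ k → SL.trans (ψ-neg k (Y *ᴸ X)) (SL.trans (SL.-‿cong (_IsTimesX_.ψ-A (*X sc) k))
        (SL.trans (SL.-‿distribˡ-* (ψ k Y) (Laurent.const n p[1+ k ])) (SL.*-congʳ {Laurent.const n p[1+ k ]} (SL.sym (ψ-neg k Y)))))
    ; scalar = scalar-neg sc }

  module TimesX {A Y} (A=YX : A IsTimesX Y) where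
    open _IsTimesX_ A=YX

    -- Since p_j[YX] = p_j[Y] p_j, a single term of log Ω[YX] involves p_{1+k}, and its derivative
    -- is p_{1+k}[Y].
    ∂ᴸ-Ω : ∀ k d → ∂ᴸ k (Ω A d) ≃ ψ k Y *ᴸ SL.shift (suc k) (Ω A) d
    ∂ᴸ-Ω k = SL.Ω-single (∂ᴸ-isDerivation k) k A
      (λ j k≢j → SL.trans (step j) (SL.trans (SL.*-congˡ {SL.con (+ 1 ℚ./ suc j)} (SL.trans
        (SL.*-congˡ {ψ j Y} (SL.trans (SL.reflexive (≡.cong SL.con (kron-≢ k≢j))) SL.con-0)) (SL.zeroʳ (ψ j Y))))
        (SL.zeroʳ (SL.con (+ 1 ℚ./ suc j)))))
      (SL.trans (step k) (SL.trans (SL.*-congˡ {SL.con (+ 1 ℚ./ suc k)} (SL.trans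
        (SL.*-congˡ {ψ k Y} (SL.reflexive (≡.cong SL.con (kron-≡ k)))) (SL.*-comm (ψ k Y) (SL.con (ℕ→ℚ (suc k))))))
        (SL.1/suc-cancel k (ψ k Y))))
      where
      step : ∀ j → ∂ᴸ k (SL.logΩ A (suc j)) ≃ SL.con (+ 1 ℚ./ suc j) *ᴸ (ψ j Y *ᴸ SL.con (kron k j))
      step j = SL.trans (SL.IsDerivation.δ-con* (∂ᴸ-isDerivation k) 0 (+ 1 ℚ./ suc j) (ψ j A)) (SL.*-congˡ {SL.con (+ 1 ℚ./ suc j)} (SL.trans (∂ᴸ-cong k (ψ-A j))
        (SL.trans (∂ᴸ-* k (ψ j Y) (Laurent.const n p[1+ j ])) (SL.trans
          (SL.+-congʳ {ψ j Y *ᴸ SL.con (kron k j)} (SL.trans (SL.*-congʳ {Laurent.const n p[1+ j ]} (scalar-∂ k (scalar-ψ j scalar))) (SL.zeroˡ (Laurent.const n p[1+ j ])))) (SL.+-identityˡ _)))))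

    -- Asked only of some representative M, because a list may contain terms of low order that
    -- cancel one another.
    OrderL : ℕ → LaurentPolynomial → Set
    OrderL d L = ∃ λ M → L ≃ M × All (λ (c , _) → Order≥ d c) M

    orderL-* : ∀ {i j L M} → All (λ (c , _) → Order≥ i c) L → All (λ (c , _) → Order≥ j c) M → All (λ (c , _) → Order≥ (i ℕ.+ j) c) (L *ᴸ M)
    orderL-* []      os′ = []
    orderL-* (o ∷ os) os′ = All.++⁺ (All.map⁺ (All.map (order-* o) os′)) (orderL-* os os′)

    Ω-order : ∀ d → OrderL d (Ω A d)
    Ω-order = SL.Ω-filtered OrderL (λ eq (M , eq′ , o) → M , SL.trans (SL.sym eq) eq′ , o)
      (λ (M , eq , o) (M′ , eq′ , o′) → M ++ M′ , SL.+-cong eq eq′ , All.++⁺ o o′)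
      (λ (M , eq , o) (M′ , eq′ , o′) → M *ᴸ M′ , SL.*-cong eq eq′ , orderL-* o o′)
      (λ q → SL.con q , SL.refl , (order-con q ∷ [])) A
      (λ k → ψ k Y *ᴸ Laurent.const n p[1+ k ] , ψ-A k , orderL-* {0} (All.universal (λ (c , _) → order-any c) (ψ k Y)) (order-p k ∷ []))

    Ω-kills : ∀ d P → degree P ℕ.< d → ∀ {g : Λ → Vec ℤ n → Λ} → (∀ μ → g (con 0ℚ) μ ≈ con 0ℚ) → Additive (λ c μ → g (D c P) μ) →
      (∀ {c c′} μ → c ≈ c′ → g c μ ≈ g c′ μ) → sumTerms (Ω A d) (λ c μ → g (D c P) μ) ≈ con 0ℚ
    Ω-kills d P deg<d {g} g-0 ag g-cong with Ω-order d
    ... | M , eq , o = ≈-trans (on eq _ ag) (vanish o)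
      where
      vanish : ∀ {M} → All (λ (c , _) → Order≥ d c) M → sumTerms M (λ c μ → g (D c P) μ) ≈ con 0ℚ
      vanish []      = ≈-refl
      vanish (_∷_ {c , μ} o os) = ≈-trans (+-cong (≈-trans (g-cong μ (order-kills o (low-degree P) deg<d)) (g-0 μ)) (vanish os)) (+-identityˡ _)

-- The operators Φ Ω[YX]^⊥

module Operators (_⊥ : Λ → Λ → Λ) (⊥-D : ∀ P Q → (P ⊥) Q ≈ D P Q) where
  open Bernstein _⊥

  -- Φ is the series by which one multiplies after skewing: Ω[zX] for Bernstein's operators, and
  -- Ω[-f[Z]] Ω[ZX] for the right side of the identity.
  module Operator {n : ℕ} {A Y : Laurent.LaurentPolynomial n} (A=YX : Skewed._IsTimesX_ n A Y) (Φ : Laurent.LaurentSeries n) where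
    open Laurent n
    open LaurentRing n
    open Skewed n
    open TimesX A=YX
    open _IsTimesX_ A=YX

    infixl 6 _⊝_
    _⊝_ : Vec ℤ n → Vec ℤ n → Vec ℤ n
    _⊝_ = Vec.zipWith ℤ._-_

    G : ℕ → Λ → Vec ℤ n → Λ
    G d P ν = sumTerms (Ω A d) λ c μ → D c P * Φ (ν ⊝ μ)

    G-additive : ∀ P ν → Additive (λ c μ → D c P * Φ (ν ⊝ μ))
    G-additive P ν = record { cong = λ μ eq → *-congʳ (D-congˡ eq P) ; add = λ c c′ μ → distribʳ _ _ _ }

    W : Λ → Vec ℤ n → Λ
    W P = Ω⟨ A ⟩⊥ᴸ P ⊙ Φ

    W≤ : ℕ → Λ → Vec ℤ n → Λ
    W≤ N P ν = ∑ N λ d → G d P ν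

    abstract
      W-W≤ : ∀ {N} P ν → degree P ℕ.≤ N → W P ν ≈ W≤ N P ν
      W-W≤ {N} P ν deg≤N = ≈-trans (sumTerms-sum≤ (degree P) (λ d → skew (Ω A d) P) _)
        (≈-trans (S.∑-cong (degree P) λ d _ → ≈-trans (reflexive (sumTerms-map (map₁ λ c → (c ⊥) P) (Ω A d) _))
          (sumTerms-cong (Ω A d) λ c μ → *-congʳ (⊥-D c P)))
        (≈-sym (S.∑-extend (λ d → G d P ν) deg≤N λ d deg<d → Ω-kills d P deg<d {λ x μ → x * Φ (ν ⊝ μ)} (λ μ → zeroˡ _) (G-additive P ν) (λ μ eq → *-congʳ eq))))

    W-cong : ∀ {P Q} → P ≈ Q → ∀ ν → W P ν ≈ W Q ν
    W-cong {P} {Q} eq ν = ≈-trans (W-W≤ P ν (ℕ.m≤m⊔n (degree P) (degree Q))) (≈-trans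
      (S.∑-cong (degree P ℕ.⊔ degree Q) λ d _ → sumTerms-cong (Ω A d) λ c μ → *-congʳ (D-congʳ c eq)) (≈-sym (W-W≤ Q ν (ℕ.m≤n⊔m (degree P) (degree Q)))))

    W-+ : ∀ P Q ν → W (P + Q) ν ≈ W P ν + W Q ν
    W-+ P Q ν = ≈-trans (W-W≤ (P + Q) ν ℕ.≤-refl) (≈-trans (S.∑-cong (degree P ℕ.⊔ degree Q) λ d _ →
        ≈-trans (sumTerms-cong (Ω A d) λ c μ → ≈-trans (*-congʳ (D-+ c P Q)) (distribʳ _ _ _)) (sumTerms-+ (Ω A d) _ _))
      (≈-trans (S.∑-+ (degree P ℕ.⊔ degree Q) (λ d → G d P ν) (λ d → G d Q ν))
        (+-cong (≈-sym (W-W≤ P ν (ℕ.m≤m⊔n (degree P) (degree Q)))) (≈-sym (W-W≤ Q ν (ℕ.m≤n⊔m (degree P) (degree Q)))))))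

    W-con* : ∀ q P ν → W (con q * P) ν ≈ con q * W P ν
    W-con* q P ν = ≈-trans (W-W≤ (con q * P) ν ℕ.≤-refl) (≈-trans (S.∑-cong (degree P) λ d _ →
        ≈-trans (sumTerms-cong (Ω A d) λ c μ → ≈-trans (*-congʳ (D-con* c q P)) (*-assoc _ _ _)) (sumTerms-*ˡ (Ω A d) (con q) _))
      (≈-trans (S.∑-*ˡ (degree P) (con q) (λ d → G d P ν)) (*-congˡ (≈-sym (W-W≤ P ν ℕ.≤-refl)))))

    W-1 : ∀ ν → W (con 1ℚ) ν ≈ Φ ν
    W-1 ν = ≈-trans (W-W≤ {0} (con 1ℚ) ν z≤n) (≈-trans (on (SL.Ω-0 A) _ (G-additive (con 1ℚ) ν))
      (≈-trans (+-identityʳ _) (≈-trans (*-congʳ (*-identityˡ _)) (≈-trans (*-identityˡ _) (reflexive (≡.cong Φ (zipWith-minus-0 ν)))))))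

    -- Ω[YX]^⊥ is the substitution of X + Y for X, so it sends p_{1+k} to p_{1+k} + p_{1+k}[Y]; the
    -- second summand shifts the exponent that is read.
    W-p* : ∀ k P ν → W (p[1+ k ] * P) ν ≈ p[1+ k ] * W P ν + sumTerms (ψ k Y) λ c μ → c * W P (ν ⊝ μ)
    W-p* k P ν = begin
      W (p[1+ k ] * P) ν
        ≈⟨ W-W≤ {N} (p[1+ k ] * P) ν ℕ.≤-refl ⟩
      ∑ N (λ d → G d (p[1+ k ] * P) ν)
        ≈⟨ S.∑-cong N (λ d _ → split d) ⟩
      ∑ N (λ d → p[1+ k ] * G d P ν + T d (SL.shift (suc k) (Ω A) d))
        ≈⟨ S.∑-+ N (λ d → p[1+ k ] * G d P ν) (λ d → T d (SL.shift (suc k) (Ω A) d)) ⟩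
      ∑ N (λ d → p[1+ k ] * G d P ν) + ∑ N (λ d → T d (SL.shift (suc k) (Ω A) d))
        ≈⟨ +-cong (≈-trans (S.∑-*ˡ N p[1+ k ] (λ d → G d P ν)) (*-congˡ (≈-sym (W-W≤ P ν (ℕ.m≤n+m (degree P) (suc k))))))
             (S.∑-delay [] (suc k) (degree P) T (Ω A) (λ d → sumTerms-0 (ψ k Y) λ c μ → zeroʳ c)) ⟩
      p[1+ k ] * W P ν + ∑ (degree P) (λ d → T d (Ω A d))
        ≈⟨ +-congˡ (sumTerms-∑ (degree P) (ψ k Y) (λ d c μ → c * G d P (ν ⊝ μ))) ⟩
      p[1+ k ] * W P ν + sumTerms (ψ k Y) (λ c μ → ∑ (degree P) λ d → c * G d P (ν ⊝ μ))
        ≈⟨ +-congˡ (sumTerms-cong (ψ k Y) λ c μ → ≈-trans (S.∑-*ˡ (degree P) c (λ d → G d P (ν ⊝ μ))) (*-congˡ (≈-sym (W-W≤ P (ν ⊝ μ) ℕ.≤-refl)))) ⟩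
      p[1+ k ] * W P ν + sumTerms (ψ k Y) (λ c μ → c * W P (ν ⊝ μ)) ∎
      where
      open ≈-Reasoning
      N = suc k ℕ.+ degree P
      T : ℕ → LaurentPolynomial → Λ
      T _ L = sumTerms (ψ k Y) λ c μ → c * sumTerms L λ d ξ → D d P * Φ ((ν ⊝ μ) ⊝ ξ)
      pull : ∀ L → ∀ {M} → Scalar M → sumTerms M (λ c μ → sumTerms L λ d ξ → D (c * d) P * Φ (ν ⊝ Vec.zipWith ℤ._+_ μ ξ)) ≈
        sumTerms M (λ c μ → c * sumTerms L λ d ξ → D d P * Φ ((ν ⊝ μ) ⊝ ξ))
      pull L []                       = ≈-refl
      pull L (_∷_ {c , μ} (q , eq) sc) = +-cong (≈-trans (sumTerms-cong L λ d ξ → ≈-trans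
          (*-cong (≈-trans (D-congˡ eq (D d P)) (*-congʳ (≈-sym eq))) (reflexive (≡.cong Φ (zipWith-minus-plus ν μ ξ)))) (*-assoc _ _ _))
        (sumTerms-*ˡ L c _)) (pull L sc)
      split : ∀ d → G d (p[1+ k ] * P) ν ≈ p[1+ k ] * G d P ν + T d (SL.shift (suc k) (Ω A) d)
      split d = ≈-trans (sumTerms-cong (Ω A d) λ c μ → ≈-trans (*-congʳ (D-p* c k P)) (≈-trans (distribʳ _ _ _) (+-congʳ (*-assoc _ _ _))))
        (≈-trans (sumTerms-+ (Ω A d) _ _) (+-cong (sumTerms-*ˡ (Ω A d) p[1+ k ] _)
          (≈-trans (reflexive (≡.sym (sumTerms-∂ᴸ k (Ω A d) _))) (≈-trans (on (∂ᴸ-Ω k d) _ (G-additive P ν))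
            (≈-trans (sumTerms-* (ψ k Y) (SL.shift (suc k) (Ω A) d) _) (pull (SL.shift (suc k) (Ω A) d) (scalar-ψ k scalar)))))))


-- The local function of toLaurentSeries cannot be named. Here with-abstraction turns its
-- arguments into distinct variables, so that unification finds it.
mutual
  go : ∀ N (F₀ : Vec ℕ N → Λ) {m} → (Vec ℕ m → Λ) → Vec ℤ m → Λ
  go = _

  find-go : ∀ m (F : ℕ → Vec ℕ m → Λ) a ν →
    Laurent.toLaurentSeries (suc m) (λ v → F (Vec.head v) (Vec.tail v)) (+ a ∷ ν) ≡
    Laurent.toLaurentSeries (suc m) (λ v → F (Vec.head v) (Vec.tail v)) (+ a ∷ ν)
  find-go m F a ν with suc m | (λ (v : Vec ℕ (suc m)) → F (Vec.head v) (Vec.tail v)) | F a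
  ... | N | F₀ | G = ≡.refl {x = go N F₀ {m} G ν}

-- The coefficients of Ω[ZX]

data Negative : ∀ {n} → Vec ℤ n → Set where
  here  : ∀ {n m} {ν : Vec ℤ n} → Negative (-[1+ m ] ∷ ν)
  there : ∀ {n a} {ν : Vec ℤ n} → Negative ν → Negative (a ∷ ν)

toLaurentSeries-≈ : ∀ {n} F (J : Vec ℤ n → Λ) → (∀ {ν} → Negative ν → J ν ≈ con 0ℚ) → (∀ α → F α ≈ J (Vec.map +_ α)) →
  ∀ ν → Laurent.toLaurentSeries n F ν ≈ J ν
toLaurentSeries-≈ {n} F = go-≈ F
  where
  go-≈ : ∀ {m} G (J : Vec ℤ m → Λ) → (∀ {ν} → Negative ν → J ν ≈ con 0ℚ) → (∀ α → G α ≈ J (Vec.map +_ α)) → ∀ ν → go n F G ν ≈ J ν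
  go-≈ G J neg eq []             = eq []
  go-≈ G J neg eq (+ a ∷ ν)      = go-≈ (G ∘ (a ∷_)) (J ∘ (+ a ∷_)) (neg ∘ there) (eq ∘ (a ∷_)) ν
  go-≈ G J neg eq (-[1+ a ] ∷ ν) = ≈-sym (neg here)

-- Reading a series at `bump i t ν` instead of ν amounts to multiplying it by z_i^(-t).
bump : ∀ {n} → Fin.Fin n → ℤ → Vec ℤ n → Vec ℤ n
bump Fin.zero    t (a ∷ ν) = a ℤ.+ t ∷ ν
bump (Fin.suc i) t (a ∷ ν) = a ∷ bump i t ν

private
  ℤ-0 : ∀ k a → a ℤ.- k ℤ.* + 0 ≡ a
  ℤ-0 = solve-∀
  ℤ-1 : ∀ k a → a ℤ.- k ℤ.* + 1 ≡ a ℤ.+ ℤ.- k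
  ℤ-1 = solve-∀
  ℤ--1 : ∀ k a → a ℤ.- k ℤ.* ℤ.- + 1 ≡ a ℤ.+ k
  ℤ--1 = solve-∀

minus-map-*-0 : ∀ {n} k (ν : Vec ℤ n) → Vec.zipWith ℤ._-_ ν (Vec.map (k ℤ.*_) (Vec.replicate n ℤ.0ℤ)) ≡ ν
minus-map-*-0 k ν = ≡.trans (≡.cong (Vec.zipWith ℤ._-_ ν) (map-*-0 k)) (zipWith-minus-0 ν)

map-neg-0 : ∀ n → Vec.map ℤ.-_ (Vec.replicate n ℤ.0ℤ) ≡ Vec.replicate n ℤ.0ℤ
map-neg-0 n = Vec.map-replicate ℤ.-_ ℤ.0ℤ n

bump-e : ∀ {n} k (i : Fin.Fin n) ν → Vec.zipWith ℤ._-_ ν (Vec.map (k ℤ.*_) (Laurent.e n i)) ≡ bump i (ℤ.- k) ν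
bump-e k Fin.zero    (a ∷ ν) = ≡.cong₂ _∷_ (ℤ-1 k a) (minus-map-*-0 k ν)
bump-e k (Fin.suc i) (a ∷ ν) = ≡.cong₂ _∷_ (ℤ-0 k a) (bump-e k i ν)

bump-e⁻ : ∀ {n} k (i : Fin.Fin n) ν → Vec.zipWith ℤ._-_ ν (Vec.map (k ℤ.*_) (Vec.map ℤ.-_ (Laurent.e n i))) ≡ bump i k ν
bump-e⁻ {suc n} k Fin.zero (a ∷ ν) = ≡.cong₂ _∷_ (ℤ--1 k a) (≡.trans (≡.cong (λ μ → Vec.zipWith ℤ._-_ ν (Vec.map (k ℤ.*_) μ)) (map-neg-0 n)) (minus-map-*-0 k ν))
bump-e⁻ k (Fin.suc i) (a ∷ ν) = ≡.cong₂ _∷_ (ℤ-0 k a) (bump-e⁻ k i ν)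

sum-hom : ∀ n (φ : Λ → Λ) (a : Fin.Fin n → Λ) → (∀ x y → φ (x + y) ≈ φ x + φ y) → φ (con 0ℚ) ≈ con 0ℚ → φ (sum a) ≈ sum (φ ∘ a)
sum-hom zero    φ a hom φ-0 = φ-0
sum-hom (suc n) φ a hom φ-0 = ≈-trans (hom _ _) (+-congˡ (sum-hom n φ (a ∘ Fin.suc) hom φ-0))

-- The coefficient of z^ν in Ω[ZX], as a product of complete symmetric functions.
hv : ∀ {n} → Vec ℤ n → Λ
hv []      = con 1ℚ
hv (a ∷ ν) = H a * hv ν

hv-negative : ∀ {n} {ν : Vec ℤ n} → Negative ν → hv ν ≈ con 0ℚ
hv-negative here      = zeroˡ _
hv-negative (there h) = ≈-trans (*-congˡ (hv-negative h)) (zeroʳ _)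

∂-hv : ∀ k {n} (ν : Vec ℤ n) → ∂ k (hv ν) ≈ sum λ i → hv (bump i -[1+ k ] ν)
∂-hv k []      = ≈-refl
∂-hv k (a ∷ ν) = +-cong (*-congʳ (≈-trans (∂-uℤ k Sign.+ a) (*-identityˡ _)))
  (≈-trans (*-congˡ (∂-hv k ν)) (sum-hom _ (H a *_) (λ i → hv (bump i -[1+ k ] ν)) (distribˡ _) (zeroʳ _)))

δᵛ : ∀ {n} → Vec ℤ n → ℚ
δᵛ []      = 1ℚ
δᵛ (a ∷ ν) = δℤ a ℚ.* δᵛ ν

ε-H : ∀ a → ε (H a) ≡ δℤ a
ε-H (+ zero)  = ε-cong (u-0 Sign.+)
ε-H (+ suc m) = ε-u-suc Sign.+ m
ε-H -[1+ m ]  = ≡.refl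

ε-hv : ∀ {n} (ν : Vec ℤ n) → ε (hv ν) ≡ δᵛ ν
ε-hv []      = ≡.refl
ε-hv (a ∷ ν) = ≡.cong₂ ℚ._*_ (ε-H a) (ε-hv ν)

δᵛ-0 : ∀ n → δᵛ (Vec.replicate n ℤ.0ℤ) ≡ 1ℚ
δᵛ-0 zero    = ≡.refl
δᵛ-0 (suc n) = ≡.trans (ℚ.*-identityˡ _) (δᵛ-0 n)

δᵛ-≢0 : ∀ {n} (ν : Vec ℤ n) → Vec.replicate n ℤ.0ℤ ≢ ν → δᵛ ν ≡ 0ℚ
δᵛ-≢0 []             ≢ = contradiction ≡.refl ≢
δᵛ-≢0 (+ zero ∷ ν)   ≢ = ≡.trans (ℚ.*-identityˡ (δᵛ ν)) (δᵛ-≢0 ν (≢ ∘ ≡.cong (+ 0 ∷_)))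
δᵛ-≢0 (+ suc _ ∷ ν)  ≢ = ℚ.*-zeroˡ (δᵛ ν)
δᵛ-≢0 (-[1+ _ ] ∷ ν) ≢ = ℚ.*-zeroˡ (δᵛ ν)

total : ∀ {n} → Vec ℤ n → ℤ
total []      = + 0
total (a ∷ ν) = a ℤ.+ total ν

total-bump : ∀ {n} (i : Fin.Fin n) t ν → total (bump i t ν) ≡ total ν ℤ.+ t
total-bump Fin.zero    t (a ∷ ν) = ℤ-eq a t (total ν)
  where
  ℤ-eq : ∀ a t s → (a ℤ.+ t) ℤ.+ s ≡ (a ℤ.+ s) ℤ.+ t
  ℤ-eq = solve-∀
total-bump (Fin.suc i) t (a ∷ ν) = ≡.trans (≡.cong (ℤ._+_ a) (total-bump i t ν)) (≡.sym (ℤ.+-assoc a (total ν) t))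

total-0 : ∀ n → total (Vec.replicate n ℤ.0ℤ) ≡ + 0
total-0 zero    = ≡.refl
total-0 (suc n) = ≡.trans (ℤ.+-identityˡ _) (total-0 n)

total-+ : ∀ {n} (α : Vec ℕ n) → total (Vec.map +_ α) ≡ + Vec.sum α
total-+ []      = ≡.refl
total-+ (a ∷ α) = ≡.cong (ℤ._+_ (+ a)) (total-+ α)

-- The bound is an integer because each derivative lowers it and may make it negative, where the sum
-- is empty.
partial : (ℕ → Λ) → ℤ → Λ
partial a (+ N)    = ∑ N a
partial a -[1+ _ ] = con 0ℚ

partial-delay : ∀ {C : Set} (c₀ : C) k N (φ : C → Λ) b → φ c₀ ≈ con 0ℚ → ∑ N (φ ∘ delay c₀ k b) ≈ partial (φ ∘ b) (N ⊖ k)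
partial-delay c₀ zero    N       φ b φ-0 = ≈-refl
partial-delay c₀ (suc k) zero    φ b φ-0 = φ-0
partial-delay c₀ (suc k) (suc N) φ b φ-0 = ≈-trans (+-cong φ-0 (partial-delay c₀ k N φ b φ-0)) (≈-trans (+-identityˡ _)
  (reflexive (≡.cong (partial (φ ∘ b)) (≡.sym (ℤ.[1+m]⊖[1+n]≡m⊖n N k)))))

ε-order : ∀ {d P} → Order≥ (suc d) P → ε P ≡ 0ℚ
ε-order {P = P} o = ≡.trans (≡.sym (⟪⟫-1 P)) (ε-cong (order-kills o (low-con {0} {1ℚ}) (s≤s z≤n)))

pair : Λ → Λ → Λ
pair G P = con ⟪ G , P ⟫

pair-+ : ∀ G P Q → pair G (P + Q) ≈ pair G P + pair G Q
pair-+ G P Q = ≈-trans (reflexive (≡.cong con (⟪⟫-+ʳ G P Q))) (con-+ _ _)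

pair-cong : ∀ G {P Q} → P ≈ Q → pair G P ≈ pair G Q
pair-cong G eq = reflexive (≡.cong con (⟪⟫-cong {G} ≈-refl eq))

pair-sum : ∀ G n (a : Fin.Fin n → Λ) → pair G (sum a) ≈ sum (pair G ∘ a)
pair-sum G n a = sum-hom n (pair G) a (pair-+ G) (reflexive (≡.cong con (ε-cong (D-0 G))))

pair-p* : ∀ k G P → pair (p[1+ k ] * G) P ≈ pair G (∂ k P)
pair-p* k G P = reflexive (≡.cong con (ε-cong (≈-sym (D-∂-comm G k P))))

pair-congˡ : ∀ {G G′} P → G ≈ G′ → pair G P ≈ pair G′ P
pair-congˡ P eq = reflexive (≡.cong con (⟪⟫-cong eq (≈-refl {P})))

module Monomials (n : ℕ) where
  open Laurent n
  open LaurentRing n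
  open Skewed n

  sumTerms-map-sum : ∀ φ m (a : Fin.Fin m → LaurentPolynomial) g →
    sumTerms (List.map φ (SL.sum a)) g ≈ sum λ i → sumTerms (List.map φ (a i)) g
  sumTerms-map-sum φ zero    a g = ≈-refl
  sumTerms-map-sum φ (suc m) a g = ≈-trans (reflexive (≡.cong (λ L → sumTerms L g) (List.map-++ φ (a Fin.zero) (SL.sum (a ∘ Fin.suc)))))
    (≈-trans (sumTerms-++ (List.map φ (a Fin.zero)) _ g) (+-congˡ (sumTerms-map-sum φ m (a ∘ Fin.suc) g)))

  sumTerms-ψZ : ∀ k g → sumTerms (ψ k Z) g ≈ sum λ i → g (con 1ℚ) (Vec.map (+ suc k ℤ.*_) (e i))
  sumTerms-ψZ k g = ≈-trans (sumTerms-map-sum _ n z g) (sum-cong n λ i → +-identityʳ _)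

  sumTerms-ψZ* : ∀ k g → sumTerms (ψ k Z*) g ≈ sum λ i → g (con 1ℚ) (Vec.map (+ suc k ℤ.*_) (Vec.map ℤ.-_ (e i)))
  sumTerms-ψZ* k g = ≈-trans (sumTerms-map-sum _ n z⁻¹ g) (sum-cong n λ i → +-identityʳ _)

  scalar-sum : ∀ m (a : Fin.Fin m → LaurentPolynomial) → (∀ i → Scalar (a i)) → Scalar (SL.sum a)
  scalar-sum zero    a sc = []
  scalar-sum (suc m) a sc = All.++⁺ (sc Fin.zero) (scalar-sum m (a ∘ Fin.suc) (sc ∘ Fin.suc))

  scalar-Z : Scalar Z
  scalar-Z = scalar-sum n z λ i → (1ℚ , ≈-refl) ∷ []

  scalar-Z* : Scalar Z*
  scalar-Z* = scalar-sum n z⁻¹ λ i → (1ℚ , ≈-refl) ∷ []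

  coeff-additive : ∀ ν → Additive (λ c μ → if does (≡-dec ℤ._≟_ μ ν) then c else con 0ℚ)
  coeff-additive ν = record { cong = λ μ → cong μ ; add = λ c c′ μ → add c c′ μ }
    where
    cong : ∀ {c c′} μ → c ≈ c′ → (if does (≡-dec ℤ._≟_ μ ν) then c else con 0ℚ) ≈ (if does (≡-dec ℤ._≟_ μ ν) then c′ else con 0ℚ)
    cong μ eq with ≡-dec ℤ._≟_ μ ν
    ... | yes _ = eq
    ... | no  _ = ≈-refl
    add : ∀ c c′ μ → (if does (≡-dec ℤ._≟_ μ ν) then c + c′ else con 0ℚ) ≈
      (if does (≡-dec ℤ._≟_ μ ν) then c else con 0ℚ) + (if does (≡-dec ℤ._≟_ μ ν) then c′ else con 0ℚ)
    add c c′ μ with ≡-dec ℤ._≟_ μ ν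
    ... | yes _ = ≈-refl
    ... | no  _ = ≈-sym (+-identityˡ _)

  coeff-≃ : ∀ {L M} → L ≃ M → ∀ ν → coeff L ν ≈ coeff M ν
  coeff-≃ eq ν = on eq _ (coeff-additive ν)

  coeff-1 : ∀ ν → coeff 1ᴸ ν ≈ con (δᵛ ν)
  coeff-1 ν with ≡-dec ℤ._≟_ (Vec.replicate n ℤ.0ℤ) ν
  ... | yes ≡.refl = ≈-trans (+-identityʳ _) (reflexive (≡.cong con (≡.sym (δᵛ-0 n))))
  ... | no  ≢      = ≈-trans (+-identityʳ _) (reflexive (≡.cong con (≡.sym (δᵛ-≢0 ν ≢))))

  plus-minus : ∀ {m} (μ ξ ν : Vec ℤ m) → Vec.zipWith ℤ._+_ μ ξ ≡ ν → ξ ≡ Vec.zipWith ℤ._-_ ν μ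
  plus-minus []      []      []      eq = ≡.refl
  plus-minus (a ∷ μ) (b ∷ ξ) (c ∷ ν) eq = ≡.cong₂ _∷_ (≡.trans (ℤ-eq a b) (≡.cong (ℤ._- a) (≡.cong Vec.head eq))) (plus-minus μ ξ ν (≡.cong Vec.tail eq))
    where
    ℤ-eq : ∀ a b → b ≡ (a ℤ.+ b) ℤ.- a
    ℤ-eq = solve-∀

  minus-plus : ∀ {m} (μ ξ ν : Vec ℤ m) → ξ ≡ Vec.zipWith ℤ._-_ ν μ → Vec.zipWith ℤ._+_ μ ξ ≡ ν
  minus-plus []      []      []      eq = ≡.refl
  minus-plus (a ∷ μ) (b ∷ ξ) (c ∷ ν) eq = ≡.cong₂ _∷_ (≡.trans (≡.cong (λ b → a ℤ.+ b) (≡.cong Vec.head eq)) (ℤ-eq a c)) (minus-plus μ ξ ν (≡.cong Vec.tail eq))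
    where
    ℤ-eq : ∀ a c → a ℤ.+ (c ℤ.- a) ≡ c
    ℤ-eq = solve-∀

  coeff-ψZ* : ∀ k L ν → coeff (ψ k Z *ᴸ L) ν ≈ sum λ i → coeff L (bump i -[1+ k ] ν)
  coeff-ψZ* k L ν = ≈-trans (sumTerms-* (ψ k Z) L _) (≈-trans (sumTerms-ψZ k _) (sum-cong n λ i → sumTerms-cong L λ c μ →
    ≈-trans (Additive.cong (coeff-additive ν) (Vec.zipWith ℤ._+_ (Vec.map (+ suc k ℤ.*_) (e i)) μ) (*-identityˡ c))
      (reflexive (≡.cong (λ b → if b then c else con 0ℚ) (≡.trans
        (does-⇔ (mk⇔ (plus-minus _ μ ν) (minus-plus _ μ ν)) (≡-dec ℤ._≟_ _ ν) (≡-dec ℤ._≟_ μ _))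
        (≡.cong (λ ξ → does (≡-dec ℤ._≟_ μ ξ)) (bump-e (+ suc k) i ν)))))))

  ∂-coeff : ∀ k L ν → ∂ k (coeff L ν) ≈ coeff (∂ᴸ k L) ν
  ∂-coeff k L ν = ≈-trans (sumTerms-hom L (∂ k) _ (λ _ _ → ≈-refl) ≈-refl) (≈-trans (sumTerms-cong L λ c μ → step c μ) (reflexive (≡.sym (sumTerms-∂ᴸ k L _))))
    where
    step : ∀ c μ → ∂ k (if does (≡-dec ℤ._≟_ μ ν) then c else con 0ℚ) ≈ (if does (≡-dec ℤ._≟_ μ ν) then ∂ k c else con 0ℚ)
    step c μ with ≡-dec ℤ._≟_ μ ν
    ... | yes _ = ≈-refl
    ... | no  _ = ≈-refl

  -- The degree components of Ω[ZX] enter only through their constant term, derivatives and orders,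
  -- which is enough to determine their sum.
  module Cauchy (E : ℕ → LaurentPolynomial) (E-0 : E 0 ≃ 1ᴸ) (∂ᴸ-E : ∀ k d → ∂ᴸ k (E d) ≃ ψ k Z *ᴸ SL.shift (suc k) E d)
    (E-order : ∀ d → ∃ λ M → E d ≃ M × All (λ (c , _) → Order≥ d c) M) where
    X≤ : ℤ → Vec ℤ n → Λ
    X≤ N ν = partial (λ d → coeff (E d) ν) N

    ∂-X≤ : ∀ k N ν → ∂ k (X≤ N ν) ≈ sum λ i → X≤ (N ℤ.+ -[1+ k ]) (bump i -[1+ k ] ν)
    ∂-X≤ k -[1+ N ] ν = ≈-sym (sum-0 n)
      where
      sum-0 : ∀ m → sum {m} (λ _ → con 0ℚ) ≈ con 0ℚ
      sum-0 zero    = ≈-refl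
      sum-0 (suc m) = ≈-trans (+-identityˡ _) (sum-0 m)
    ∂-X≤ k (+ N) ν = ≈-trans (S.∑-hom N (∂ k) (λ d → coeff (E d) ν) (λ _ _ → ≈-refl))
      (≈-trans (S.∑-cong N λ d _ → ≈-trans (∂-coeff k (E d) ν) (≈-trans (coeff-≃ (∂ᴸ-E k d) ν) (coeff-ψZ* k (SL.shift (suc k) (E) d) ν)))
      (≈-trans (∑-sum n λ d i → coeff (SL.shift (suc k) (E) d) (bump i -[1+ k ] ν))
        (sum-cong n λ i → partial-delay [] (suc k) N
          (λ L → coeff L (bump i -[1+ k ] ν)) (E) ≈-refl)))
      where
      ∑-sum : ∀ m (a : ℕ → Fin.Fin m → Λ) → ∑ N (λ d → sum (a d)) ≈ sum λ i → ∑ N λ d → a d i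
      ∑-sum zero    a = S.∑-0 N λ _ _ → ≈-refl
      ∑-sum (suc m) a = ≈-trans (S.∑-+ N (λ d → a d Fin.zero) (λ d → sum (a d ∘ Fin.suc))) (+-congˡ (∑-sum m λ d → a d ∘ Fin.suc))

    ε-coeff-E : ∀ d ν → con (ε (coeff (E (suc d)) ν)) ≈ con 0ℚ
    ε-coeff-E d ν with E-order (suc d)
    ... | M , eq , o = ≈-trans (reflexive (≡.cong con (ε-cong (coeff-≃ eq ν)))) (vanish o)
      where
      vanish : ∀ {M} → All (λ (c , _) → Order≥ (suc d) c) M → con (ε (coeff M ν)) ≈ con 0ℚ
      vanish []                   = ≈-refl
      vanish (_∷_ {c , μ} o os) with does (≡-dec ℤ._≟_ μ ν)
      ... | true  = ≈-trans (con-+ _ _) (≈-trans (+-cong (reflexive (≡.cong con (ε-order o))) (vanish os)) (+-identityˡ _))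
      ... | false = ≈-trans (con-+ _ _) (≈-trans (+-identityˡ _) (vanish os))

    -- Both sides have the same Taylor coefficients: `∂ k` lowers N and the total of ν by the same
    -- amount, so the inequality persists, and the constant terms agree.
    X≤-hv : ∀ N ν → total ν ℤ.≤ N → X≤ N ν ≈ hv ν
    X≤-hv N ν ≤N = taylor λ G → ≡.trans (≡.sym (ε-con _)) (≡.trans (ε-cong (pairs G N ν ≤N)) (ε-con _))
      where
      ε-con : ∀ q → ε (con q) ≡ q
      ε-con q = ≡.refl
      base : ∀ N ν → total ν ℤ.≤ N → con (ε (X≤ N ν)) ≈ con (ε (hv ν))
      base (+ N) ν ≤N = ≈-trans (S.∑-hom N (con ∘ ε) (λ d → coeff (E d) ν) (λ x y → con-+ (ε x) (ε y)))
        (≈-trans (S.∑-extend {0} {N} _ z≤n λ { (suc d) _ → ε-coeff-E d ν })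
        (reflexive (≡.cong con (≡.trans (ε-cong (≈-trans (coeff-≃ E-0 ν) (coeff-1 ν))) (≡.sym (ε-hv ν))))))
      base -[1+ N ] ν ≤N = reflexive (≡.cong con (≡.sym (≡.trans (ε-hv ν) (δᵛ-≢0 ν
        λ { ≡.refl → contradiction (≡.subst (ℤ._≤ -[1+ N ]) (total-0 n) ≤N) λ () }))))
      pairs : ∀ G N ν → total ν ℤ.≤ N → pair G (X≤ N ν) ≈ pair G (hv ν)
      pairs = Λ-ind (λ G → ∀ N ν → total ν ℤ.≤ N → pair G (X≤ N ν) ≈ pair G (hv ν))
        (λ eq IH N ν ≤N → ≈-trans (pair-congˡ _ (≈-sym eq)) (≈-trans (IH N ν ≤N) (pair-congˡ _ eq)))
        (λ IH IH′ N ν ≤N → ≈-trans (con-+ _ _) (≈-trans (+-cong (IH N ν ≤N) (IH′ N ν ≤N)) (≈-sym (con-+ _ _))))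
        (λ q IH N ν ≤N → ≈-trans (con-* q _) (≈-trans (*-congˡ (IH N ν ≤N)) (≈-sym (con-* q _))))
        (λ k {G} IH N ν ≤N → ≈-trans (pair-p* k G _) (≈-trans (pair-cong G (∂-X≤ k N ν)) (≈-trans (pair-sum G n _)
          (≈-trans (sum-cong n λ i → IH (N ℤ.+ -[1+ k ]) (bump i -[1+ k ] ν)
              (≡.subst (ℤ._≤ N ℤ.+ -[1+ k ]) (≡.sym (total-bump i -[1+ k ] ν)) (ℤ.+-monoˡ-≤ -[1+ k ] ≤N)))
          (≈-sym (≈-trans (pair-p* k G _) (≈-trans (pair-cong G (∂-hv k ν)) (pair-sum G n _))))))))
        (λ N ν ≤N → ≈-trans (reflexive (≡.cong con (ℚ.*-identityˡ _))) (≈-trans (base N ν ≤N) (reflexive (≡.cong con (≡.sym (ℚ.*-identityˡ _))))))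

  ZX : LaurentPolynomial
  ZX = Z *ᴸ X

  private
    module ZX = TimesX (*X scalar-Z)
    module C = Cauchy (Ω ZX) (SL.Ω-0 ZX) ZX.∂ᴸ-Ω ZX.Ω-order

  Ω⟨ZX⟩ : ∀ α → Ω⟨ ZX ⟩ α ≈ hv (Vec.map +_ α)
  Ω⟨ZX⟩ α = ≈-trans (S.sum≤-∑ (Vec.sum α) (λ d → coeff (Ω ZX d) (Vec.map +_ α))) (C.X≤-hv (+ Vec.sum α) (Vec.map +_ α) (ℤ.≤-reflexive (total-+ α)))


-- Products of Bernstein operators and conjugation by Ω[a]^⊥

bump-minus : ∀ {n} (i : Fin.Fin n) t ν μ → bump i t (Vec.zipWith ℤ._-_ ν μ) ≡ Vec.zipWith ℤ._-_ (bump i t ν) μ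
bump-minus Fin.zero    t (a ∷ ν) (b ∷ μ) = ≡.cong (_∷ Vec.zipWith ℤ._-_ ν μ) (ℤ-swap a (ℤ.- b) t)
bump-minus (Fin.suc i) t (a ∷ ν) (b ∷ μ) = ≡.cong (_ ∷_) (bump-minus i t ν μ)

Bv : ∀ {n} → Vec ℤ n → Λ → Λ
Bv []      Q = Q
Bv (r ∷ ν) Q = B⁺ r (Bv ν Q)

Bv-cong : ∀ {n} (ν : Vec ℤ n) {P Q} → P ≈ Q → Bv ν P ≈ Bv ν Q
Bv-cong []      eq = eq
Bv-cong (r ∷ ν) eq = V-cong Sign.+ r (Bv-cong ν eq)

Bv-+ : ∀ {n} (ν : Vec ℤ n) P Q → Bv ν (P + Q) ≈ Bv ν P + Bv ν Q
Bv-+ []      P Q = ≈-refl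
Bv-+ (r ∷ ν) P Q = ≈-trans (V-cong Sign.+ r (Bv-+ ν P Q)) (V-+ Sign.+ r _ _)

Bv-con* : ∀ {n} (ν : Vec ℤ n) q P → Bv ν (con q * P) ≈ con q * Bv ν P
Bv-con* []      q P = ≈-refl
Bv-con* (r ∷ ν) q P = ≈-trans (V-cong Sign.+ r (Bv-con* ν q P)) (V-con* Sign.+ r q _)

V-sum : ∀ r n (a : Fin.Fin n → Λ) → B⁺ r (sum a) ≈ sum (B⁺ r ∘ a)
V-sum r n a = sum-hom n (B⁺ r) a (V-+ Sign.+ r) (V-0 Sign.+ r)

-- In generating form, B(Z) p_{1+k} = (p_{1+k} - p_{1+k}[Z*]) B(Z).
Bv-p* : ∀ {n} (ν : Vec ℤ n) k Q → Bv ν (p[1+ k ] * Q) ≈ p[1+ k ] * Bv ν Q + - sum (λ i → Bv (bump i (+ suc k) ν) Q)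
Bv-p* []      k Q = ≈-sym (≈-trans (+-congˡ S.-0#≈0#) (+-identityʳ _))
Bv-p* {suc n} (r ∷ ν) k Q = ≈-trans (V-cong Sign.+ r (Bv-p* ν k Q)) (≈-trans (V-+ Sign.+ r _ _) (≈-trans (+-cong
    (≈-trans (V-p* Sign.+ r k (Bv ν Q)) (+-congˡ (-‿cong (*-identityˡ _))))
    (≈-trans (V-neg Sign.+ r _) (-‿cong (V-sum r n (λ i → Bv (bump i (+ suc k) ν) Q)))))
  (≈-trans (+-assoc _ _ _) (+-congˡ (≈-sym (neg-+ _ _))))))

-- In generating form, B(Z) ∂_k = (∂_k - p_{1+k}[Z]) B(Z). This is the source of Z in Z + Z*.
Bv-∂ : ∀ {n} (ν : Vec ℤ n) k Q → Bv ν (∂ k Q) ≈ ∂ k (Bv ν Q) + - sum (λ i → Bv (bump i -[1+ k ] ν) Q)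
Bv-∂ []      k Q = ≈-sym (≈-trans (+-congˡ S.-0#≈0#) (+-identityʳ _))
Bv-∂ {suc n} (r ∷ ν) k Q = ≈-trans (V-cong Sign.+ r (Bv-∂ ν k Q)) (≈-trans (V-+ Sign.+ r _ _) (≈-trans (+-cong
    (≈-trans (solveΛ 2 (λ a b → a := (a :+ K 1ℚ :* b) :+ :- b) ≈-refl _ (B⁺ (r ℤ.+ -[1+ k ]) (Bv ν Q))) (+-congʳ (≈-sym (V-∂ Sign.+ r k (Bv ν Q)))))
    (≈-trans (V-neg Sign.+ r _) (-‿cong (V-sum r n (λ i → Bv (bump i -[1+ k ] ν) Q)))))
  (≈-trans (+-assoc _ _ _) (+-congˡ (≈-sym (neg-+ _ _))))))

diagonal : (ℕ → ℕ → Λ) → ℕ → Λ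
diagonal φ zero    = φ 0 0
diagonal φ (suc d) = φ 0 (suc d) + diagonal (φ ∘ suc) d

diagonal-⊛ : ∀ (a b : Seq) Q d → D ((a ⊛ b) d) Q ≈ diagonal (λ i j → D (a i) (D (b j) Q)) d
diagonal-⊛ a b Q zero    = ≈-refl
diagonal-⊛ a b Q (suc d) = +-congˡ (diagonal-⊛ (a ∘ suc) b Q d)

diagonal-0 : ∀ φ d → (∀ i j → φ i j ≈ con 0ℚ) → diagonal φ d ≈ con 0ℚ
diagonal-0 φ zero    z = z 0 0
diagonal-0 φ (suc d) z = ≈-trans (+-cong (z 0 (suc d)) (diagonal-0 (φ ∘ suc) d (z ∘ suc))) (+-identityˡ _)

-- Summing over triangles i + j = d agrees with summing over a rectangle once the triangles cover
-- the rectangle that supports φ.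
∑-diagonal : ∀ k {M N} φ → (∀ i j → k ℕ.< i → φ i j ≈ con 0ℚ) → (∀ i j → M ℕ.< j → φ i j ≈ con 0ℚ) → k ℕ.+ M ℕ.≤ N →
  ∑ N (diagonal φ) ≈ ∑ k λ i → ∑ M (φ i)
∑-diagonal zero {M} {N} φ zi zj ≤N = ≈-trans (S.∑-cong N λ { zero _ → ≈-refl ; (suc d) _ → ≈-trans (+-congˡ (diagonal-0 (φ ∘ suc) d λ i j → zi (suc i) j (s≤s z≤n))) (+-identityʳ _) })
  (S.∑-extend (φ 0) ≤N (zj 0))
∑-diagonal (suc k) {M} {suc N} φ zi zj (s≤s ≤N) = ≈-trans
  (≈-trans (+-congˡ (S.∑-+ N (λ d → φ 0 (suc d)) (diagonal (φ ∘ suc)))) (≈-sym (+-assoc _ _ _)))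
  (+-cong (S.∑-extend (φ 0) (ℕ.m≤n⇒m≤1+n (ℕ.≤-trans (ℕ.m≤n+m M k) ≤N)) (zj 0)) (∑-diagonal k (φ ∘ suc) (λ i j k<i → zi (suc i) j (s≤s k<i)) (zj ∘ suc) ≤N))

-- κ k is (1+k) ∂/∂p_{1+k} of log Ω[a]; `bounded` says that only the first k + 1 terms of the
-- logarithm contribute, so that it is an element of Λ.
record Log (a : Λ) (κ : ℕ → Λ) : Set where
  field
    ψ-order : ∀ k → Order≥ (suc k) (Λ-ψ[1+ k ] a)
    bounded : ∀ k i → k ℕ.< i → ∂ k (S.logΩ a (suc i)) ≈ con 0ℚ
    ∂-log   : ∀ k → ∑ k (λ i → ∂ k (S.logΩ a (suc i))) ≈ κ k

module Main (_⊥ : Λ → Λ → Λ) (⊥-D : ∀ P Q → (P ⊥) Q ≈ D P Q) where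
  open Bernstein _⊥
  open Operators _⊥ ⊥-D

  -- Bernstein's operator as defined is the operator W for one variable; it has the same rule for
  -- p_{1+k} as V and the same value at 1.
  B-B⁺ : ∀ r P → B r P ≈ B⁺ r P
  B-B⁺ r P = Λ-ind (λ P → ∀ r → B r P ≈ B⁺ r P)
    (λ eq IH r → ≈-trans (O.W-cong (≈-sym eq) (r ∷ [])) (≈-trans (IH r) (V-cong Sign.+ r eq)))
    (λ {P} {Q} IH IH′ r → ≈-trans (O.W-+ P Q (r ∷ [])) (≈-trans (+-cong (IH r) (IH′ r)) (≈-sym (V-+ Sign.+ r P Q))))
    (λ q {P} IH r → ≈-trans (O.W-con* q P (r ∷ [])) (≈-trans (*-congˡ (IH r)) (≈-sym (V-con* Sign.+ r q P))))
    (λ k {P} IH r → ≈-trans (O.W-p* k P (r ∷ [])) (≈-trans (+-cong (*-congˡ (IH r)) (≈-trans (+-identityʳ _)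
        (≈-trans (≈-sym (S.-‿distribˡ-* _ _)) (-‿cong (*-congˡ (≈-trans (reflexive (≡.cong (λ r → B r P) (ℤ-eq (+ suc k) r))) (IH (r ℤ.+ + suc k))))))))
      (≈-sym (V-p* Sign.+ r k P))))
    (λ r → ≈-trans (O.W-1 (r ∷ [])) (≈-trans (toLaurentSeries-≈ _ hv hv-negative (Monomials.Ω⟨ZX⟩ 1) (r ∷ [])) (≈-trans (*-identityʳ _) (≈-sym (V-1 Sign.+ r)))))
    P r
    where
    module O = Operator (Skewed.-*X 1 {Laurent.z⁻¹ 1 Fin.zero} ((1ℚ , ≈-refl) ∷ [])) (Laurent.toLaurentSeries 1 (Laurent.Ω⟨_⟩ 1 (Laurent._*ᴸ_ 1 (Laurent.z 1 Fin.zero) (Laurent.X 1))))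
    ℤ-eq : ∀ k r → r ℤ.- k ℤ.* ℤ.- + 1 ≡ r ℤ.+ k
    ℤ-eq = solve-∀

  B[]-Bv : ∀ {n} (ν : Vec ℤ n) P → B[ ν ] P ≈ Bv ν P
  B[]-Bv []      P = ≈-refl
  B[]-Bv (r ∷ ν) P = ≈-trans (B-B⁺ r _) (V-cong Sign.+ r (B[]-Bv ν P))

  module Exponential {a κ} (log : Log a κ) where
    open Log log

    T : Λ → Λ
    T = Ω⟨ a ⟩⊥

    T≤ : ℕ → Λ → Λ
    T≤ N P = ∑ N λ d → D (ΩΛ a d) P

    Ω-order : ∀ d → Order≥ d (ΩΛ a d)
    Ω-order = order-Ω a ψ-order

    kills : ∀ P d → degree P ℕ.< d → D (ΩΛ a d) P ≈ con 0ℚ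
    kills P d deg<d = order-kills (Ω-order d) (low-degree P) deg<d

    T-T≤ : ∀ {N} P → degree P ℕ.≤ N → T P ≈ T≤ N P
    T-T≤ P deg≤N = ≈-trans (S.sum≤-∑ (degree P) _) (≈-trans (S.∑-cong (degree P) λ d _ → ⊥-D (ΩΛ a d) P) (≈-sym (S.∑-extend _ deg≤N λ d → kills P d)))

    T-cong : ∀ {P Q} → P ≈ Q → T P ≈ T Q
    T-cong {P} {Q} eq = ≈-trans (T-T≤ P (ℕ.m≤m⊔n (degree P) (degree Q))) (≈-trans (S.∑-cong (degree P ℕ.⊔ degree Q) λ d _ → D-congʳ (ΩΛ a d) eq)
      (≈-sym (T-T≤ Q (ℕ.m≤n⊔m (degree P) (degree Q)))))

    T-+ : ∀ P Q → T (P + Q) ≈ T P + T Q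
    T-+ P Q = ≈-trans (T-T≤ (P + Q) ℕ.≤-refl) (≈-trans (S.∑-cong (degree P ℕ.⊔ degree Q) λ d _ → D-+ (ΩΛ a d) P Q)
      (≈-trans (S.∑-+ (degree P ℕ.⊔ degree Q) (λ d → D (ΩΛ a d) P) (λ d → D (ΩΛ a d) Q))
        (+-cong (≈-sym (T-T≤ P (ℕ.m≤m⊔n (degree P) (degree Q)))) (≈-sym (T-T≤ Q (ℕ.m≤n⊔m (degree P) (degree Q)))))))

    T-con* : ∀ q P → T (con q * P) ≈ con q * T P
    T-con* q P = ≈-trans (T-T≤ (con q * P) ℕ.≤-refl) (≈-trans (S.∑-cong (degree P) λ d _ → D-con* (ΩΛ a d) q P)
      (≈-trans (S.∑-*ˡ (degree P) (con q) (λ d → D (ΩΛ a d) P)) (*-congˡ (≈-sym (T-T≤ P ℕ.≤-refl)))))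

    T-0 : T (con 0ℚ) ≈ con 0ℚ
    T-0 = ≈-trans (T-cong (≈-sym (zeroˡ (con 0ℚ)))) (≈-trans (T-con* 0ℚ (con 0ℚ)) (zeroˡ _))

    T-neg : ∀ P → T (- P) ≈ - T P
    T-neg P = ≈-trans (T-cong (neg-con P)) (≈-trans (T-con* _ P) (≈-sym (neg-con _)))

    T-sum : ∀ n (b : Fin.Fin n → Λ) → T (sum b) ≈ sum (T ∘ b)
    T-sum n b = sum-hom n T b T-+ T-0

    T-1 : T (con 1ℚ) ≈ con 1ℚ
    T-1 = ≈-trans (T-T≤ {0} (con 1ℚ) z≤n) (≈-trans (D-congˡ (S.Ω-0 a) (con 1ℚ)) (*-identityˡ _))

    T-∂ : ∀ k P → T (∂ k P) ≈ ∂ k (T P)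
    T-∂ k P = ≈-trans (T-T≤ (∂ k P) (ℕ.m≤n⊔m (degree P) (degree (∂ k P)))) (≈-trans (S.∑-cong N λ d _ → D-∂-comm (ΩΛ a d) k P)
      (≈-trans (≈-sym (S.∑-hom N (∂ k) (λ d → D (ΩΛ a d) P) λ _ _ → ≈-refl)) (∂-cong k (≈-sym (T-T≤ P (ℕ.m≤m⊔n (degree P) (degree (∂ k P))))))))
      where N = degree P ℕ.⊔ degree (∂ k P)

    -- The commutator of Ω[a]^⊥ with p_{1+k} differentiates its symbol, and the derivative of an
    -- exponential is the derivative of its logarithm times itself.
    T-p* : ∀ k P → T (p[1+ k ] * P) ≈ p[1+ k ] * T P + D (κ k) (T P)
    T-p* k P = begin
      T (p[1+ k ] * P)
        ≈⟨ T-T≤ (p[1+ k ] * P) ℕ.≤-refl ⟩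
      ∑ (suc N) (λ d → D (E d) (p[1+ k ] * P))
        ≈⟨ S.∑-cong (suc N) (λ d _ → D-p* (E d) k P) ⟩
      ∑ (suc N) (λ d → p[1+ k ] * D (E d) P + D (∂ k (E d)) P)
        ≈⟨ S.∑-+ (suc N) (λ d → p[1+ k ] * D (E d) P) (λ d → D (∂ k (E d)) P) ⟩
      ∑ (suc N) (λ d → p[1+ k ] * D (E d) P) + ∑ (suc N) (λ d → D (∂ k (E d)) P)
        ≈⟨ +-cong (≈-trans (S.∑-*ˡ (suc N) p[1+ k ] (λ d → D (E d) P)) (*-congˡ (≈-sym (T-T≤ P (ℕ.m≤n⇒m≤1+n (ℕ.m≤n+m (degree P) k))))))
             (≈-trans (+-cong (≈-trans (D-congˡ (∂-cong k (S.Ω-0 a)) P) (zeroˡ P)) (S.∑-cong N λ d _ →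
               ≈-trans (D-congˡ (S.Ω-derivation (∂-isDerivation k) a d) P) (diagonal-⊛ q E P d))) (+-identityˡ _)) ⟩
      p[1+ k ] * T P + ∑ N (diagonal λ i j → D (q i) (D (E j) P))
        ≈⟨ +-congˡ (∑-diagonal k {degree P} {N} (λ i j → D (q i) (D (E j) P)) (λ i j k<i → ≈-trans (D-congˡ (bounded k i k<i) (D (E j) P)) (zeroˡ _))
             (λ i j deg<j → ≈-trans (D-congʳ (q i) (kills P j deg<j)) (D-0 (q i))) ℕ.≤-refl) ⟩
      p[1+ k ] * T P + ∑ k (λ i → ∑ (degree P) λ j → D (q i) (D (E j) P))
        ≈⟨ +-congˡ (S.∑-cong k λ i _ → ≈-trans (≈-sym (S.∑-hom (degree P) (D (q i)) (λ j → D (E j) P) (D-+ (q i)))) (D-congʳ (q i) (≈-sym (T-T≤ P ℕ.≤-refl)))) ⟩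
      p[1+ k ] * T P + ∑ k (λ i → D (q i) (T P))
        ≈⟨ +-congˡ (≈-trans (≈-sym (D-∑ k q (T P))) (D-congˡ (∂-log k) (T P))) ⟩
      p[1+ k ] * T P + D (κ k) (T P) ∎
      where
      open ≈-Reasoning
      N = k ℕ.+ degree P
      E = ΩΛ a
      q : ℕ → Λ
      q i = ∂ k (S.logΩ a (suc i))

  module Conjugation {a κ} (log⁺ : Log a κ) (log⁻ : Log (- a) (-_ ∘ κ)) (η : ℕ → ℚ) (κ-η : ∀ k → κ k ≈ p[1+ k ] + con (η k)) where
    private
      module T⁺ = Exponential log⁺
      module T⁻ = Exponential log⁻

    LHS : ∀ {n} → Λ → Vec ℤ n → Λ
    LHS P ν = T⁻.T (Bv ν (T⁺.T P))

    -- The inner factor turns p_{1+k} into p_{1+k} + ∂_k + η, passing B(Z) subtracts p_{1+k}[Z*] and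
    -- p_{1+k}[Z], and the outer factor cancels ∂_k + η.
    LHS-p* : ∀ {n} k P (ν : Vec ℤ n) → LHS (p[1+ k ] * P) ν ≈
      p[1+ k ] * LHS P ν + - (sum (λ i → LHS P (bump i -[1+ k ] ν)) + sum (λ i → LHS P (bump i (+ suc k) ν)))
    LHS-p* {n} k P ν = begin
      T⁻.T (Bv ν (T⁺.T (p[1+ k ] * P)))
        ≈⟨ T⁻.T-cong (≈-trans (Bv-cong ν (≈-trans (T⁺.T-p* k P) (+-congˡ (D-congˡ (κ-η k) x)))) (≈-trans (Bv-+ ν _ _) (+-congˡ (Bv-+ ν _ _)))) ⟩
      T⁻.T (Bv ν (p[1+ k ] * x) + (Bv ν (∂ k x) + Bv ν (con (η k) * x)))
        ≈⟨ T⁻.T-cong (+-cong (Bv-p* ν k x) (+-cong (Bv-∂ ν k x) (Bv-con* ν (η k) x))) ⟩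
      T⁻.T ((p[1+ k ] * y + - Σ⁺) + ((∂ k y + - Σ⁻) + con (η k) * y))
        ≈⟨ ≈-trans (T⁻.T-+ _ _) (+-cong (≈-trans (T⁻.T-+ _ _) (+-congˡ (T⁻.T-neg Σ⁺)))
             (≈-trans (T⁻.T-+ _ _) (+-cong (≈-trans (T⁻.T-+ _ _) (+-congˡ (T⁻.T-neg Σ⁻))) (T⁻.T-con* (η k) y)))) ⟩
      (T⁻.T (p[1+ k ] * y) + - T⁻.T Σ⁺) + ((T⁻.T (∂ k y) + - T⁻.T Σ⁻) + con (η k) * T⁻.T y)
        ≈⟨ +-cong (+-congʳ (≈-trans (T⁻.T-p* k y) (+-congˡ (-‿cong (D-congˡ (κ-η k) (T⁻.T y)))))) (+-congʳ (+-congʳ (T⁻.T-∂ k y))) ⟩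
      ((p[1+ k ] * T⁻.T y + - (∂ k (T⁻.T y) + con (η k) * T⁻.T y)) + - T⁻.T Σ⁺) + ((∂ k (T⁻.T y) + - T⁻.T Σ⁻) + con (η k) * T⁻.T y)
        ≈⟨ solveΛ 5 (λ p d e s t → ((p :+ :- (d :+ e)) :+ :- s) :+ ((d :+ :- t) :+ e) := p :+ :- (t :+ s)) ≈-refl _ _ _ _ _ ⟩
      p[1+ k ] * T⁻.T y + - (T⁻.T Σ⁻ + T⁻.T Σ⁺)
        ≈⟨ +-congˡ (-‿cong (+-cong (T⁻.T-sum n (λ i → Bv (bump i -[1+ k ] ν) x)) (T⁻.T-sum n (λ i → Bv (bump i (+ suc k) ν) x)))) ⟩
      p[1+ k ] * LHS P ν + - (sum (λ i → LHS P (bump i -[1+ k ] ν)) + sum (λ i → LHS P (bump i (+ suc k) ν))) ∎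
      where
      open ≈-Reasoning
      x = T⁺.T P
      y = Bv ν x
      Σ⁺ = sum λ i → Bv (bump i (+ suc k) ν) x
      Σ⁻ = sum λ i → Bv (bump i -[1+ k ] ν) x


map-*-1 : ∀ {n} (μ : Vec ℤ n) → Vec.map (+ 1 ℤ.*_) μ ≡ μ
map-*-1 []      = ≡.refl
map-*-1 (a ∷ μ) = ≡.cong₂ _∷_ (ℤ.*-identityˡ a) (map-*-1 μ)

-- The expansion of B(Z) 1

-- (1 - z_j / z_i) J, for a series J.
difference : ∀ {n} → Fin.Fin n × Fin.Fin n → (Vec ℤ n → Λ) → Vec ℤ n → Λ
difference (i , j) J ν = J ν + - J (bump i (+ 1) (bump j (ℤ.- + 1) ν))

differences : ∀ {n} → List (Fin.Fin n × Fin.Fin n) → (Vec ℤ n → Λ) → Vec ℤ n → Λ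
differences ps J = List.foldr difference J ps

differences-cong : ∀ {n} ps {J J′ : Vec ℤ n → Λ} → (∀ ν → J ν ≈ J′ ν) → ∀ ν → differences ps J ν ≈ differences ps J′ ν
differences-cong []       eq ν = eq ν
differences-cong (p ∷ ps) eq ν = +-cong (differences-cong ps eq ν) (-‿cong (differences-cong ps eq _))

differences-hom : ∀ {n} ps (φ : Λ → Λ) (J : Vec ℤ n → Λ) → (∀ x y → φ (x + y) ≈ φ x + φ y) → (∀ x → φ (- x) ≈ - φ x) →
  ∀ ν → φ (differences ps J ν) ≈ differences ps (φ ∘ J) ν
differences-hom []       φ J hom neg ν = ≈-refl
differences-hom (p ∷ ps) φ J hom neg ν = ≈-trans (hom _ _) (+-cong (differences-hom ps φ J hom neg ν) (≈-trans (neg _) (-‿cong (differences-hom ps φ J hom neg _))))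

-- The list of the definition of R, so that `factors (pairs n)` is R by computation.
pairs : ∀ n → List (Fin.Fin n × Fin.Fin n)
pairs n = List.filter (λ (i , j) → i Fin.<? j) (List.cartesianProduct (List.allFin n) (List.allFin n))

0,suc : ∀ {n} → Fin.Fin n → Fin.Fin (suc n) × Fin.Fin (suc n)
0,suc j = Fin.zero , Fin.suc j

suc,suc : ∀ {n} → Fin.Fin n × Fin.Fin n → Fin.Fin (suc n) × Fin.Fin (suc n)
suc,suc (i , j) = Fin.suc i , Fin.suc j

pairs-suc : ∀ n → pairs (suc n) ≡ List.map 0,suc (List.allFin n) ++ List.map suc,suc (pairs n)
pairs-suc n = ≡.trans (≡.cong (λ fs → List.filter P? (List.cartesianProduct (Fin.zero ∷ fs) (Fin.zero ∷ fs))) (≡.sym (List.map-tabulate id Fin.suc)))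
  (≡.trans (List.filter-++ P? (List.map (Fin.zero ,_) (List.map Fin.suc (List.allFin n))) _)
  (≡.cong₂ _++_ (first (List.allFin n)) (rest (List.allFin n) (List.allFin n))))
  where
  P? = λ ((i , j) : Fin.Fin (suc n) × Fin.Fin (suc n)) → i Fin.<? j
  first : ∀ js → List.filter P? (List.map (Fin.zero ,_) (List.map Fin.suc js)) ≡ List.map 0,suc js
  first []       = ≡.refl
  first (j ∷ js) = ≡.cong (_ ∷_) (first js)
  row : ∀ i js → List.filter P? (List.map (Fin.suc i ,_) (List.map Fin.suc js)) ≡ List.map suc,suc (List.filter (λ (i , j) → i Fin.<? j) (List.map (i ,_) js))
  row i []       = ≡.refl
  row i (j ∷ js) with does (i Fin.<? j)
  ... | true  = ≡.cong (_ ∷_) (row i js)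
  ... | false = row i js
  rest : ∀ is js → List.filter P? (List.cartesianProduct (List.map Fin.suc is) (Fin.zero ∷ List.map Fin.suc js)) ≡
    List.map suc,suc (List.filter (λ (i , j) → i Fin.<? j) (List.cartesianProduct is js))
  rest []       js = ≡.refl
  rest (i ∷ is) js = ≡.trans (List.filter-++ P? (List.map (Fin.suc i ,_) (List.map Fin.suc js)) _)
    (≡.trans (≡.cong₂ _++_ (row i js) (rest is js)) (≡.sym (≡.trans (≡.cong (List.map suc,suc) (List.filter-++ _ (List.map (i ,_) js) (List.cartesianProduct is js)))
      (List.map-++ suc,suc (List.filter _ (List.map (i ,_) js)) _))))

module Vandermonde (n : ℕ) where
  open Laurent n
  open LaurentRing n
  open Skewed n
  open RingOps rawRing using (productList)

  factor : Fin.Fin n × Fin.Fin n → LaurentPolynomial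
  factor (i , j) = 1ᴸ +ᴸ -ᴸ (z j *ᴸ z⁻¹ i)

  factors : List (Fin.Fin n × Fin.Fin n) → LaurentPolynomial
  factors ps = productList (List.map factor ps)

  factors-⊙ : ∀ ps J ν → (factors ps ⊙ J) ν ≈ differences ps J ν
  factors-⊙ []             J ν = ≈-trans (+-identityʳ _) (≈-trans (*-identityˡ _) (reflexive (≡.cong J (zipWith-minus-0 ν))))
  factors-⊙ ((i , j) ∷ ps) J ν = ≈-trans (sumTerms-* (factor (i , j)) (factors ps) _) (≈-trans (+-congˡ (+-identityʳ _)) (+-cong
      (≈-trans (sumTerms-cong (factors ps) λ c μ → *-cong (*-identityˡ c) (reflexive (≡.cong J (≡.cong (Vec.zipWith ℤ._-_ ν) (Vec.zipWith-identityˡ ℤ.+-identityˡ μ))))) (factors-⊙ ps J ν))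
      (≈-trans (≈-trans (sumTerms-cong (factors ps) λ c μ → ≈-trans (*-cong (unit c) (reflexive (≡.cong J (index μ)))) (≈-sym (S.-‿distribˡ-* _ _)))
          (≈-sym (sumTerms-hom (factors ps) -_ _ neg-+ S.-0#≈0#)))
        (-‿cong (factors-⊙ ps J (bump i (+ 1) (bump j (ℤ.- + 1) ν)))))))
    where
    unit : ∀ c → - (con 1ℚ * con 1ℚ) * c ≈ - c
    unit = solveΛ 1 (λ c → :- (K 1ℚ :* K 1ℚ) :* c := :- c) ≈-refl
    index : ∀ μ → Vec.zipWith ℤ._-_ ν (Vec.zipWith ℤ._+_ (Vec.zipWith ℤ._+_ (e j) (Vec.map ℤ.-_ (e i))) μ) ≡
      Vec.zipWith ℤ._-_ (bump i (+ 1) (bump j (ℤ.- + 1) ν)) μ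
    index μ = ≡.trans (zipWith-minus-plus ν _ μ) (≡.cong (λ ν → Vec.zipWith ℤ._-_ ν μ) (≡.trans (zipWith-minus-plus ν (e j) (Vec.map ℤ.-_ (e i)))
      (≡.trans (≡.cong₂ (λ μ ξ → Vec.zipWith ℤ._-_ (Vec.zipWith ℤ._-_ ν μ) ξ) (≡.sym (map-*-1 (e j))) (≡.sym (map-*-1 (Vec.map ℤ.-_ (e i)))))
      (≡.trans (≡.cong (λ ν → Vec.zipWith ℤ._-_ ν (Vec.map (+ 1 ℤ.*_) (Vec.map ℤ.-_ (e i)))) (bump-e (+ 1) j ν)) (bump-e⁻ (+ 1) i (bump j (ℤ.- + 1) ν))))))

  factors-++ : ∀ ps qs → factors (ps ++ qs) ≃ factors ps *ᴸ factors qs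
  factors-++ []       qs = SL.sym (SL.*-identityˡ (factors qs))
  factors-++ (p ∷ ps) qs = SL.trans (SL.*-congˡ {factor p} (factors-++ ps qs)) (SL.sym (SL.*-assoc (factor p) (factors ps) (factors qs)))

  ⊙-additive : ∀ (J : LaurentSeries) ν → Additive (λ c μ → c * J (Vec.zipWith ℤ._-_ ν μ))
  ⊙-additive J ν = record { cong = λ μ → *-congʳ ; add = λ c c′ μ → distribʳ _ c c′ }

  ⊙-* : ∀ L M J ν → ((L *ᴸ M) ⊙ J) ν ≈ (L ⊙ (M ⊙ J)) ν
  ⊙-* L M J ν = ≈-trans (sumTerms-* L M _) (sumTerms-cong L λ c μ → ≈-trans (sumTerms-cong M λ d ξ →
    ≈-trans (*-congˡ (reflexive (≡.cong J (zipWith-minus-plus ν μ ξ)))) (*-assoc _ _ _)) (sumTerms-*ˡ M c _))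

  ⊙-cong : ∀ L {J J′} → (∀ ν → J ν ≈ J′ ν) → ∀ ν → (L ⊙ J) ν ≈ (L ⊙ J′) ν
  ⊙-cong L eq ν = sumTerms-cong L λ c μ → *-congˡ (eq _)

  -- The fold applies ps last, whereas the induction in `differences-pairs` wants the first row
  -- applied to the series first. The factors commute as Laurent polynomials.
  differences-comm : ∀ ps qs J ν → differences (ps ++ qs) J ν ≈ differences qs (differences ps J) ν
  differences-comm ps qs J ν = ≈-trans (≈-sym (factors-⊙ (ps ++ qs) J ν)) (≈-trans
    (on (SL.trans (factors-++ ps qs) (SL.*-comm (factors ps) (factors qs))) _ (⊙-additive J ν))
    (≈-trans (⊙-* (factors qs) (factors ps) J ν) (≈-trans (⊙-cong (factors qs) (factors-⊙ ps J) ν) (factors-⊙ qs (differences ps J) ν))))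

-- Each h_a that B_r passes contributes one factor 1 - z_j / z_i with i the first index; this is
-- `V-u*` repeated along α.
differences-first-row : ∀ n r (α : Vec ℤ n) → differences (List.map 0,suc (List.allFin n)) hv (r ∷ α) ≈ B⁺ r (hv α)
differences-first-row zero    r []      = ≈-trans (*-identityʳ _) (≈-sym (V-1 Sign.+ r))
differences-first-row (suc n) r (a ∷ α) = ≈-trans
  (reflexive (≡.cong (λ js → differences (0,suc Fin.zero ∷ List.map 0,suc js) hv (r ∷ a ∷ α)) (≡.sym (List.map-tabulate id Fin.suc))))
  (≈-trans (+-cong (≈-trans (step (List.allFin n) r a) (*-congˡ (differences-first-row n r α)))
    (-‿cong (≈-trans (step (List.allFin n) (r ℤ.+ + 1) (a ℤ.- + 1)) (*-congˡ (differences-first-row n (r ℤ.+ + 1) α)))))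
  (≈-sym (V-u* Sign.+ r a (hv α))))
  where
  step : ∀ js r a {α} → differences (List.map 0,suc (List.map Fin.suc js)) hv (r ∷ a ∷ α) ≈ H a * differences (List.map 0,suc js) hv (r ∷ α)
  step []       r a = x∙yz≈y∙xz _ _ _
  step (j ∷ js) r a = ≈-trans (+-cong (step js r a) (-‿cong (step js (r ℤ.+ + 1) a)))
    (solveΛ 3 (λ h x y → h :* x :+ :- (h :* y) := h :* (x :+ :- y)) ≈-refl _ _ _)

-- The pairs containing the first index produce the outermost B_r; the remaining ones act on α alone
-- and so pass through B_r by linearity.
differences-pairs : ∀ {n} (ν : Vec ℤ n) → differences (pairs n) hv ν ≈ Bv ν (con 1ℚ)
differences-pairs []              = ≈-refl
differences-pairs {suc n} (r ∷ α) = ≈-trans (reflexive (≡.cong (λ ps → differences ps hv (r ∷ α)) (pairs-suc n)))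
  (≈-trans (Vandermonde.differences-comm (suc n) (List.map 0,suc (List.allFin n)) (List.map suc,suc (pairs n)) hv (r ∷ α))
  (≈-trans (differences-cong (List.map suc,suc (pairs n)) {J′ = row} (λ { (r ∷ α) → differences-first-row n r α }) (r ∷ α))
  (≈-trans (step (pairs n) r α) (V-cong Sign.+ r (differences-pairs α)))))
  where
  row : Vec ℤ (suc n) → Λ
  row (r ∷ α) = B⁺ r (hv α)
  step : ∀ ps r α → differences (List.map suc,suc ps) row (r ∷ α) ≈ B⁺ r (differences ps hv α)
  step []       r α = ≈-refl
  step (p ∷ ps) r α = ≈-trans (+-cong (step ps r α) (≈-trans (-‿cong (step ps r _)) (≈-sym (V-neg Sign.+ r _)))) (≈-sym (V-+ Sign.+ r _ _))

-- The local function of _∙_ cannot be named. As for toLaurentSeries, with-abstraction turns its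
-- arguments into distinct variables, so that unification finds it; the library functions are
-- abstracted as well, lest they reduce.
mutual
  below : ∀ N (F G : Vec ℕ N → Λ) (α : Vec ℕ N) {m} → Vec ℕ m → List (Vec ℕ m)
  below = _

  find-below : ∀ m (F G : Vec ℕ (suc m) → Λ) a α → Laurent._∙_ (suc m) F G (a ∷ α) ≡ Laurent._∙_ (suc m) F G (a ∷ α)
  find-below m F G a α
    with suc m | F | G | a ∷ α | List.foldr {A = Vec ℕ (suc m)} {B = Λ} | List._++_ {A = Vec ℕ (suc m)}
       | List.map {A = Vec ℕ m} {B = Vec ℕ (suc m)} (0 ∷_) | List.cartesianProductWith {A = ℕ} {B = Vec ℕ m} {C = Vec ℕ (suc m)} _∷_
  ... | N | F | G | β | fold | append | mp | cp = ≡.refl {x = fold _ (con 0ℚ) (append (mp (below N F G β α)) (cp _ (below N F G β α)))}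

-- Skewing Ω[ZX]

nest : ∀ {m} → Vec ℕ m → (Vec ℕ m → Λ) → Λ
nest []      g = g []
nest (a ∷ α) g = ∑ a λ b → nest α λ β → g (b ∷ β)

nest-cong : ∀ {m} (α : Vec ℕ m) {g g′} → (∀ β → Vec.sum β ℕ.≤ Vec.sum α → g β ≈ g′ β) → nest α g ≈ nest α g′
nest-cong []      eq = eq [] z≤n
nest-cong (a ∷ α) eq = S.∑-cong a λ b b≤a → nest-cong α λ β β≤α → eq (b ∷ β) (ℕ.+-mono-≤ b≤a β≤α)

nest-*ˡ : ∀ {m} (α : Vec ℕ m) c g → c * nest α g ≈ nest α λ β → c * g β
nest-*ˡ []      c g = ≈-refl
nest-*ˡ (a ∷ α) c g = ≈-trans (≈-sym (S.∑-*ˡ a c _)) (S.∑-cong a λ b _ → nest-*ˡ α c (g ∘ (b ∷_)))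

nest-∑ : ∀ {m} (α : Vec ℕ m) N (g : ℕ → Vec ℕ m → Λ) → ∑ N (λ d → nest α (g d)) ≈ nest α λ β → ∑ N λ d → g d β
nest-∑ []      N g = ≈-refl
nest-∑ (a ∷ α) N g = ≈-trans (S.∑-swap N a λ d b → nest α λ β → g d (b ∷ β)) (S.∑-cong a λ b _ → nest-∑ α N λ d β → g d (b ∷ β))

sumList : ∀ {A : Set} → List A → (A → Λ) → Λ
sumList xs g = List.foldr (λ x a → g x + a) (con 0ℚ) xs

sumList-++ : ∀ {A : Set} xs ys (g : A → Λ) → sumList (xs ++ ys) g ≈ sumList xs g + sumList ys g
sumList-++ []       ys g = ≈-sym (+-identityˡ _)
sumList-++ (x ∷ xs) ys g = ≈-trans (+-congˡ (sumList-++ xs ys g)) (≈-sym (+-assoc _ _ _))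

sumList-map : ∀ {A B : Set} (φ : A → B) xs g → sumList (List.map φ xs) g ≡ sumList xs (g ∘ φ)
sumList-map φ []       g = ≡.refl
sumList-map φ (x ∷ xs) g = ≡.cong (λ s → g (φ x) + s) (sumList-map φ xs g)

sumList-product : ∀ {m} xs (ys : List (Vec ℕ m)) g → sumList (List.cartesianProductWith _∷_ xs ys) g ≈ sumList xs λ x → sumList ys λ y → g (x ∷ y)
sumList-product []       ys g = ≈-refl
sumList-product (x ∷ xs) ys g = ≈-trans (sumList-++ (List.map (x ∷_) ys) _ g) (+-cong (reflexive (sumList-map (x ∷_) ys g)) (sumList-product xs ys g))

sumList-upTo : ∀ a φ (g : ℕ → Λ) → sumList (List.applyUpTo φ (suc a)) g ≈ ∑ a (g ∘ φ)
sumList-upTo zero    φ g = +-identityʳ _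
sumList-upTo (suc a) φ g = +-congˡ (sumList-upTo a (φ ∘ suc) g)

∙-nest : ∀ {n} (F G : Vec ℕ n → Λ) α → Laurent._∙_ n F G α ≈ nest α λ β → F β * G (Vec.zipWith ℕ._∸_ α β)
∙-nest {n} F G α = step α _
  where
  step : ∀ {m} (β : Vec ℕ m) g → sumList (below n F G α β) g ≈ nest β g
  step []      g = +-identityʳ _
  step (b ∷ β) g = ≈-trans (sumList-product (List.upTo (suc b)) (below n F G α β) g)
    (≈-trans (sumList-upTo b id _) (S.∑-cong b λ c _ → step β (g ∘ (c ∷_))))

shift-< : ∀ k b d → d ℕ.< k → shift k b d ≡ con 0ℚ
shift-< (suc k) b zero    _         = ≡.refl
shift-< (suc k) b (suc d) (s≤s d<k) = shift-< k b d d<k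

-- Moving G^⊥ past Ω[zX] replaces G by G[X + z], in which the coefficient of z^b is h_b^⊥ G.
D-H* : ∀ G a Q → D G (H (+ a) * Q) ≈ ∑ a λ b → H (+ (a ℕ.∸ b)) * D (D (u Sign.+ b) G) Q
D-H* = Λ-ind (λ G → ∀ a Q → D G (H (+ a) * Q) ≈ ∑ a λ b → H (+ (a ℕ.∸ b)) * D (D (hs b) G) Q)
  (λ eq IH a Q → ≈-trans (D-congˡ (≈-sym eq) _) (≈-trans (IH a Q) (S.∑-cong a λ b _ → *-congˡ {H (+ (a ℕ.∸ b))} (D-congˡ (D-congʳ (hs b) eq) Q))))
  (λ {G} {G′} IH IH′ a Q → ≈-trans (+-cong (IH a Q) (IH′ a Q)) (≈-trans (≈-sym (S.∑-+ a (λ b → H (+ (a ℕ.∸ b)) * D (D (hs b) G) Q) (λ b → H (+ (a ℕ.∸ b)) * D (D (hs b) G′) Q)))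
    (S.∑-cong a λ b _ → ≈-trans (≈-sym (distribˡ _ _ _)) (*-congˡ {H (+ (a ℕ.∸ b))} (D-congˡ (≈-sym (D-+ (hs b) G G′)) Q)))))
  (λ q {G} IH a Q → ≈-trans (*-congˡ (IH a Q)) (≈-trans (≈-sym (S.∑-*ˡ a (con q) (λ b → H (+ (a ℕ.∸ b)) * D (D (hs b) G) Q)))
    (S.∑-cong a λ b _ → ≈-trans (x∙yz≈y∙xz _ _ _) (*-congˡ {H (+ (a ℕ.∸ b))} (D-congˡ (≈-sym (D-con* (hs b) q G)) Q)))))
  step
  (λ a Q → ≈-trans (*-identityˡ _) (≈-sym (≈-trans (S.∑-extend {0} {a} _ z≤n λ { (suc b) _ → ≈-trans
      (*-congˡ {H (+ (a ℕ.∸ suc b))} (≈-trans (D-congˡ (order-kills (order-u Sign.+ (suc b)) (low-con {0} {1ℚ}) (s≤s z≤n)) Q) (zeroˡ Q))) (zeroʳ _) })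
    (*-congˡ (≈-trans (D-congˡ (D-u0 Sign.+ (con 1ℚ)) Q) (*-identityˡ Q))))))
  where
  hs : ℕ → Λ
  hs = u Sign.+
  step : ∀ k {G} → (∀ a Q → D G (H (+ a) * Q) ≈ ∑ a λ b → H (+ (a ℕ.∸ b)) * D (D (hs b) G) Q) →
    ∀ a Q → D (p[1+ k ] * G) (H (+ a) * Q) ≈ ∑ a λ b → H (+ (a ℕ.∸ b)) * D (D (hs b) (p[1+ k ] * G)) Q
  step k {G} IH a Q = begin
    ∂ k (D G (H (+ a) * Q))
      ≈⟨ D-∂-comm G k (H (+ a) * Q) ⟨
    D G (∂ k (H (+ a)) * Q + H (+ a) * ∂ k Q)
      ≈⟨ ≈-trans (D-+ G _ _) (+-comm _ _) ⟩
    D G (H (+ a) * ∂ k Q) + D G (∂ k (H (+ a)) * Q)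
      ≈⟨ +-cong (IH a (∂ k Q)) (≈-trans (D-congʳ G (*-congʳ (≈-trans (∂-u k Sign.+ a) (*-identityˡ _)))) (lower (suc k ℕ.≤? a))) ⟩
    ∑ a (λ b → H (+ (a ℕ.∸ b)) * D (D (hs b) G) (∂ k Q)) + ∑ a (λ b → H (+ (a ℕ.∸ b)) * D (D (shift (suc k) hs b) G) Q)
      ≈⟨ S.∑-+ a (λ b → H (+ (a ℕ.∸ b)) * D (D (hs b) G) (∂ k Q)) (λ b → H (+ (a ℕ.∸ b)) * D (D (shift (suc k) hs b) G) Q) ⟨
    ∑ a (λ b → H (+ (a ℕ.∸ b)) * D (D (hs b) G) (∂ k Q) + H (+ (a ℕ.∸ b)) * D (D (shift (suc k) hs b) G) Q)
      ≈⟨ S.∑-cong a (λ b _ → ≈-trans (≈-sym (distribˡ _ _ _)) (*-congˡ {H (+ (a ℕ.∸ b))} (merge b))) ⟩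
    ∑ a (λ b → H (+ (a ℕ.∸ b)) * D (D (hs b) (p[1+ k ] * G)) Q) ∎
    where
    open ≈-Reasoning
    merge : ∀ b → D (D (hs b) G) (∂ k Q) + D (D (shift (suc k) hs b) G) Q ≈ D (D (hs b) (p[1+ k ] * G)) Q
    merge b = ≈-sym (≈-trans (D-congˡ (≈-trans (D-p* (hs b) k G) (+-congˡ (D-congˡ (≈-trans (∂-u k Sign.+ b) (*-identityˡ _)) G))) Q)
      (+-congʳ (≈-sym (D-∂-comm (D (hs b) G) k Q))))
    -- For a < 1 + k both sides vanish; otherwise the delayed summands drop out and the induction
    -- hypothesis applies at a - (1 + k).
    lower : Dec (suc k ℕ.≤ a) → D G (shift (suc k) hs a * Q) ≈ ∑ a (λ b → H (+ (a ℕ.∸ b)) * D (D (shift (suc k) hs b) G) Q)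
    lower (no k≰a) = ≈-trans (D-congʳ G (≈-trans (*-congʳ (reflexive (shift-< (suc k) hs a (ℕ.≰⇒> k≰a)))) (zeroˡ Q))) (≈-trans (D-0 G)
      (≈-sym (S.∑-0 a λ b b≤a → ≈-trans (*-congˡ {H (+ (a ℕ.∸ b))} (≈-trans (D-congˡ (≈-trans
        (D-congˡ (reflexive (shift-< (suc k) hs b (ℕ.≤-<-trans b≤a (ℕ.≰⇒> k≰a)))) G) (zeroˡ G)) Q) (zeroˡ Q))) (zeroʳ _))))
    lower (yes k≤a) = ≡.subst (λ a → D G (shift (suc k) hs a * Q) ≈ ∑ a (λ b → H (+ (a ℕ.∸ b)) * D (D (shift (suc k) hs b) G) Q)) (ℕ.m+[n∸m]≡n k≤a) (exact (a ℕ.∸ suc k))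
      where
      shift-+ : ∀ k b d → shift k b (k ℕ.+ d) ≡ b d
      shift-+ zero    b d = ≡.refl
      shift-+ (suc k) b d = shift-+ k b d
      exact : ∀ N → D G (shift (suc k) hs (suc k ℕ.+ N) * Q) ≈ ∑ (suc k ℕ.+ N) (λ b → H (+ (suc k ℕ.+ N ℕ.∸ b)) * D (D (shift (suc k) hs b) G) Q)
      exact N = ≈-trans (D-congʳ G (*-congʳ (reflexive (shift-+ (suc k) hs N)))) (≈-trans (IH N Q) (≈-sym (≈-trans
        (S.∑-delay (con 0ℚ) (suc k) N (λ b x → H (+ (suc k ℕ.+ N ℕ.∸ b)) * D (D x G) Q) hs
          (λ b → ≈-trans (*-congˡ {H (+ (suc k ℕ.+ N ℕ.∸ b))} (≈-trans (D-congˡ (zeroˡ G) Q) (zeroˡ Q))) (zeroʳ _)))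
        (S.∑-cong N λ b _ → *-congʳ {D (D (hs b) G) Q} (reflexive (≡.cong (λ m → H (+ m)) (ℕ.[m+n]∸[m+o]≡n∸o k N b)))))))

-- The coefficient form of G^⊥ Ω[ZX] = G[Z] Ω[ZX], the coefficient of z^β in G[Z] being the pairing
-- of G with h_β.
D-hv : ∀ {n} G (α : Vec ℕ n) → D G (hv (Vec.map +_ α)) ≈ nest α λ β → pair G (hv (Vec.map +_ β)) * hv (Vec.map +_ (Vec.zipWith ℕ._∸_ α β))
D-hv G []      = ≈-trans (D-con G 1ℚ) (≈-sym (≈-trans (*-identityʳ _) (reflexive (≡.cong con (ε-cong (D-con G 1ℚ))))))
D-hv G (a ∷ α) = ≈-trans (D-H* G a (hv (Vec.map +_ α))) (S.∑-cong a λ b _ → ≈-trans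
  (*-congˡ {H (+ (a ℕ.∸ b))} (D-hv (D (u Sign.+ b) G) α)) (≈-trans (nest-*ˡ α (H (+ (a ℕ.∸ b))) _) (nest-cong α λ β _ → ≈-trans (x∙yz≈y∙xz _ _ _)
    (*-congʳ (reflexive (≡.cong con (≡.sym (⟪⟫-adjoint (u Sign.+ b) G (hv (Vec.map +_ β))))))))))

low-u : ∀ σ d → Low (suc d) (u σ d)
low-u σ d = ≡.subst (Low (suc d)) (u-Ω σ d) (S.Ω-filtered (Low ∘ suc) low-≈ low-+ (low-* ≡.refl) (λ q → low-con) (±X σ)
  (λ k → low-≈ (≈-sym (ψ-±X σ k)) (low-con* (sg σ) (low-p ℕ.≤-refl))) d)

low-hv : ∀ {n} (α : Vec ℕ n) → Low (suc (Vec.sum α)) (hv (Vec.map +_ α))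
low-hv []      = low-con
low-hv (a ∷ α) = low-* ≡.refl (low-u Sign.+ a) (low-hv α)


-- Plethystic substitution of Z

module Plethysm (n : ℕ) where
  open Laurent n
  open LaurentRing n
  open Skewed n
  open Monomials n

  -- The local function of plethysm, found as for toLaurentSeries.
  mutual
    substitute : Λ → LaurentPolynomial → Λ → LaurentPolynomial
    substitute = _

    find-substitute : ∀ P Q A → (P + Q) ⟦ A ⟧ ≡ (P + Q) ⟦ A ⟧
    find-substitute P Q A with P + Q | List._++_ {A = Λ × Vec ℤ n}
    ... | S | append = ≡.refl {x = append (substitute S A P) (substitute S A Q)}

  _[Z] : Λ → LaurentPolynomial
  P [Z] = substitute (con 0ℚ) Z P

  ⟦Z⟧-[Z] : ∀ P → P ⟦ Z ⟧ ≡ P [Z]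
  ⟦Z⟧-[Z] P = same P P
    where
    same : ∀ w P → substitute w Z P ≡ P [Z]
    same w (con q)  = ≡.refl
    same w p[1+ k ] = ≡.refl
    same w (P + Q)  = ≡.cong₂ _+ᴸ_ (same w P) (same w Q)
    same w (P * Q)  = ≡.cong₂ _*ᴸ_ (same w P) (same w Q)
    same w (- P)    = ≡.cong -ᴸ_ (same w P)

  [Z]-cong : ∀ {P Q} → P ≈ Q → P [Z] ≃ Q [Z]
  [Z]-cong ≈-refl           = SL.refl
  [Z]-cong (≈-sym eq)       = SL.sym ([Z]-cong eq)
  [Z]-cong (≈-trans eq eq′) = SL.trans ([Z]-cong eq) ([Z]-cong eq′)
  [Z]-cong (+-cong eq eq′)  = SL.+-cong ([Z]-cong eq) ([Z]-cong eq′)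
  [Z]-cong (*-cong eq eq′)  = SL.*-cong ([Z]-cong eq) ([Z]-cong eq′)
  [Z]-cong (-‿cong eq)      = SL.-‿cong ([Z]-cong eq)
  [Z]-cong (+-assoc P Q S)  = SL.+-assoc (P [Z]) (Q [Z]) (S [Z])
  [Z]-cong (+-comm P Q)     = SL.+-comm (P [Z]) (Q [Z])
  [Z]-cong (+-identityˡ P)  = SL.trans (SL.+-congʳ {P [Z]} SL.con-0) (SL.+-identityˡ (P [Z]))
  [Z]-cong (-‿inverseˡ P)   = SL.trans (SL.-‿inverseˡ (P [Z])) (SL.sym SL.con-0)
  [Z]-cong (*-assoc P Q S)  = SL.*-assoc (P [Z]) (Q [Z]) (S [Z])
  [Z]-cong (*-comm P Q)     = SL.*-comm (P [Z]) (Q [Z])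
  [Z]-cong (*-identityˡ P)  = SL.trans (SL.*-congʳ {P [Z]} SL.con-1) (SL.*-identityˡ (P [Z]))
  [Z]-cong (distribˡ P Q S) = SL.distribˡ (P [Z]) (Q [Z]) (S [Z])
  [Z]-cong (con-+ a b)      = SL.con-+ a b
  [Z]-cong (con-* a b)      = SL.con-* a b

  ψ-Z : ∀ k j → ψ (ℕ.pred (suc k ℕ.* suc j)) Z ≃ ψ k (ψ j Z)
  ψ-Z k j = equal λ g ag → ≈-trans (sumTerms-ψZ _ g) (≈-trans (sum-cong n λ i → reflexive (≡.cong (g (con 1ℚ)) (compose (e i))))
    (≈-sym (≈-trans (reflexive (sumTerms-map _ (ψ j Z) g)) (sumTerms-ψZ j _))))
    where
    compose : ∀ {m} (μ : Vec ℤ m) → Vec.map (+ (suc k ℕ.* suc j) ℤ.*_) μ ≡ Vec.map (+ suc k ℤ.*_) (Vec.map (+ suc j ℤ.*_) μ)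
    compose []      = ≡.refl
    compose (a ∷ μ) = ≡.cong₂ _∷_ (≡.trans (≡.cong (ℤ._* a) (ℤ.pos-* (suc k) (suc j))) (ℤ.*-assoc (+ suc k) (+ suc j) a)) (compose μ)

  ψ-[Z] : ∀ k P → Λ-ψ[1+ k ] P [Z] ≃ ψ k (P [Z])
  ψ-[Z] k (con q)  = SL.reflexive (≡.cong (λ μ → (con q , μ) ∷ []) (≡.sym (map-*-0 (+ suc k))))
  ψ-[Z] k p[1+ j ] = ψ-Z k j
  ψ-[Z] k (P + Q)  = SL.trans (SL.+-cong (ψ-[Z] k P) (ψ-[Z] k Q)) (SL.reflexive (≡.sym (List.map-++ _ (P [Z]) (Q [Z]))))
  ψ-[Z] k (P * Q)  = SL.trans (SL.*-cong (ψ-[Z] k P) (ψ-[Z] k Q)) (SL.sym (ψ-* k (P [Z]) (Q [Z])))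
  ψ-[Z] k (- P)    = SL.trans (SL.-‿cong (ψ-[Z] k P)) (SL.sym (ψ-neg k (P [Z])))

  [Z]-⊛ : ∀ a b d → (a ⊛ b) d [Z] ≃ SL._⊛_ (_[Z] ∘ a) (_[Z] ∘ b) d
  [Z]-⊛ a b zero    = SL.refl
  [Z]-⊛ a b (suc d) = SL.+-congˡ {a 0 [Z] *ᴸ b (suc d) [Z]} ([Z]-⊛ (a ∘ suc) b d)

  -- Substituting Z commutes with the power operations, so both sequences satisfy the same Newton
  -- recursion.
  Ω-[Z] : ∀ a d → ΩΛ a d [Z] ≃ Ω (a [Z]) d
  Ω-[Z] a = natural (ΩΛ a) (S.Ω-0 a) (S.newton a) (Ω (a [Z])) (SL.Ω-0 (a [Z])) (SL.newton (a [Z]))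
    where
    natural : ∀ E → E 0 ≈ con 1ℚ → (∀ d → con (ℕ→ℚ (suc d)) * E (suc d) ≈ ((λ k → Λ-ψ[1+ k ] a) ⊛ E) d) →
      ∀ E′ → E′ 0 ≃ 1ᴸ → (∀ d → SL.con (ℕ→ℚ (suc d)) *ᴸ E′ (suc d) ≃ SL._⊛_ (λ k → ψ k (a [Z])) E′ d) → ∀ d → E d [Z] ≃ E′ d
    natural E E0 En E′ E′0 E′n = SL.newton-unique {λ k → ψ k (a [Z])} {_[Z] ∘ E} {E′} (SL.trans ([Z]-cong E0) (SL.trans SL.con-1 (SL.sym E′0)))
      (λ d → SL.trans ([Z]-cong (En d)) (SL.trans ([Z]-⊛ (λ k → Λ-ψ[1+ k ] a) E d) (SL.⊛-congʳ {λ k → Λ-ψ[1+ k ] a [Z]} {λ k → ψ k (a [Z])} {_[Z] ∘ E} (λ k → ψ-[Z] k a) d))) E′n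

  coeff-con* : ∀ q L ν → coeff (SL.con q *ᴸ L) ν ≈ con q * coeff L ν
  coeff-con* q L ν = ≈-trans (sumTerms-* (SL.con q) L _) (≈-trans (+-identityʳ _) (≈-trans (sumTerms-cong L λ c μ →
      ≈-trans (reflexive (≡.cong (λ μ → if does (≡-dec ℤ._≟_ μ ν) then con q * c else con 0ℚ) (Vec.zipWith-identityˡ ℤ.+-identityˡ μ))) (scale c μ))
    (sumTerms-*ˡ L (con q) _)))
    where
    scale : ∀ c μ → (if does (≡-dec ℤ._≟_ μ ν) then con q * c else con 0ℚ) ≈ con q * (if does (≡-dec ℤ._≟_ μ ν) then c else con 0ℚ)
    scale c μ with does (≡-dec ℤ._≟_ μ ν)
    ... | true  = ≈-refl
    ... | false = ≈-sym (zeroʳ _)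

  -- Multiplication by p_{1+k}[Z] sums over the lowered exponents, exactly as `∂ k` does on h_ν. The
  -- extra factor L lets the induction pass through products.
  coeff-[Z]* : ∀ P {Q L} → (∀ ν → coeff L ν ≈ pair Q (hv ν)) → ∀ ν → coeff (P [Z] *ᴸ L) ν ≈ pair (P * Q) (hv ν)
  coeff-[Z]* (con q)  {Q} {L} eq ν = ≈-trans (coeff-con* q L ν) (≈-trans (*-congˡ (eq ν)) (≈-sym (con-* q _)))
  coeff-[Z]* p[1+ k ] {Q} {L} eq ν = ≈-trans (coeff-ψZ* k L ν) (≈-trans (sum-cong n λ i → eq (bump i -[1+ k ] ν))
    (≈-sym (≈-trans (pair-p* k Q (hv ν)) (≈-trans (pair-cong Q (∂-hv k ν)) (pair-sum Q n _)))))
  coeff-[Z]* (P + P′) {Q} {L} eq ν = ≈-trans (coeff-≃ (SL.distribʳ L (P [Z]) (P′ [Z])) ν) (≈-trans (sumTerms-++ (P [Z] *ᴸ L) _ _)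
    (≈-trans (+-cong (coeff-[Z]* P {Q} eq ν) (coeff-[Z]* P′ {Q} eq ν)) (≈-sym (con-+ _ _))))
  coeff-[Z]* (P * P′) {Q} {L} eq ν = ≈-trans (coeff-≃ (SL.*-assoc (P [Z]) (P′ [Z]) L) ν) (coeff-[Z]* P {P′ * Q} (coeff-[Z]* P′ {Q} eq) ν)
  coeff-[Z]* (- P)    {Q} {L} eq ν = ≈-trans (coeff-≃ (SL.sym (SL.-‿distribˡ-* (P [Z]) L)) ν) (≈-trans (sumTerms-neg (P [Z] *ᴸ L) _ (coeff-additive ν))
    (≈-trans (-‿cong (coeff-[Z]* P {Q} eq ν)) (≈-sym (con-neg _))))

  coeff-[Z] : ∀ P ν → coeff (P [Z]) ν ≈ pair P (hv ν)
  coeff-[Z] P ν = ≈-trans (coeff-≃ (SL.sym (SL.*-identityʳ (P [Z]))) ν) (≈-trans (coeff-[Z]* P {con 1ℚ} {1ᴸ}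
    (λ ν → ≈-trans (coeff-1 ν) (reflexive (≡.cong con (≡.sym (≡.trans (ℚ.*-identityˡ _) (ε-hv ν)))))) ν) (pair-congˡ (hv ν) (*-identityʳ P)))

  -- A free bound M is needed, because a product of series sums over all β below α and wants one
  -- bound for all of them.
  Ω⟨[Z]⟩ : ∀ a {M} α → (∀ d → Order≥ d (ΩΛ a d)) → Vec.sum α ℕ.≤ M → Ω⟨ a ⟦ Z ⟧ ⟩ α ≈ ∑ M λ d → pair (ΩΛ a d) (hv (Vec.map +_ α))
  Ω⟨[Z]⟩ a {M} α o α≤M = ≈-trans (reflexive (≡.cong (λ A → Ω⟨ A ⟩ α) (⟦Z⟧-[Z] a))) (≈-trans (S.sum≤-∑ (Vec.sum α) _)
    (≈-trans (S.∑-cong (Vec.sum α) λ d _ → ≈-trans (coeff-≃ (SL.sym (Ω-[Z] a d)) (Vec.map +_ α)) (coeff-[Z] (ΩΛ a d) (Vec.map +_ α)))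
    (≈-sym (S.∑-extend _ α≤M λ d α<d → reflexive (≡.cong con (ε-cong (order-kills (o d) (low-hv α) α<d)))))))


-- The identity

-- The three f ◇ are of the form α p_1 + p_1² / 2 + γ p_2.
module Quadratic {a : Λ} (α γ : ℚ) (a≈ : a ≈ con α * p[1+ 0 ] + (con ℚ.½ * (p[1+ 0 ] * p[1+ 0 ]) + con γ * p[1+ 1 ])) where
  -- p[1+ twice i ] is the power sum of index 2(1 + i), the image of p_2 under the power operation
  -- of index 1 + i.
  twice : ℕ → ℕ
  twice i = suc (i ℕ.* 2)

  ψ-a : ∀ i → Λ-ψ[1+ i ] a ≈ con α * p[1+ i ] + (con ℚ.½ * (p[1+ i ] * p[1+ i ]) + con γ * p[1+ twice i ])
  ψ-a i = ≈-trans (Λ-ψ-cong i a≈) (+-cong (*-congˡ p-i) (+-congʳ (*-congˡ (*-cong p-i p-i))))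
    where
    p-i : p[1+ i ℕ.* 1 ] ≈ p[1+ i ]
    p-i = reflexive (≡.cong p[1+_] (ℕ.*-identityʳ i))

  i≤twice : ∀ i → i ℕ.≤ twice i
  i≤twice i = ℕ.m≤n⇒m≤1+n (≡.subst (ℕ._≤ i ℕ.* 2) (ℕ.*-identityʳ i) (ℕ.*-monoʳ-≤ i (s≤s z≤n)))

  ψ-order : ∀ k → Order≥ (suc k) (Λ-ψ[1+ k ] a)
  ψ-order k = order-≈ (≈-sym (ψ-a k)) (order-+ (order-* {0} (order-con α) (order-p k))
    (order-+ (order-* {0} (order-con ℚ.½) (order-mono (ℕ.m≤m+n (suc k) (suc k)) (order-* (order-p k) (order-p k))))
      (order-mono (s≤s (i≤twice k)) (order-* {0} (order-con γ) (order-p (twice k))))))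

  q : ℕ → ℕ → Λ
  q k i = ∂ k (S.logΩ a (suc i))

  constant : ℕ → ℕ → ℚ
  constant k i = (+ 1 ℚ./ suc i) ℚ.* (α ℚ.* kron k i ℚ.+ γ ℚ.* kron k (twice i))

  q≈ : ∀ k i → q k i ≈ con (+ 1 ℚ./ suc i) * con (kron k i) * p[1+ i ] + con (constant k i)
  q≈ k i = ≈-trans (∂-con* k (+ 1 ℚ./ suc i) (Λ-ψ[1+ i ] a)) (≈-trans (*-congˡ (≈-trans (∂-cong k (ψ-a i))
      (+-cong (∂-con* k α p[1+ i ]) (+-cong (∂-con* k ℚ.½ (p[1+ i ] * p[1+ i ])) (∂-con* k γ p[1+ twice i ])))))
    (≈-trans (solveΛ 6 (λ r α κ p γ κ′ → r :* (α :* κ :+ (K ℚ.½ :* (κ :* p :+ p :* κ) :+ γ :* κ′)) := r :* κ :* p :+ r :* (α :* κ :+ γ :* κ′)) ≈-refl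
      (con (+ 1 ℚ./ suc i)) (con α) (con (kron k i)) p[1+ i ] (con γ) (con (kron k (twice i))))
    (+-congˡ (≈-sym (≈-trans (con-* (+ 1 ℚ./ suc i) _) (*-congˡ (≈-trans (con-+ _ _) (+-cong (con-* α _) (con-* γ _)))))))))

  kron-< : ∀ {k i} → k ℕ.< i → kron k i ≡ 0ℚ
  kron-< k<i = kron-≢ (ℕ.<⇒≢ k<i)

  bounded : ∀ k i → k ℕ.< i → q k i ≈ con 0ℚ
  bounded k i k<i = ≈-trans (q≈ k i) (≈-trans (+-cong
    (≈-trans (*-congʳ (≈-trans (*-congˡ (reflexive (≡.cong con (kron-< k<i)))) (zeroʳ _))) (zeroˡ _))
    (reflexive (≡.cong con (≡.trans (≡.cong ((+ 1 ℚ./ suc i) ℚ.*_) (≡.trans (≡.cong₂ (λ x y → α ℚ.* x ℚ.+ γ ℚ.* y) (kron-< k<i) (kron-< (ℕ.≤-trans k<i (i≤twice i))))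
      (≡.cong₂ ℚ._+_ (ℚ.*-zeroʳ α) (ℚ.*-zeroʳ γ)))) (ℚ.*-zeroʳ (+ 1 ℚ./ suc i))))))  (+-identityˡ _))

  κ : ℕ → Λ
  κ k = ∑ k (q k)

  -- Equal to α, plus 2γ when 1 + k is even. Here ε only reads off the rational number, all summands
  -- being constants.
  η : ℕ → ℚ
  η k = ε (∑ k (con ∘ constant k))

  ∑-con : ∀ N (c : ℕ → ℚ) → ∑ N (con ∘ c) ≈ con (ε (∑ N (con ∘ c)))
  ∑-con zero    c = ≈-refl
  ∑-con (suc N) c = ≈-trans (+-congˡ (∑-con N (c ∘ suc))) (≈-sym (con-+ _ _))

  -- The square p_1² / 2 contributes p_{1+k}, the factor 1 / (1 + k) of the logarithm cancelling the
  -- 1 + k in `∂ k`; the linear terms contribute constants.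
  κ-η : ∀ k → κ k ≈ p[1+ k ] + con (η k)
  κ-η k = ≈-trans (S.∑-cong k λ i _ → q≈ k i) (≈-trans (S.∑-+ k (λ i → con (+ 1 ℚ./ suc i) * con (kron k i) * p[1+ i ]) (con ∘ constant k))
    (+-cong (≈-trans (S.∑-cong k λ i _ → *-congʳ {p[1+ i ]} (≈-trans (≈-sym (con-* _ _)) (reflexive (≡.cong con (diagonal-kron i))))) (∑-δ k p[1+_] k ℕ.≤-refl))
      (∑-con k (constant k))))
    where
    diagonal-kron : ∀ i → (+ 1 ℚ./ suc i) ℚ.* kron k i ≡ δ i k
    diagonal-kron i = ≡.trans (≡.cong ((+ 1 ℚ./ suc i) ℚ.*_) (kron-sym k i)) (≡.trans (≡.sym (ℚ.*-assoc (+ 1 ℚ./ suc i) (ℕ→ℚ (suc i)) (δ i k)))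
      (≡.trans (≡.cong (ℚ._* δ i k) (1/suc*suc i)) (ℚ.*-identityˡ (δ i k))))

  log⁺ : Log a κ
  log⁺ = record { ψ-order = ψ-order ; bounded = bounded ; ∂-log = λ k → ≈-refl }

  log⁻ : Log (- a) (-_ ∘ κ)
  log⁻ = record
    { ψ-order = λ k → order-neg (ψ-order k)
    ; bounded = λ k i k<i → ≈-trans (q⁻ k i) (≈-trans (-‿cong (bounded k i k<i)) S.-0#≈0#)
    ; ∂-log = λ k → ≈-trans (S.∑-cong k λ i _ → q⁻ k i) (≈-sym (S.∑-hom k -_ (q k) neg-+)) }
    where
    q⁻ : ∀ k i → ∂ k (S.logΩ (- a) (suc i)) ≈ - q k i
    q⁻ k i = ∂-cong k (≈-sym (S.-‿distribʳ-* (con (+ 1 ℚ./ suc i)) (Λ-ψ[1+ i ] a)))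

H-1 : H (+ 1) ≈ p[1+ 0 ]
H-1 = ≈-trans (≈-sym (≈-trans (*-congʳ (reflexive (≡.cong con ℕ→ℚ-1))) (*-identityˡ _)))
  (≈-trans (u-newton Sign.+ 0) (≈-trans (*-congˡ (u-0 Sign.+)) (solveΛ 1 (λ p → K 1ℚ :* p :* K 1ℚ := p) ≈-refl p[1+ 0 ])))

H-2 : H (+ 2) ≈ con ℚ.½ * (p[1+ 0 ] * p[1+ 0 ]) + con ℚ.½ * p[1+ 1 ]
H-2 = ≈-trans (≈-sym (≈-trans (*-congˡ {con ℚ.½} (*-congʳ (≈-trans (reflexive (≡.cong con two)) (con-+ 1ℚ 1ℚ))))
    (solveΛ 1 (λ h → K ℚ.½ :* ((K 1ℚ :+ K 1ℚ) :* h) := h) ≈-refl (H (+ 2)))))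
  (≈-trans (*-congˡ (≈-trans (u-newton Sign.+ 1) (+-cong (*-congˡ H-1) (*-congˡ (u-0 Sign.+)))))
    (solveΛ 2 (λ p r → K ℚ.½ :* (K 1ℚ :* p :* p :+ K 1ℚ :* r :* K 1ℚ) := K ℚ.½ :* (p :* p) :+ K ℚ.½ :* r) ≈-refl p[1+ 0 ] p[1+ 1 ]))
  where
  two : ℕ→ℚ 2 ≡ 1ℚ ℚ.+ 1ℚ
  two = ≡.trans (ℕ→ℚ-suc 1) (≡.cong (1ℚ ℚ.+_) ℕ→ℚ-1)

s-1 : s (1 ∷ []) ≈ p[1+ 0 ]
s-1 = ≈-trans (s-B⁺s (1 ∷ [])) (≈-trans (V-1 Sign.+ (+ 1)) H-1)

s-2 : s (2 ∷ []) ≈ con ℚ.½ * (p[1+ 0 ] * p[1+ 0 ]) + con ℚ.½ * p[1+ 1 ]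
s-2 = ≈-trans (s-B⁺s (2 ∷ [])) (≈-trans (V-1 Sign.+ (+ 2)) H-2)

s-11 : s (1 ∷ 1 ∷ []) ≈ con ℚ.½ * (p[1+ 0 ] * p[1+ 0 ]) + con (ℚ.- ℚ.½) * p[1+ 1 ]
s-11 = ≈-trans (s-B⁺s (1 ∷ 1 ∷ [])) (≈-trans (V-cong Sign.+ (+ 1) (V-1 Sign.+ (+ 1))) (≈-trans (V-u-same Sign.+ (+ 1) (+ 1))
  (≈-trans (+-cong (*-cong H-1 H-1) (-‿cong (*-cong (u-0 Sign.+) H-2)))
    (solveΛ 2 (λ p r → p :* p :+ :- (K 1ℚ :* (K ℚ.½ :* (p :* p) :+ K ℚ.½ :* r)) := K ℚ.½ :* (p :* p) :+ K (ℚ.- ℚ.½) :* r) ≈-refl p[1+ 0 ] p[1+ 1 ]))))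

linear-part quadratic-part : Symbol → ℚ
linear-part □ = 1ℚ
linear-part 𝗁 = 0ℚ
linear-part 𝗏 = 0ℚ
quadratic-part □ = ℚ.- ℚ.½
quadratic-part 𝗁 = ℚ.½
quadratic-part 𝗏 = ℚ.- ℚ.½

f-quadratic : ∀ ◇ → f ◇ ≈ con (linear-part ◇) * p[1+ 0 ] + (con ℚ.½ * (p[1+ 0 ] * p[1+ 0 ]) + con (quadratic-part ◇) * p[1+ 1 ])
f-quadratic □ = +-cong (≈-trans s-1 (≈-sym (*-identityˡ _))) s-11
f-quadratic 𝗁 = ≈-trans s-2 (≈-sym (≈-trans (+-congʳ (zeroˡ _)) (+-identityˡ _)))
f-quadratic 𝗏 = ≈-trans s-11 (≈-sym (≈-trans (+-congʳ (zeroˡ _)) (+-identityˡ _)))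

module Proposition (_⊥ : Λ → Λ → Λ) (⊥-D : ∀ P Q → (P ⊥) Q ≈ D P Q) (◇ : Symbol) (n : ℕ) where
  open Bernstein _⊥
  open Operators _⊥ ⊥-D
  open Main _⊥ ⊥-D
  open Laurent n
  open LaurentRing n
  open Skewed n
  open Monomials n
  open Vandermonde n
  open Plethysm n
  private
    module f◇ = Quadratic {f ◇} (linear-part ◇) (quadratic-part ◇) (f-quadratic ◇)
    module T⁺ = Exponential f◇.log⁺
    module T⁻ = Exponential f◇.log⁻
  open Conjugation f◇.log⁺ f◇.log⁻ f◇.η f◇.κ-η

  series : PowerSeries
  series = Ω⟨ -ᴸ (f ◇ ⟦ Z ⟧) ⟩ ∙ Ω⟨ Z *ᴸ X ⟩

  -- `D-hv` applied to each component of Ω[-f] and summed: Ω[-f[Z]] Ω[ZX] is Ω[ZX] skewed by Ω[-f].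
  series-T⁻ : ∀ α → series α ≈ T⁻.T (hv (Vec.map +_ α))
  series-T⁻ α = begin
    series α
      ≈⟨ ∙-nest Ω⟨ -ᴸ (f ◇ ⟦ Z ⟧) ⟩ Ω⟨ Z *ᴸ X ⟩ α ⟩
    nest α (λ β → Ω⟨ -ᴸ (f ◇ ⟦ Z ⟧) ⟩ β * Ω⟨ Z *ᴸ X ⟩ (Vec.zipWith ℕ._∸_ α β))
      ≈⟨ nest-cong α (λ β β≤α → *-cong (≈-trans (reflexive (≡.cong (λ A → Ω⟨ A ⟩ β) neg-⟦Z⟧))
           (Ω⟨[Z]⟩ (- f ◇) {M} β T⁻.Ω-order (ℕ.≤-trans β≤α (ℕ.m≤m⊔n (Vec.sum α) _)))) (Ω⟨ZX⟩ (Vec.zipWith ℕ._∸_ α β))) ⟩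
    nest α (λ β → ∑ M (λ d → pair (E d) (hv (Vec.map +_ β))) * hv (Vec.map +_ (Vec.zipWith ℕ._∸_ α β)))
      ≈⟨ nest-cong α (λ β _ → S.∑-*ʳ M (hv (Vec.map +_ (Vec.zipWith ℕ._∸_ α β))) (λ d → pair (E d) (hv (Vec.map +_ β)))) ⟨
    nest α (λ β → ∑ M (λ d → pair (E d) (hv (Vec.map +_ β)) * hv (Vec.map +_ (Vec.zipWith ℕ._∸_ α β))))
      ≈⟨ nest-∑ α M (λ d β → pair (E d) (hv (Vec.map +_ β)) * hv (Vec.map +_ (Vec.zipWith ℕ._∸_ α β))) ⟨
    ∑ M (λ d → nest α (λ β → pair (E d) (hv (Vec.map +_ β)) * hv (Vec.map +_ (Vec.zipWith ℕ._∸_ α β))))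
      ≈⟨ S.∑-cong M (λ d _ → D-hv (E d) α) ⟨
    ∑ M (λ d → D (E d) (hv (Vec.map +_ α)))
      ≈⟨ T⁻.T-T≤ (hv (Vec.map +_ α)) (ℕ.m≤n⊔m (Vec.sum α) _) ⟨
    T⁻.T (hv (Vec.map +_ α)) ∎
    where
    open ≈-Reasoning
    E : ℕ → Λ
    E = ΩΛ (- f ◇)
    -- One bound for the coefficients of Ω[-f[Z]] at all β below α and for the skewing of h_α.
    M = Vec.sum α ℕ.⊔ degree (hv (Vec.map +_ α))
    neg-⟦Z⟧ : -ᴸ (f ◇ ⟦ Z ⟧) ≡ (- f ◇) ⟦ Z ⟧
    neg-⟦Z⟧ = ≡.trans (≡.cong -ᴸ_ (⟦Z⟧-[Z] (f ◇))) (≡.sym (⟦Z⟧-[Z] (- f ◇)))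

  module O = Operator (-*X {Z +ᴸ Z*} (scalar-++ scalar-Z scalar-Z*)) (toLaurentSeries series)

  RHS : Λ → Vec ℤ n → Λ
  RHS P = R ⊙ O.W P

  sumTerms-sum : ∀ L m (g : Fin.Fin m → Λ → Vec ℤ n → Λ) → sumTerms L (λ c μ → sum (λ i → g i c μ)) ≈ sum λ i → sumTerms L (g i)
  sumTerms-sum L zero    g = sumTerms-0 L λ _ _ → ≈-refl
  sumTerms-sum L (suc m) g = ≈-trans (sumTerms-+ L (g Fin.zero) _) (+-congˡ (sumTerms-sum L m (g ∘ Fin.suc)))

  -- The rule `W-p*` for Y = -(Z + Z*), written out to match `LHS-p*`: a power of z_i lowers the
  -- exponent read, a power of its inverse raises it.
  W-p*-bump : ∀ k P ν → O.W (p[1+ k ] * P) ν ≈ p[1+ k ] * O.W P ν + - (sum (λ i → O.W P (bump i -[1+ k ] ν)) + sum (λ i → O.W P (bump i (+ suc k) ν)))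
  W-p*-bump k P ν = ≈-trans (O.W-p* k P ν) (+-congˡ (≈-trans (on (ψ-neg k (Z +ᴸ Z*)) _ (⊙-additive (O.W P) ν))
    (≈-trans (sumTerms-neg (ψ k (Z +ᴸ Z*)) _ (⊙-additive (O.W P) ν)) (-‿cong (≈-trans (reflexive (≡.cong (λ L → sumTerms L _) (List.map-++ _ Z Z*)))
      (≈-trans (sumTerms-++ (ψ k Z) (ψ k Z*) _) (+-cong
        (≈-trans (sumTerms-ψZ k _) (sum-cong n λ i → ≈-trans (*-identityˡ _) (reflexive (≡.cong (O.W P) (bump-e (+ suc k) i ν)))))
        (≈-trans (sumTerms-ψZ* k _) (sum-cong n λ i → ≈-trans (*-identityˡ _) (reflexive (≡.cong (O.W P) (bump-e⁻ (+ suc k) i ν))))))))))))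

  RHS-bump : ∀ t P ν → sumTerms R (λ c μ → c * sum (λ i → O.W P (bump i t (Vec.zipWith ℤ._-_ ν μ)))) ≈ sum λ i → RHS P (bump i t ν)
  RHS-bump t P ν = ≈-trans (sumTerms-cong R λ c μ → sum-hom n (c *_) _ (distribˡ c) (zeroʳ c)) (≈-trans
    (sumTerms-sum R n λ i c μ → c * O.W P (bump i t (Vec.zipWith ℤ._-_ ν μ)))
    (sum-cong n λ i → sumTerms-cong R λ c μ → *-congˡ (reflexive (≡.cong (O.W P) (bump-minus i t ν μ)))))

  -- Multiplication by R commutes with p_{1+k} and with all shifts of exponents, so it preserves the
  -- rule for W.
  RHS-p* : ∀ k P ν → RHS (p[1+ k ] * P) ν ≈
    p[1+ k ] * RHS P ν + - (sum (λ i → RHS P (bump i -[1+ k ] ν)) + sum (λ i → RHS P (bump i (+ suc k) ν)))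
  RHS-p* k P ν = ≈-trans (sumTerms-cong R λ c μ → ≈-trans (*-congˡ (W-p*-bump k P (Vec.zipWith ℤ._-_ ν μ)))
      (solveΛ 5 (λ c p w a b → c :* (p :* w :+ :- (a :+ b)) := p :* (c :* w) :+ :- (c :* a :+ c :* b)) ≈-refl c p[1+ k ] _ _ _))
    (≈-trans (sumTerms-+ R _ _) (+-cong (sumTerms-*ˡ R p[1+ k ] _) (≈-trans (≈-sym (sumTerms-hom R -_ _ neg-+ S.-0#≈0#))
      (-‿cong (≈-trans (sumTerms-+ R _ _) (+-cong (RHS-bump -[1+ k ] P ν) (RHS-bump (+ suc k) P ν)))))))

  LHS-RHS-1 : ∀ ν → LHS (con 1ℚ) ν ≈ RHS (con 1ℚ) ν
  LHS-RHS-1 ν = begin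
    T⁻.T (Bv ν (T⁺.T (con 1ℚ)))
      ≈⟨ T⁻.T-cong (≈-trans (Bv-cong ν T⁺.T-1) (≈-sym (differences-pairs ν))) ⟩
    T⁻.T (differences (pairs n) hv ν)
      ≈⟨ differences-hom (pairs n) T⁻.T hv T⁻.T-+ T⁻.T-neg ν ⟩
    differences (pairs n) (T⁻.T ∘ hv) ν
      ≈⟨ factors-⊙ (pairs n) (T⁻.T ∘ hv) ν ⟨
    (R ⊙ (T⁻.T ∘ hv)) ν
      ≈⟨ ⊙-cong R (λ ν → ≈-trans (O.W-1 ν) (toLaurentSeries-≈ series (T⁻.T ∘ hv)
           (λ neg → ≈-trans (T⁻.T-cong (hv-negative neg)) T⁻.T-0) series-T⁻ ν)) ν ⟨
    (R ⊙ O.W (con 1ℚ)) ν ∎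
    where open ≈-Reasoning

  LHS-RHS : ∀ P ν → LHS P ν ≈ RHS P ν
  LHS-RHS = Λ-ind (λ P → ∀ ν → LHS P ν ≈ RHS P ν)
    (λ eq IH ν → ≈-trans (T⁻.T-cong (Bv-cong ν (T⁺.T-cong (≈-sym eq)))) (≈-trans (IH ν) (⊙-cong R (O.W-cong eq) ν)))
    (λ {P} {Q} IH IH′ ν → ≈-trans (T⁻.T-cong (≈-trans (Bv-cong ν (T⁺.T-+ P Q)) (Bv-+ ν _ _))) (≈-trans (T⁻.T-+ _ _) (≈-trans (+-cong (IH ν) (IH′ ν))
      (≈-sym (≈-trans (sumTerms-cong R λ c μ → ≈-trans (*-congˡ {c} (O.W-+ P Q (Vec.zipWith ℤ._-_ ν μ))) (distribˡ c _ _)) (sumTerms-+ R _ _))))))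
    (λ q {P} IH ν → ≈-trans (T⁻.T-cong (≈-trans (Bv-cong ν (T⁺.T-con* q P)) (Bv-con* ν q _))) (≈-trans (T⁻.T-con* q _) (≈-trans (*-congˡ (IH ν))
      (≈-sym (≈-trans (sumTerms-cong R λ c μ → ≈-trans (*-congˡ {c} (O.W-con* q P (Vec.zipWith ℤ._-_ ν μ))) (x∙yz≈y∙xz c _ _)) (sumTerms-*ˡ R (con q) _))))))
    (λ k {P} IH ν → ≈-trans (LHS-p* k P ν) (≈-trans (+-cong (*-congˡ (IH ν)) (-‿cong (+-cong
      (sum-cong n λ i → IH (bump i -[1+ k ] ν)) (sum-cong n λ i → IH (bump i (+ suc k) ν))))) (≈-sym (RHS-p* k P ν))))
    LHS-RHS-1

  conjugated-B : ∀ P ν → B^ ◇ ⟨Z⟩ P ν ≈ RHS P ν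
  conjugated-B P ν = ≈-trans (T⁻.T-cong (B[]-Bv ν (T⁺.T P))) (LHS-RHS P ν)

proposition11 : (⟨_,_⟩ : Λ → Λ → ℚ) (_⊥ : Λ → Λ → Λ) →
    IsHallScalarProduct ⟨_,_⟩ → IsSkewing ⟨_,_⟩ _⊥ →
    let open Bernstein _⊥ in
    (◇ : Symbol) (n : ℕ) → 1 ≤ n →
    let open Laurent n in
    (P : Λ) (ν : Vec ℤ n) →
    B^ ◇ ⟨Z⟩ P ν
    ≈ (R ⊙ ((Ω⟨ -ᴸ (f ◇ ⟦ Z ⟧) ⟩ ∙ Ω⟨ Z *ᴸ X ⟩) · Ω⟨ -ᴸ ((Z +ᴸ Z*) *ᴸ X) ⟩⊥ᴸ P)) ν
proposition11 ⟨_,_⟩ _⊥ hall skewing ◇ n 1≤n = Proposition.conjugated-B _⊥ (skewing-D hall skewing) ◇ n
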